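{- Let $G$ be a countable locally finite abelian group (written additively) such that $2G=\{2g:g\in G\}$ is infinite. Let $G_\bullet=(G_i)_{i\ge 1}$ be an arbitrary filtration of $G$ by finite subgroups, i.e. $G_1\le G_2\le\cdots$ are finite subgroups with $\bigcup_{i\ge1}G_i=G$. Then for all real numbers $0\le\alpha\le\beta\le1$ there exists a set $A\subseteq G$ such that $$\mathcal L_{G_\bullet}(A)=[\alpha,\beta].$$
   Context: An abelian group is locally finite if every finitely generated subgroup is finite. For a subset $A$ of an additive abelian group $G$, $\mathcal P(A):=\{\sum_{a\in F}a : F\subseteq A,\ |F|<\infty\}$ is the set of finite subset sums (sums of distinct elements of $A$), including the empty sum, so $0\in\mathcal P(A)$. For a filtration $G_\bullet=(G_i)_{i\ge1}$ and $S\subseteq G$, put $d_i^{G_\bullet}(S):=|S\cap G_i|/|G_i|$. The set $\mathcal L_{G_\bullet}(A)$ is the set of all subsequential limits of $\bigl(d_i^{G_\bullet}(\mathcal P(A))\bigr)_{i\ge1}$, that is, all $\gamma\in[0,1]$ such that $\lim_{\ell\to\infty}d_{i_\ell}^{G_\bullet}(\mathcal P(A))=\gamma$ for some $i_1<i_2<\cdots$. -}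

module Defs where

open import Algebra.Bundles using (AbelianGroup)
open import Axiom.ExcludedMiddle using (ExcludedMiddle)
open import Data.Integer.Base using (+_)
open import Data.List.Base using (List; foldr; length; filter)
open import Data.List.Relation.Unary.All using (All)
open import Data.List.Relation.Unary.Any using (here; there)
import Data.List.Membership.Setoid as SetoidMembership
import Data.List.Membership.Setoid.Properties as SetoidMembershipProperties
import Data.List.Relation.Unary.Unique.Setoid as SetoidUnique
import Data.List.Relation.Unary.Unique.Setoid.Properties as SetoidUniqueProperties
open import Data.Nat.Base as ℕ using (ℕ; suc; NonZero)
open import Data.Product using (∃; _×_; _,_)
open import Data.Rational.Base as ℚ using (ℚ; 0ℚ; 1ℚ)
open import Data.Rational.Properties using (<-dense; <-trans)
open import Data.Sum.Base using (_⊎_; inj₁; inj₂)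
open import Function.Base using (_∘_)
open import Function.Bundles using (Surjection; _⇔_; mk⇔; Equivalence)
open import Level using (Level; _⊔_; Setω) renaming (suc to lsuc)
open import Relation.Binary.Core using (Rel)
open import Relation.Binary.Definitions using (_Respects_)
import Relation.Binary.PropositionalEquality as ≡
open import Relation.Nullary.Negation using (¬_)
open import Relation.Unary using (Pred; _∈_; _⊆_; _∩_; Decidable)

Classical : Setω
Classical = ∀ {a} → ExcludedMiddle a

------------------------------------------------------------------------
-- Real numbers, as two-sided Dedekind cuts of ℚ

record ℝ : Set₁ where
  field
    L U         : Pred ℚ Level.zero
    L-inhabited : ∃ L
    U-inhabited : ∃ U
    L-open      : ∀ q → L q ⇔ (∃ λ r → q ℚ.< r × L r)
    U-open      : ∀ r → U r ⇔ (∃ λ q → q ℚ.< r × U q)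
    disjoint    : ∀ q → ¬ (L q × U q)
    located     : ∀ q r → q ℚ.< r → L q ⊎ U r

infix 4 _<ᴸ_ _<ᵁ_ _≤ᴿ_

_<ᴸ_ : ℚ → ℝ → Set
q <ᴸ x = ℝ.L x q

_<ᵁ_ : ℝ → ℚ → Set
x <ᵁ q = ℝ.U x q

_≤ᴿ_ : Rel ℝ Level.zero
x ≤ᴿ y = ∀ q → q <ᴸ x → q <ᴸ y

fromℚ : ℚ → ℝ
fromℚ x = record
  { L           = λ q → q ℚ.< x
  ; U           = λ r → x ℚ.< r
  ; L-inhabited = x ℚ.- 1ℚ , below
  ; U-inhabited = x ℚ.+ 1ℚ , above
  ; L-open      = λ q → mk⇔ <-dense λ (r , q<r , r<x) → <-trans q<r r<x
  ; U-open      = λ r → mk⇔ (λ x<r → let (q , x<q , q<r) = <-dense x<r in q , q<r , x<q)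
                            (λ (q , q<r , x<q) → <-trans x<q q<r)
  ; disjoint    = λ q (q<x , x<q) → ℚP.<-asym q<x x<q
  ; located     = loc
  }
  where
  import Data.Rational.Properties as ℚP
  open import Relation.Binary.Definitions using (tri<; tri≈; tri>)

  below : x ℚ.- 1ℚ ℚ.< x
  below = ≡.subst (x ℚ.- 1ℚ ℚ.<_) (ℚP.+-identityʳ x) (ℚP.+-monoʳ-< x (ℚP.negative⁻¹ (ℚ.- 1ℚ)))

  above : x ℚ.< x ℚ.+ 1ℚ
  above = ≡.subst (ℚ._< x ℚ.+ 1ℚ) (ℚP.+-identityʳ x) (ℚP.+-monoʳ-< x (ℚP.positive⁻¹ 1ℚ))

  loc : ∀ q r → q ℚ.< r → (q ℚ.< x) ⊎ (x ℚ.< r)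
  loc q r q<r with ℚP.<-cmp q x
  ... | tri< q<x _ _     = inj₁ q<x
  ... | tri≈ _ ≡.refl _  = inj₂ q<r
  ... | tri> _ _ x<q     = inj₂ (<-trans x<q q<r)

0ᴿ 1ᴿ : ℝ
0ᴿ = fromℚ 0ℚ
1ᴿ = fromℚ 1ℚ

Interval : ℝ → ℝ → Pred ℝ Level.zero
Interval α β γ = α ≤ᴿ γ × γ ≤ᴿ β

-- |sₙ − x| < ε is spelled out as sₙ − ε < x < sₙ + ε; rational ε suffice
-- because ℚ is dense in ℝ.
_ConvergesTo_ : (ℕ → ℚ) → ℝ → Set
s ConvergesTo x = ∀ ε → 0ℚ ℚ.< ε →
  ∃ λ N → ∀ n → N ℕ.≤ n → (s n ℚ.- ε <ᴸ x) × (x <ᵁ s n ℚ.+ ε)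

IsSubsequentialLimit : (ℕ → ℚ) → Pred ℝ Level.zero
IsSubsequentialLimit s x =
  ∃ λ (ι : ℕ → ℕ) → (∀ k → ι k ℕ.< ι (suc k)) × (s ∘ ι) ConvergesTo x

------------------------------------------------------------------------
-- Abelian groups, written additively

module _ {c ℓ : Level} (G : AbelianGroup c ℓ) where

  open AbelianGroup G using (Carrier; _≈_; setoid)
    renaming (_∙_ to _+_; ε to 0#; _⁻¹ to -_)
  private
    module G = AbelianGroup G
    module M = SetoidMembership setoid
    module MP = SetoidMembershipProperties
    module U = SetoidUnique setoid
    module UP = SetoidUniqueProperties

  IsCountable : Set (c ⊔ ℓ)
  IsCountable = Surjection (≡.setoid ℕ) setoid

  -- The enumeration is without repetition, so its length is the cardinality.
  record Finite {p} (S : Pred Carrier p) : Set (c ⊔ ℓ ⊔ p) where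
    field
      elements : List Carrier
      unique   : U.Unique elements
      exact    : ∀ x → x ∈ S ⇔ x M.∈ elements

  card : ∀ {p} {S : Pred Carrier p} → Finite S → ℕ
  card S-finite = length (Finite.elements S-finite)

  record IsSubgroup {p} (H : Pred Carrier p) : Set (c ⊔ ℓ ⊔ p) where
    field
      resp       : H Respects _≈_
      0-closed   : 0# ∈ H
      +-closed   : ∀ {x y} → x ∈ H → y ∈ H → x + y ∈ H
      neg-closed : ∀ {x} → x ∈ H → - x ∈ H

  data ⟨_⟩ (xs : List Carrier) : Pred Carrier (c ⊔ ℓ) where
    generator : ∀ {x} → x M.∈ xs → ⟨ xs ⟩ x
    zero      : ⟨ xs ⟩ 0#
    plus      : ∀ {x y} → ⟨ xs ⟩ x → ⟨ xs ⟩ y → ⟨ xs ⟩ (x + y)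
    minus     : ∀ {x} → ⟨ xs ⟩ x → ⟨ xs ⟩ (- x)
    resp      : ∀ {x y} → x ≈ y → ⟨ xs ⟩ x → ⟨ xs ⟩ y

  IsLocallyFinite : Set (c ⊔ ℓ)
  IsLocallyFinite = ∀ xs → Finite ⟨ xs ⟩

  Doubles : Pred Carrier (c ⊔ ℓ)
  Doubles x = ∃ λ g → x ≈ g + g

  -- Indexed from 0: `stage i` is the (i+1)-st subgroup of the filtration.
  record Filtration (p : Level) : Set (c ⊔ ℓ ⊔ lsuc p) where
    field
      stage      : ℕ → Pred Carrier p
      isSubgroup : ∀ i → IsSubgroup (stage i)
      finite     : ∀ i → Finite (stage i)
      ascending  : ∀ i → stage i ⊆ stage (suc i)
      exhaustive : ∀ x → ∃ λ i → x ∈ stage i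

  -- A finite subset F of A is a repetition-free list of elements of A.
  SubsetSums : ∀ {a} → Pred Carrier a → Pred Carrier (c ⊔ ℓ ⊔ a)
  SubsetSums A x = ∃ λ (F : List Carrier) → U.Unique F × All A F × x ≈ foldr _+_ 0# F

  SubsetSums-resp : ∀ {a} (A : Pred Carrier a) → SubsetSums A Respects _≈_
  SubsetSums-resp A x≈y (F , uniq , F⊆A , x≈ΣF) = F , uniq , F⊆A , G.trans (G.sym x≈y) x≈ΣF

  ∩-finite : ∀ {p q} {S : Pred Carrier p} {T : Pred Carrier q} →
             Decidable S → S Respects _≈_ → Finite T → Finite (S ∩ T)
  ∩-finite S? S-resp T-finite = record
    { elements = filter S? elements
    ; unique   = UP.filter⁺ setoid S? unique
    ; exact    = λ x → mk⇔
        (λ (x∈S , x∈T) → MP.∈-filter⁺ setoid S? S-resp (Equivalence.to (exact x) x∈T) x∈S)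
        (λ x∈F → let (x∈T , x∈S) = MP.∈-filter⁻ setoid S? S-resp x∈F
                 in x∈S , Equivalence.from (exact x) x∈T)
    }
    where open Finite T-finite

  module _ {p : Level} (G• : Filtration p) where
    open Filtration G•

    card-stage-nonZero : ∀ i → NonZero (card (finite i))
    card-stage-nonZero i =
      inhabited (Equivalence.to (Finite.exact (finite i) 0#) (IsSubgroup.0-closed (isSubgroup i)))
      where
      inhabited : ∀ {x xs} → x M.∈ xs → NonZero (length xs)
      inhabited (here _)  = _
      inhabited (there _) = _

    density : ∀ {s} {S : Pred Carrier s} → Decidable S → S Respects _≈_ → ℕ → ℚ
    density S? S-resp i = + card (∩-finite S? S-resp (finite i)) ℚ./ card (finite i)
      where instance _ = card-stage-nonZero i

    -- Excluded middle is used only to count the elements of SubsetSums A.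
    𝓛 : Classical → ∀ {a} → Pred Carrier a → Pred ℝ Level.zero
    𝓛 em A γ = 0ᴿ ≤ᴿ γ × γ ≤ᴿ 1ᴿ ×
      IsSubsequentialLimit (density (λ x → em {P = SubsetSums A x}) (SubsetSums-resp A)) γ

{-# OPTIONS --safe #-}
module Submission where

-- A is the union of a chain of finite sets L whose subset sums S L never change
-- inside an earlier stage.  Let K be the current finite subgroup.  Adjoining to L
-- elements with the subset sums 0, c, …, (N − 1)c, where c has order N modulo K,
-- keeps the density of S L.  The density drops a little when few cosets of a large
-- extension of K are left empty.  If there are c of arbitrarily large order modulo
-- K, then 0, c, …, (N − 1 − m)c are used.  Otherwise, since 2G is infinite, there
-- are independent z₁, …, zₛ of order at least 3 with ⟨z₁, …, zₛ⟩ ∩ K = 0, and some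
-- set has all elements of Q = ⟨z₁, …, zₛ⟩ but one as its subset sums.  In both cases
-- the set T of representatives used satisfies T ∪ (T + q) = everything for some q,
-- and this q makes it possible to return to the old density: if 2c ∉ K, then
-- adjoining elements with the sums {0, …, N − 2}c + {0, c + q} leaves S L unchanged
-- on K itself but gives S L ∪ (S L + q) on the cosets of c, …, (N − 2)c.  So from a
-- density above β one can descend to any rational above α and climb back, with all
-- densities in between controlled by comparing cosets; doing this for all
-- fractions a/b with b → ∞ produces exactly the limit points [α , β].

open import Data.Product using (Σ; ∃; _×_; _,_; proj₁; proj₂)
open import Relation.Binary.PropositionalEquality hiding (J; setoid)

-- The filtration is arbitrary, so densities must be controlled at every stage between two
-- constructed subgroups, and a few empty cosets could fill a large share of a stage in between. The
-- elements for a drop are therefore taken from the first stage that contains suitable ones: the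
-- empty cosets then all appear at once in the last stage of the move, where their share is known.
-- Climbing back must not overshoot at any intermediate stage. This is read off from comparisons
-- coset by coset (`Above`, `Below`), which, unlike an inequality of densities, are inherited by all
-- stages in between and survive the addition of a fixed set. An element c with 2c in K is useless
-- for the climb: only the cosets of 0 and c exist, and on neither of them do the two translates
-- unite. This is why 2G has to be infinite. Finally, a subset sum uses each element once, so the
-- multiples 0, ..., m of c must come from distinct elements. A fixed nontrivial group `K₀` of
-- periods leaves room to choose them.

module Rationals where
  open import Data.Integer.Base as ℤ using (ℤ; +_)
  import Data.Integer.Properties as ℤP
  open import Data.Nat.Base as ℕ using (ℕ; zero; suc)
  import Data.Nat.Properties as ℕP
  open import Data.Rational.Base hiding (∣_∣)
  open import Data.Rational.Properties
  import Data.Rational.Unnormalised.Base as ℚᵘ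
  import Data.Rational.Unnormalised.Properties as ℚᵘP
  open import Data.Rational.Solver using (module +-*-Solver)

  private
    u : ℕ → ℕ → ℚᵘ.ℚᵘ
    u a b = ℚᵘ.mkℚᵘ (+ a) b

  fromℚᵘ-mono-≤ : ∀ {p q} → p ℚᵘ.≤ q → fromℚᵘ p ≤ fromℚᵘ q
  fromℚᵘ-mono-≤ {p} {q} p≤q = toℚᵘ-cancel-≤
    (ℚᵘP.≤-respˡ-≃ (ℚᵘP.≃-sym (toℚᵘ-fromℚᵘ p)) (ℚᵘP.≤-respʳ-≃ (ℚᵘP.≃-sym (toℚᵘ-fromℚᵘ q)) p≤q))

  fromℚᵘ-mono-< : ∀ {p q} → p ℚᵘ.< q → fromℚᵘ p < fromℚᵘ q
  fromℚᵘ-mono-< {p} {q} p<q = toℚᵘ-cancel-<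
    (ℚᵘP.<-respˡ-≃ (ℚᵘP.≃-sym (toℚᵘ-fromℚᵘ p)) (ℚᵘP.<-respʳ-≃ (ℚᵘP.≃-sym (toℚᵘ-fromℚᵘ q)) p<q))

  fromℚᵘ-+ : ∀ p q → fromℚᵘ p + fromℚᵘ q ≡ fromℚᵘ (p ℚᵘ.+ q)
  fromℚᵘ-+ p q = toℚᵘ-injective (ℚᵘP.≃-trans (toℚᵘ-homo-+ (fromℚᵘ p) (fromℚᵘ q))
    (ℚᵘP.≃-trans (ℚᵘP.+-cong (toℚᵘ-fromℚᵘ p) (toℚᵘ-fromℚᵘ q)) (ℚᵘP.≃-sym (toℚᵘ-fromℚᵘ (p ℚᵘ.+ q)))))

  fromℚᵘ-* : ∀ p q → fromℚᵘ p * fromℚᵘ q ≡ fromℚᵘ (p ℚᵘ.* q)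
  fromℚᵘ-* p q = toℚᵘ-injective (ℚᵘP.≃-trans (toℚᵘ-homo-* (fromℚᵘ p) (fromℚᵘ q))
    (ℚᵘP.≃-trans (ℚᵘP.*-cong (toℚᵘ-fromℚᵘ p) (toℚᵘ-fromℚᵘ q)) (ℚᵘP.≃-sym (toℚᵘ-fromℚᵘ (p ℚᵘ.* q)))))

  abstract
    -- The value 0 for denominator 0 avoids carrying `NonZero` instances. The definition is opaque,
    -- so that type checking does not unfold the normalisation of `ℚ`.
    frac : ℕ → ℕ → ℚ
    frac a zero    = 0ℚ
    frac a (suc b) = + a / suc b

  ι : ℕ → ℚ
  ι n = frac n 1

  abstract

    ι-mono-≤ : ∀ {m n} → m ℕ.≤ n → ι m ≤ ι n
    ι-mono-≤ {m} {n} m≤n = fromℚᵘ-mono-≤ {u m 0} {u n 0}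
      (ℚᵘ.*≤* (ℤP.*-monoʳ-≤-nonNeg (+ 1) (ℤ.+≤+ m≤n)))

    ι-mono-< : ∀ {m n} → m ℕ.< n → ι m < ι n
    ι-mono-< {m} {n} m<n = fromℚᵘ-mono-< {u m 0} {u n 0}
      (ℚᵘ.*<* (ℤP.*-monoʳ-<-pos (+ 1) (ℤ.+<+ m<n)))

    ι-0 : ι 0 ≡ 0ℚ
    ι-0 = refl

    ι-1 : ι 1 ≡ 1ℚ
    ι-1 = refl

    ι-+ : ∀ m n → ι (m ℕ.+ n) ≡ ι m + ι n
    ι-+ m n = sym (trans (fromℚᵘ-+ (u m 0) (u n 0)) (fromℚᵘ-cong {u m 0 ℚᵘ.+ u n 0} {u (m ℕ.+ n) 0}
      (ℚᵘ.*≡* (cong (ℤ._* + 1) (cong₂ ℤ._+_ (ℤP.*-identityʳ (+ m)) (ℤP.*-identityʳ (+ n)))))))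

    ι-* : ∀ m n → ι (m ℕ.* n) ≡ ι m * ι n
    ι-* m n = sym (trans (fromℚᵘ-* (u m 0) (u n 0)) (fromℚᵘ-cong {u m 0 ℚᵘ.* u n 0} {u (m ℕ.* n) 0}
      (ℚᵘ.*≡* (cong (ℤ._* + 1) (sym (ℤP.pos-* m n))))))

    -- This determines `frac a b`: the later identities and inequalities of fractions are obtained
    -- by multiplying out denominators and cancelling a positive `ι n`.
    ι-frac : ∀ a {b} → 0 ℕ.< b → ι b * frac a b ≡ ι a
    ι-frac a {suc b} _ = trans (fromℚᵘ-* (u (suc b) 0) (u a b))
      (fromℚᵘ-cong {u (suc b) 0 ℚᵘ.* u a b} {u a 0}
        (ℚᵘ.*≡* (trans (ℤP.*-identityʳ (+ suc b ℤ.* + a)) (trans (ℤP.*-comm (+ suc b) (+ a))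
          (cong (λ n → + a ℤ.* + suc n) (sym (ℕP.+-identityʳ b)))))))

    frac-/ : ∀ a b .{{_ : ℕ.NonZero b}} → + a / b ≡ frac a b
    frac-/ a (suc b) = refl

    archimedean : ∀ {ε} → 0ℚ < ε → ∃ λ M → 2 ℕ.≤ M × frac 1 M ≤ ε
    archimedean {ε} 0<ε with ε | positive 0<ε
    ... | mkℚ (+ suc n) d c | _ = suc (suc (d ℕ.+ d)) , ℕ.s≤s (ℕ.s≤s ℕ.z≤n) ,
      subst (frac 1 (suc (suc (d ℕ.+ d))) ≤_) (fromℚᵘ-toℚᵘ (mkℚ (+ suc n) d c))
        (fromℚᵘ-mono-≤ {u 1 (suc (d ℕ.+ d))} {ℚᵘ.mkℚᵘ (+ suc n) d}
          (ℚᵘ.*≤* (ℤ.+≤+ (ℕP.≤-trans (ℕP.≤-reflexive (ℕP.*-identityˡ (suc d)))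
            (ℕP.≤-trans (ℕ.s≤s (ℕP.m≤n⇒m≤1+n (ℕP.m≤m+n d d))) (ℕP.m≤m+n (suc (suc (d ℕ.+ d))) _))))))

    frac-0 : ∀ a → frac a 0 ≡ 0ℚ
    frac-0 a = refl

  0≤ι : ∀ n → 0ℚ ≤ ι n
  0≤ι n = subst (_≤ ι n) ι-0 (ι-mono-≤ ℕ.z≤n)

  ι-positive : ∀ {n} → 0 ℕ.< n → Positive (ι n)
  ι-positive {n} 0<n = positive (subst (_< ι n) ι-0 (ι-mono-< 0<n))

  ι-cancel-≤ : ∀ {n p q} → 0 ℕ.< n → ι n * p ≤ ι n * q → p ≤ q
  ι-cancel-≤ {n} 0<n = *-cancelˡ-≤-pos (ι n) {{ι-positive 0<n}}

  ι-cancel-≡ : ∀ {n p q} → 0 ℕ.< n → ι n * p ≡ ι n * q → p ≡ q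
  ι-cancel-≡ 0<n eq = ≤-antisym (ι-cancel-≤ 0<n (≤-reflexive eq)) (ι-cancel-≤ 0<n (≤-reflexive (sym eq)))

  ι*-mono : ∀ n {p q} → p ≤ q → ι n * p ≤ ι n * q
  ι*-mono n = *-monoˡ-≤-nonNeg (ι n) {{nonNegative (0≤ι n)}}

  0≤frac : ∀ a b → 0ℚ ≤ frac a b
  0≤frac a zero    = ≤-reflexive (sym (frac-0 a))
  0≤frac a (suc b) = ι-cancel-≤ {suc b} (ℕ.s≤s ℕ.z≤n)
    (subst₂ _≤_ (sym (*-zeroʳ (ι (suc b)))) (sym (ι-frac a (ℕ.s≤s ℕ.z≤n))) (0≤ι a))

  frac-mono : ∀ {a b c d} → 0 ℕ.< b → 0 ℕ.< d → a ℕ.* d ℕ.≤ c ℕ.* b → frac a b ≤ frac c d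
  frac-mono {a} {b} {c} {d} 0<b 0<d ad≤cb = ι-cancel-≤ 0<b (ι-cancel-≤ 0<d (begin
    ι d * (ι b * frac a b) ≡⟨ cong (ι d *_) (ι-frac a 0<b) ⟩
    ι d * ι a              ≡⟨ *-comm (ι d) (ι a) ⟩
    ι a * ι d              ≡⟨ ι-* a d ⟨
    ι (a ℕ.* d)            ≤⟨ ι-mono-≤ ad≤cb ⟩
    ι (c ℕ.* b)            ≡⟨ ι-* c b ⟩
    ι c * ι b              ≡⟨ cong (_* ι b) (ι-frac c 0<d) ⟨
    ι d * frac c d * ι b   ≡⟨ solve 3 (λ d b f → d :* f :* b := d :* (b :* f)) refl (ι d) (ι b) (frac c d) ⟩
    ι d * (ι b * frac c d) ∎))
    where open ≤-Reasoning
          open +-*-Solver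

  0≤p-q : ∀ {p q} → q ≤ p → 0ℚ ≤ p - q
  0≤p-q {p} {q} q≤p = subst (_≤ p - q) (+-inverseʳ q) (+-monoˡ-≤ (- q) q≤p)

  +-nonNeg : ∀ {p q} → 0ℚ ≤ p → 0ℚ ≤ q → 0ℚ ≤ p + q
  +-nonNeg {p} {q} 0≤p 0≤q = subst (_≤ p + q) (+-identityˡ 0ℚ) (+-mono-≤ 0≤p 0≤q)

  ≤-by : ∀ {p q} r → 0ℚ ≤ r → q ≡ p + r → p ≤ q
  ≤-by {p} r 0≤r refl = subst (_≤ p + r) (+-identityʳ p) (+-monoʳ-≤ p 0≤r)

  halves : ∀ {M} → 0 ℕ.< M → frac 1 (M ℕ.+ M) + frac 1 (M ℕ.+ M) ≡ frac 1 M
  halves {M} 0<M = ι-cancel-≡ {M} 0<M (begin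
    ι M * (f + f)     ≡⟨ solve 2 (λ m f → m :* (f :+ f) := (m :+ m) :* f) refl (ι M) f ⟩
    (ι M + ι M) * f   ≡⟨ cong (_* f) (ι-+ M M) ⟨
    ι (M ℕ.+ M) * f   ≡⟨ ι-frac 1 (ℕP.≤-trans 0<M (ℕP.m≤m+n M M)) ⟩
    ι 1               ≡⟨ ι-frac 1 0<M ⟨
    ι M * frac 1 M    ∎)
    where open ≡-Reasoning
          open +-*-Solver
          f = frac 1 (M ℕ.+ M)

  frac-suc : ∀ a {b} → 0 ℕ.< b → frac a b + frac 1 b ≡ frac (suc a) b
  frac-suc a {b} 0<b = ι-cancel-≡ 0<b (begin
    ι b * (frac a b + frac 1 b)        ≡⟨ *-distribˡ-+ (ι b) (frac a b) (frac 1 b) ⟩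
    ι b * frac a b + ι b * frac 1 b    ≡⟨ cong₂ _+_ (ι-frac a 0<b) (ι-frac 1 0<b) ⟩
    ι a + ι 1                          ≡⟨ +-comm (ι a) (ι 1) ⟩
    ι 1 + ι a                          ≡⟨ ι-+ 1 a ⟨
    ι (suc a)                          ≡⟨ ι-frac (suc a) 0<b ⟨
    ι b * frac (suc a) b               ∎)
    where open ≡-Reasoning

  frac-< : ∀ {b M} → 0 ℕ.< b → b ℕ.< M → frac 1 M < frac 1 b
  frac-< {b} {M} 0<b b<M = ≰⇒> λ fb≤fM → <-irrefl refl (<-≤-trans (ι-mono-< b<M) (begin
    ι M                     ≡⟨ *-identityʳ (ι M) ⟨
    ι M * 1ℚ                ≡⟨ cong (ι M *_) (trans (ι-frac 1 0<b) ι-1) ⟨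
    ι M * (ι b * frac 1 b)  ≤⟨ ι*-mono M (ι*-mono b fb≤fM) ⟩
    ι M * (ι b * frac 1 M)  ≡⟨ solve 3 (λ m b f → m :* (b :* f) := b :* (m :* f)) refl (ι M) (ι b) (frac 1 M) ⟩
    ι b * (ι M * frac 1 M)  ≡⟨ cong (ι b *_) (trans (ι-frac 1 (ℕP.<-trans 0<b b<M)) ι-1) ⟩
    ι b * 1ℚ                ≡⟨ *-identityʳ (ι b) ⟩
    ι b                     ∎))
    where open ≤-Reasoning
          open +-*-Solver

  frac-self : ∀ {b} → 0 ℕ.< b → frac b b ≡ 1ℚ
  frac-self {b} 0<b = ι-cancel-≡ 0<b (trans (ι-frac b 0<b) (sym (*-identityʳ (ι b))))

  0<frac : ∀ {b} → 0 ℕ.< b → 0ℚ < frac 1 b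
  0<frac {b} 0<b = ≤-<-trans (0≤frac 1 (suc b)) (frac-< 0<b (ℕP.n<1+n b))

  frac-zero : ∀ {b} → 0 ℕ.< b → frac 0 b ≡ 0ℚ
  frac-zero {b} 0<b = ι-cancel-≡ 0<b (trans (ι-frac 0 0<b) (trans ι-0 (sym (*-zeroʳ (ι b)))))

  0<p-q : ∀ {p q} → q < p → 0ℚ < p - q
  0<p-q {p} {q} q<p = subst (_< p - q) (+-inverseʳ q) (+-monoˡ-< (- q) q<p)

  p<p+r : ∀ p {r} → 0ℚ < r → p < p + r
  p<p+r p {r} 0<r = subst (_< p + r) (+-identityʳ p) (+-monoʳ-< p 0<r)

  +-cancelʳ-< : ∀ r p q → p + r < q + r → p < q
  +-cancelʳ-< r p q p+r<q+r = subst₂ _<_ (solve 2 (λ p r → p :+ r :- r := p) refl p r)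
    (solve 2 (λ q r → q :+ r :- r := q) refl q r)
    (+-monoˡ-< (- r) p+r<q+r)
    where open +-*-Solver

open import Algebra.Bundles using (AbelianGroup)
open import Algebra.Structures using (IsAbelianGroup)
import Algebra.Properties.CommutativeMonoid.Mult
import Algebra.Properties.Group
import Algebra.Properties.Monoid.Mult
import Algebra.Solver.CommutativeMonoid
import Algebra.Solver.CommutativeMonoid.Normal
open import Axiom.ExcludedMiddle using (ExcludedMiddle)
import Axiom.UniquenessOfIdentityProofs.WithK as WithK
open import Data.Bool.Base using (if_then_else_)
open import Data.Empty using (⊥)
open import Data.Fin.Base using (Fin; toℕ)
open import Data.Fin.Properties using (pigeonhole)
import Data.List.Base
open import Data.List.Base using (List; []; _∷_; _++_; map; length; foldr; filter; applyUpTo)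
open import Data.List.Properties using (length-map; length-++)
import Data.List.Membership.Setoid as SetoidMembership
import Data.List.Membership.Setoid.Properties as SetoidMembershipProperties
open import Data.List.Relation.Unary.All using (All; []; _∷_)
import Data.List.Relation.Unary.All as All
import Data.List.Relation.Unary.All.Properties as All
open import Data.List.Relation.Unary.AllPairs using ([]; _∷_)
open import Data.List.Relation.Unary.Any using (here; there)
import Data.List.Relation.Unary.Any as Any
import Data.List.Relation.Unary.Unique.Setoid.Properties as SetoidUnique
open import Data.Nat.Base
open import Data.Nat.Induction using (<-wellFounded; Acc; acc)
open import Data.Nat.Properties
import Data.Nat.Solver as ℕSolver
open import Data.Rational.Base as ℚ using (ℚ; 0ℚ; 1ℚ)
import Data.Rational.Properties as ℚP
import Data.Rational.Solver as ℚSolver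
open import Data.Sum.Base using (_⊎_; inj₁; inj₂)
open import Data.Unit.Base using (⊤; tt)
open import Data.Vec.Base using (Vec; lookup)
open import Data.Vec.N-ary using (N-ary; curryⁿ; curryⁿ-cong; Eq)
open import Function.Base using (_∘_; id)
open import Function.Bundles using (_⇔_; mk⇔; Equivalence; Surjection)
open import Level using (0ℓ)
open import Relation.Binary.Definitions using (_Respects_; tri<; tri≈; tri>)
import Relation.Binary.PropositionalEquality as ≡
import Relation.Binary.Reflection
open import Relation.Nullary using (Dec; yes; no; does; contradiction)
open import Relation.Nullary.Negation using (¬_)
open import Defs using (ℝ; _<ᴸ_; _<ᵁ_; _≤ᴿ_; 0ᴿ; 1ᴿ; Interval; IsSubsequentialLimit)
open Rationals renaming (+-cancelʳ-< to +ℚ-cancelʳ-<)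

least : ∀ {ℓ} → ExcludedMiddle ℓ → (P : ℕ → Set ℓ) → ∃ P → ∃ λ n → P n × (∀ {m} → m < n → ¬ P m)
least em P (n , p) = go n p (<-wellFounded n)
  where
  go : ∀ n → P n → Acc _<_ n → ∃ λ n → P n × (∀ {m} → m < n → ¬ P m)
  go n p (acc rs) with em {∃ λ m → m < n × P m}
  ... | yes (m , m<n , q) = go m q (rs m<n)
  ... | no none           = n , p , λ m<n q → none (_ , m<n , q)

-- Dedekind cuts and subsequential limits

module Cut (x : ℝ) where
  open ℝ x

  L-down : ∀ {q r} → q ℚ.< r → L r → L q
  L-down q<r Lr = Equivalence.from (L-open _) (_ , q<r , Lr)

  L-down≤ : ∀ {q r} → q ℚ.≤ r → L r → L q
  L-down≤ {q} {r} q≤r Lr = let (s , r<s , Ls) = Equivalence.to (L-open r) Lr in L-down (ℚP.≤-<-trans q≤r r<s) Ls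

  U-up : ∀ {q r} → q ℚ.< r → U q → U r
  U-up q<r Uq = Equivalence.from (U-open _) (_ , q<r , Uq)

  U-up≤ : ∀ {q r} → q ℚ.≤ r → U q → U r
  U-up≤ {q} q≤r Uq = let (s , s<q , Us) = Equivalence.to (U-open q) Uq in U-up (ℚP.<-≤-trans s<q q≤r) Us

  L<U : ∀ {q r} → L q → U r → q ℚ.< r
  L<U {q} {r} Lq Ur = ℚP.≰⇒> λ r≤q → disjoint q (Lq , U-up≤ r≤q Ur)

  ¬U⇒L : ∀ {q r} → q ℚ.< r → ¬ U r → L q
  ¬U⇒L {q} {r} q<r ¬Ur with located q r q<r
  ... | inj₁ Lq = Lq
  ... | inj₂ Ur = contradiction Ur ¬Ur

  ¬L⇒U : ∀ {q r} → q ℚ.< r → ¬ L q → U r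
  ¬L⇒U {q} {r} q<r ¬Lq with located q r q<r
  ... | inj₁ Lq = contradiction Lq ¬Lq
  ... | inj₂ Ur = Ur

≤ᴿ⇒U : ∀ {x y} → x ≤ᴿ y → ∀ {q} → y <ᵁ q → x <ᵁ q
≤ᴿ⇒U {x} {y} x≤y {q} y<q = let (r , r<q , y<r) = Equivalence.to (ℝ.U-open y q) y<q in
  Cut.¬L⇒U x r<q λ r<x → ℝ.disjoint y r (x≤y r r<x , y<r)

≤1⇒U : ∀ {x} → x ≤ᴿ 1ᴿ → ∀ {q} → 1ℚ ℚ.< q → x <ᵁ q
≤1⇒U {x} x≤1 1<q = Cut.¬L⇒U x 1<q λ 1<x → ℚP.<-irrefl refl (x≤1 1ℚ 1<x)

0≤⇒¬U0 : ∀ {x} → 0ᴿ ≤ᴿ x → ¬ x <ᵁ 0ℚ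
0≤⇒¬U0 {x} 0≤x x<0 = let (r , r<0 , x<r) = Equivalence.to (ℝ.U-open x 0ℚ) x<0 in ℝ.disjoint x r (0≤x r r<0 , x<r)

module SubsequentialLimits (em : ExcludedMiddle 0ℓ) (α β : ℝ) (0≤α : 0ᴿ ≤ᴿ α) (α≤β : α ≤ᴿ β) (β≤1 : β ≤ᴿ 1ᴿ) where

  -- Rounding down to the grid of mesh 1/b: starting from any numerator beyond b x, excluded middle
  -- on the cut decides when to stop.
  least-numerator : ∀ b → 0 < b → ∀ x → 0ᴿ ≤ᴿ x → ∀ k → x <ᵁ frac k b →
                    ∃ λ a → a < k × x <ᵁ frac (suc a) b × ¬ x <ᵁ frac a b
  least-numerator b 0<b x 0≤x zero x<0 = contradiction (subst (x <ᵁ_) (frac-zero 0<b) x<0) (0≤⇒¬U0 {x} 0≤x)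
  least-numerator b 0<b x 0≤x (suc k) x<k with em {x <ᵁ frac k b}
  ... | yes x<k′ = let (a , a<k , p) = least-numerator b 0<b x 0≤x k x<k′ in a , m<n⇒m<1+n a<k , p
  ... | no x≮k′  = k , n<1+n k , x<k , x≮k′

  -- `low` and `high` keep limit points inside the interval, `visit` makes every point of it a limit
  -- point. Grid points above `β` need not be reached; being near `β` is enough for them. The
  -- numerators go up to b + 1, with b = 2 + n, because the grid cell that starts at 1 ends at (b +
  -- 1)/b.
  record Oscillates (s : ℕ → ℚ) : Set where
    field
      low   : ∀ j {r} → r <ᴸ α → r ℚ.≤ s j
      high  : ∀ {ρ} → β <ᵁ ρ → ∃ λ J → ∀ {j} → J ≤ j → s j ℚ.≤ ρ
      visit : ∀ n {a} → a < 2 + (2 + n) → α <ᵁ frac a (2 + n) →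
              ∃ λ j → n ≤ j × s j ℚ.≤ frac a (2 + n) ℚ.+ frac 1 (2 + n) ×
              (frac a (2 + n) ℚ.≤ s j ⊎ (∀ {q} → q <ᴸ β → q ℚ.< s j ℚ.+ frac 1 (2 + n)))

  module _ {s : ℕ → ℚ} (osc : Oscillates s) where
    open Oscillates osc
    open ℚSolver.+-*-Solver using (solve; _:+_; _:-_; _:=_)

    limit⇒interval : ∀ {γ} → IsSubsequentialLimit s γ → Interval α β γ
    limit⇒interval {γ} (ι , ι-mono , conv) = α≤γ , γ≤β
      where
      n≤ι : ∀ n → n ≤ ι n
      n≤ι zero    = z≤n
      n≤ι (suc n) = ≤-<-trans (n≤ι n) (ι-mono n)
      α≤γ : α ≤ᴿ γ
      α≤γ q q<α = let (r , q<r , r<α) = Equivalence.to (ℝ.L-open α q) q<α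
                      (N , close) = conv (r ℚ.- q) (0<p-q q<r) in
        Cut.L-down≤ γ (subst (ℚ._≤ s (ι N) ℚ.- (r ℚ.- q)) (solve 2 (λ r q → r :- (r :- q) := q) refl r q)
          (ℚP.+-monoˡ-≤ (ℚ.- (r ℚ.- q)) (low (ι N) r<α))) (proj₁ (close N ≤-refl))
      γ≤β : γ ≤ᴿ β
      γ≤β q q<γ with em {q <ᴸ β}
      ... | yes q<β = q<β
      ... | no q≮β =
        let (r , q<r , r<γ) = Equivalence.to (ℝ.L-open γ q) q<γ
            (ρ , q<ρ , ρ<r) = ℚP.<-dense q<r
            (J , below) = high (Cut.¬L⇒U β q<ρ q≮β)
            (N , close) = conv (r ℚ.- ρ) (0<p-q ρ<r)
            n = N ⊔ J in
        contradiction (r<γ , Cut.U-up≤ γ (subst (s (ι n) ℚ.+ (r ℚ.- ρ) ℚ.≤_)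
          (solve 2 (λ r ρ → ρ :+ (r :- ρ) := r) refl r ρ)
          (ℚP.+-monoˡ-≤ (r ℚ.- ρ) (below (≤-trans (m≤n⊔m N J) (n≤ι n))))) (proj₂ (close n (m≤m⊔n N J))))
          (ℝ.disjoint γ r)

    module Approach (γ : ℝ) (α≤γ : α ≤ᴿ γ) (γ≤β : γ ≤ᴿ β) where
      0≤γ : 0ᴿ ≤ᴿ γ
      0≤γ q = α≤γ q ∘ 0≤α q

      -- The grid point aimed at is the upper end of the cell of `γ`, so it exceeds `γ` by at most
      -- one step, and the visit exceeds it by at most one more. From below, the visit is either not
      -- under that grid point or within one step of `β`, which is at least `γ`.
      near : ∀ n → ∃ λ j → n ≤ j × (∀ {ε} → frac 1 (2 + n) ℚ.+ frac 1 (2 + n) ℚ.< ε →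
        s j ℚ.- ε <ᴸ γ × γ <ᵁ s j ℚ.+ ε)
      near n =
        let b = 2 + n
            f = frac 1 b
            (a , a≤b , γ<a+1 , γ≮a) = least-numerator b (s≤s z≤n) γ 0≤γ (suc b)
              (≤1⇒U {γ} (λ q → β≤1 q ∘ γ≤β q) (subst (1ℚ ℚ.<_)
                (trans (cong (ℚ._+ f) (sym (frac-self {b} (s≤s z≤n)))) (frac-suc b (s≤s z≤n)))
                (p<p+r 1ℚ (0<frac {b} (s≤s z≤n)))))
            (j , n≤j , upper , lower) = visit n (s≤s a≤b) (≤ᴿ⇒U {α} {γ} α≤γ γ<a+1) in
        j , n≤j , λ {ε} 2f<ε →
          Cut.¬U⇒L γ (ℚP.≤-<-trans (ℚP.+-monoˡ-≤ (ℚ.- ε) upper)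
            (subst₂ ℚ._<_ (trans (solve 3 (λ a f ε → a :+ (f :+ f) :- ε := a :+ f :+ f :- ε) refl (frac a b) f ε)
                (cong (λ w → w ℚ.+ f ℚ.- ε) (frac-suc a (s≤s z≤n))))
              (solve 2 (λ a ε → a :+ ε :- ε := a) refl (frac a b) ε)
              (ℚP.+-monoˡ-< (ℚ.- ε) (ℚP.+-monoʳ-< (frac a b) 2f<ε)))) γ≮a
          , above γ<a+1 lower 2f<ε
        where
        above : ∀ {a j ε} → γ <ᵁ frac a (2 + n) →
                (frac a (2 + n) ℚ.≤ s j ⊎ (∀ {q} → q <ᴸ β → q ℚ.< s j ℚ.+ frac 1 (2 + n))) →
                frac 1 (2 + n) ℚ.+ frac 1 (2 + n) ℚ.< ε → γ <ᵁ s j ℚ.+ ε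
        above {j = j} {ε} γ<a (inj₁ a≤s) 2f<ε = Cut.U-up γ (ℚP.≤-<-trans a≤s (p<p+r (s j) (ℚP.<-trans
          (ℚP.<-trans (0<frac {2 + n} (s≤s z≤n)) (p<p+r (frac 1 (2 + n)) (0<frac {2 + n} (s≤s z≤n)))) 2f<ε))) γ<a
        above {j = j} {ε} _ (inj₂ β-near) 2f<ε = Cut.¬L⇒U γ
          (ℚP.+-monoʳ-< (s j) (ℚP.<-trans (p<p+r (frac 1 (2 + n)) (0<frac {2 + n} (s≤s z≤n))) 2f<ε))
          λ L → ℚP.<-irrefl refl (β-near (γ≤β _ L))

      time : ℕ → ℕ
      time n = proj₁ (near n)

      -- Since `time n` is at least `n`, restarting just after the last chosen time makes the
      -- subsequence strictly increasing while the grid becomes finer.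
      start : ℕ → ℕ
      start zero    = 0
      start (suc k) = suc (time (start k))

      k≤start : ∀ k → k ≤ start k
      k≤start zero    = z≤n
      k≤start (suc k) = s≤s (≤-trans (k≤start k) (proj₁ (proj₂ (near (start k)))))

      interval⇒limit : IsSubsequentialLimit s γ
      interval⇒limit = time ∘ start , (λ k → proj₁ (proj₂ (near (start (suc k))))) , λ ε 0<ε →
        let (M , 2≤M , fM≤ε) = archimedean 0<ε
            0<M = ≤-trans (s≤s z≤n) 2≤M in
        M + M , λ k 2M≤k → proj₂ (proj₂ (near (start k))) (ℚP.<-≤-trans
          (subst (frac 1 (2 + start k) ℚ.+ frac 1 (2 + start k) ℚ.<_) (halves 0<M)
            (let f< = frac-< (≤-trans 0<M (m≤m+n M M)) (s≤s (m≤n⇒m≤1+n (≤-trans 2M≤k (k≤start k)))) in ℚP.+-mono-<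
                   f< f<)) fM≤ε)

    limits⇔interval : ∀ γ → IsSubsequentialLimit s γ ⇔ Interval α β γ
    limits⇔interval γ = mk⇔ (limit⇒interval {γ}) (λ (α≤γ , γ≤β) → Approach.interval⇒limit γ α≤γ γ≤β)

-- Subset sums and densities in a group filtered by finite subgroups

module Combinatorics where
  open import Algebra.Properties.CommutativeSemigroup +-commutativeSemigroup using () renaming (interchange to +-interchange)
  open import Data.List.Membership.Propositional using (_∈_; _∉_)
  open import Data.List.Membership.Propositional.Properties
    using (∈-map⁺; ∈-map⁻; ∈-++⁺ˡ; ∈-++⁺ʳ; ∈-++⁻; ∈-filter⁺; ∈-filter⁻; ∈-applyUpTo⁺; ∈-applyUpTo⁻)
  open import Data.List.Membership.Propositional.Properties.WithK using (unique∧set⇒bag)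
  open import Data.List.Relation.Binary.BagAndSetEquality using (∼bag⇒↭)
  import Data.List.Relation.Binary.Permutation.Propositional as ↭
  open ↭ using (_↭_)
  open import Data.List.Relation.Unary.Any.Properties using (lookup-index)
  open import Data.List.Relation.Unary.Unique.Propositional using (Unique)
  import Data.List.Relation.Unary.Unique.Propositional.Properties as Unique
  open import Data.Nat.DivMod using (_/_; _%_; m≡m%n+[m/n]*n; m%n<n)
  open ℚSolver.+-*-Solver using ()
    renaming (solve to ℚsolve; con to conq; _:+_ to _:+q_; _:-_ to _:-q_; _:*_ to _:*q_; _:=_ to _:=q_)

  -- Propositional equality is available because an element of a countable group
  -- can be represented by its least index in the enumeration.
  record Setting : Set₁ where
    infixl 6 _⊕_
    infix 8 ⊖_
    field
      em   : ExcludedMiddle 0ℓ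
      C    : Set
      _⊕_  : C → C → C
      𝟘    : C
      ⊖_   : C → C
      isAbelianGroup : IsAbelianGroup _≡_ _⊕_ 𝟘 ⊖_
      E         : ℕ → List C
      E-unique  : ∀ i → Unique (E i)
      E-𝟘       : ∀ i → 𝟘 ∈ E i
      E-⊕       : ∀ i {x y} → x ∈ E i → y ∈ E i → x ⊕ y ∈ E i
      E-⊖       : ∀ i {x} → x ∈ E i → ⊖ x ∈ E i
      E-suc     : ∀ i {x} → x ∈ E i → x ∈ E (suc i)
      E-cover   : ∀ x → ∃ λ i → x ∈ E i
      unbounded-doubles : ∀ i → ∃ λ x → x ⊕ x ∉ E i

  module Core (𝒮 : Setting) where
    open Setting 𝒮

    abelianGroup : AbelianGroup 0ℓ 0ℓ
    abelianGroup = record { isAbelianGroup = isAbelianGroup }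

    private module G = AbelianGroup abelianGroup

    open Algebra.Properties.Group G.group using (∙-cancelʳ; ⁻¹-anti-homo-∙; ⁻¹-involutive; ε⁻¹≈ε)
    open Algebra.Properties.Monoid.Mult G.monoid public using ()
      renaming (_×_ to infixr 8 _·_; ×-homo-+ to ·-+; ×-assocˡ to ·-*)

    infixl 6 _⊝_
    _⊝_ : C → C → C
    x ⊝ y = x ⊕ ⊖ y

    module Solver where
      open Algebra.Solver.CommutativeMonoid G.commutativeMonoid
        using (normalise) renaming (Expr to Expr⁺; var to var⁺; id to id⁺; _⊕_ to _⊕⁺_; ⟦_⟧ to ⟦_⟧⁺)
      module CM = Algebra.Solver.CommutativeMonoid G.commutativeMonoid
      open Algebra.Solver.CommutativeMonoid.Normal G.commutativeMonoid using (correct)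

      infixl 6 _:+_ _:-_
      infix 4 _:=_
      data Expr (n : ℕ) : Set where
        var  : Fin n → Expr n
        :0   : Expr n
        _:+_ : Expr n → Expr n → Expr n
        :-_  : Expr n → Expr n

      _:-_ : ∀ {n} → Expr n → Expr n → Expr n
      x :- y = x :+ (:- y)

      _:=_ : ∀ {n} → Expr n → Expr n → Expr n × Expr n
      _:=_ = _,_

      ⟦_⟧ : ∀ {n} → Expr n → Vec C n → C
      ⟦ var i ⟧ ρ  = lookup ρ i
      ⟦ :0 ⟧ ρ     = 𝟘
      ⟦ x :+ y ⟧ ρ = ⟦ x ⟧ ρ ⊕ ⟦ y ⟧ ρ
      ⟦ :- x ⟧ ρ   = ⊖ ⟦ x ⟧ ρ

      -- An expression e equals `pos e` minus `neg e`, both free of negation. Hence e = f follows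
      -- from `pos e` + `neg f` = `pos f` + `neg e`, which the normal form for commutative monoids
      -- decides.
      pos neg : ∀ {n} → Expr n → Expr⁺ n
      pos (var i)  = var⁺ i
      pos :0       = id⁺
      pos (x :+ y) = pos x ⊕⁺ pos y
      pos (:- x)   = neg x
      neg (var i)  = id⁺
      neg :0       = id⁺
      neg (x :+ y) = neg x ⊕⁺ neg y
      neg (:- x)   = pos x

      interchange : ∀ a b c d → (a ⊕ b) ⊕ (c ⊕ d) ≡ (a ⊕ c) ⊕ (b ⊕ d)
      interchange = CM.solve 4 (λ a b c d → ((a CM.⊕ b) CM.⊕ (c CM.⊕ d)) CM.⊜ ((a CM.⊕ c) CM.⊕ (b CM.⊕ d))) refl

      pos-neg : ∀ {n} (e : Expr n) ρ → ⟦ e ⟧ ρ ⊕ ⟦ neg e ⟧⁺ ρ ≡ ⟦ pos e ⟧⁺ ρ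
      pos-neg (var i) ρ  = G.identityʳ _
      pos-neg :0 ρ       = G.identityʳ _
      pos-neg (x :+ y) ρ =
        trans (interchange (⟦ x ⟧ ρ) (⟦ y ⟧ ρ) _ _) (cong₂ _⊕_ (pos-neg x ρ) (pos-neg y ρ))
      pos-neg (:- x) ρ   = begin
        ⊖ a ⊕ ⟦ pos x ⟧⁺ ρ       ≡⟨ cong (⊖ a ⊕_) (pos-neg x ρ) ⟨
        ⊖ a ⊕ (a ⊕ ⟦ neg x ⟧⁺ ρ) ≡⟨ G.assoc (⊖ a) a _ ⟨
        (⊖ a ⊕ a) ⊕ ⟦ neg x ⟧⁺ ρ ≡⟨ cong (_⊕ ⟦ neg x ⟧⁺ ρ) (G.inverseˡ a) ⟩
        𝟘 ⊕ ⟦ neg x ⟧⁺ ρ         ≡⟨ G.identityˡ _ ⟩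
        ⟦ neg x ⟧⁺ ρ             ∎
        where open ≡-Reasoning
              a = ⟦ x ⟧ ρ

      prove : ∀ {n} (e f : Expr n) → normalise (pos e ⊕⁺ neg f) ≡ normalise (pos f ⊕⁺ neg e) →
              ∀ ρ → ⟦ e ⟧ ρ ≡ ⟦ f ⟧ ρ
      prove e f eq ρ = ∙-cancelʳ (ne ⊕ nf) _ _ (begin
        ⟦ e ⟧ ρ ⊕ (ne ⊕ nf)   ≡⟨ G.assoc _ ne nf ⟨
        (⟦ e ⟧ ρ ⊕ ne) ⊕ nf   ≡⟨ cong (_⊕ nf) (pos-neg e ρ) ⟩
        ⟦ pos e ⟧⁺ ρ ⊕ nf     ≡⟨ correct (pos e ⊕⁺ neg f) ρ ⟨
        CM.⟦ normalise (pos e ⊕⁺ neg f) ⟧⇓ ρ ≡⟨ cong (λ n → CM.⟦ n ⟧⇓ ρ) eq ⟩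
        CM.⟦ normalise (pos f ⊕⁺ neg e) ⟧⇓ ρ ≡⟨ correct (pos f ⊕⁺ neg e) ρ ⟩
        ⟦ pos f ⟧⁺ ρ ⊕ ne     ≡⟨ cong (_⊕ ne) (pos-neg f ρ) ⟨
        (⟦ f ⟧ ρ ⊕ nf) ⊕ ne   ≡⟨ G.assoc _ nf ne ⟩
        ⟦ f ⟧ ρ ⊕ (nf ⊕ ne)   ≡⟨ cong (⟦ f ⟧ ρ ⊕_) (G.comm nf ne) ⟩
        ⟦ f ⟧ ρ ⊕ (ne ⊕ nf)   ∎)
        where
        open ≡-Reasoning
        ne = ⟦ neg e ⟧⁺ ρ
        nf = ⟦ neg f ⟧⁺ ρ

      solve : ∀ n (f : N-ary n (Expr n) (Expr n × Expr n)) →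
              let (e₁ , e₂) = Relation.Binary.Reflection.close G.setoid var ⟦_⟧ ⟦_⟧ (λ _ _ → refl) n f in
              normalise (pos e₁ ⊕⁺ neg e₂) ≡ normalise (pos e₂ ⊕⁺ neg e₁) →
              Eq n _≡_ (curryⁿ ⟦ e₁ ⟧) (curryⁿ ⟦ e₂ ⟧)
      solve n f eq = let (e₁ , e₂) = Relation.Binary.Reflection.close G.setoid var ⟦_⟧ ⟦_⟧ (λ _ _ → refl) n f in
        curryⁿ-cong _≡_ ⟦ e₁ ⟧ ⟦ e₂ ⟧ (prove e₁ e₂ eq)

    open Solver public using (solve; :0; _:+_; _:-_; :-_; _:=_)

    ⊖-swap : ∀ x y → ⊖ (x ⊝ y) ≡ y ⊝ x
    ⊖-swap = solve 2 (λ x y → :- (x :- y) := y :- x) refl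

    ⊝-self : ∀ x → x ⊝ x ≡ 𝟘
    ⊝-self = solve 1 (λ x → x :- x := :0) refl

    ⊝-𝟘 : ∀ x → x ⊝ 𝟘 ≡ x
    ⊝-𝟘 = solve 1 (λ x → x :- :0 := x) refl

    ⊝-⊕ : ∀ x y → x ⊝ y ⊕ y ≡ x
    ⊝-⊕ = solve 2 (λ x y → x :- y :+ y := x) refl

    ⊕-⊝ : ∀ x y → x ⊕ y ⊝ y ≡ x
    ⊕-⊝ = solve 2 (λ x y → x :+ y :- y := x) refl

    ⊕-cancelˡ : ∀ a {x y} → a ⊕ x ≡ a ⊕ y → x ≡ y
    ⊕-cancelˡ a {x} {y} eq = trans (sym (lem a x)) (trans (cong (_⊝ a) eq) (lem a y))
      where lem = solve 2 (λ a x → a :+ x :- a := x) refl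

    ·-∸ : ∀ {i j} c → i ≤ j → (j ∸ i) · c ≡ j · c ⊝ i · c
    ·-∸ {i} {j} c i≤j = trans (sym (⊕-⊝ _ _)) (cong (_⊝ i · c)
      (trans (sym (·-+ c (j ∸ i) i)) (cong (_· c) (m∸n+n≡m i≤j))))

    -- Finite subgroups and counting

    record FinSub : Set where
      field
        elements : List C
        unique   : Unique elements
        𝟘∈       : 𝟘 ∈ elements
        ⊕∈       : ∀ {x y} → x ∈ elements → y ∈ elements → x ⊕ y ∈ elements
        ⊖∈       : ∀ {x} → x ∈ elements → ⊖ x ∈ elements

    infix 4 _∈ₛ_ _∉ₛ_ _⊆ₛ_
    _∈ₛ_ _∉ₛ_ : C → FinSub → Set
    x ∈ₛ K = x ∈ FinSub.elements K
    x ∉ₛ K = ¬ x ∈ₛ K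

    _⊆ₛ_ : FinSub → FinSub → Set
    K ⊆ₛ L = ∀ {x} → x ∈ₛ K → x ∈ₛ L

    stage : ℕ → FinSub
    stage i = record
      { elements = E i ; unique = E-unique i ; 𝟘∈ = E-𝟘 i ; ⊕∈ = E-⊕ i ; ⊖∈ = E-⊖ i }

    stage-mono : ∀ {i j} → i ≤ j → stage i ⊆ₛ stage j
    stage-mono i≤j = go (≤⇒≤′ i≤j)
      where
      go : ∀ {i j} → i ≤′ j → stage i ⊆ₛ stage j
      go ≤′-refl x∈     = x∈
      go (≤′-step i≤j) x∈ = E-suc _ (go i≤j x∈)

    module _ (K : FinSub) where
      open FinSub K

      ⊝∈ : ∀ {x y} → x ∈ₛ K → y ∈ₛ K → x ⊝ y ∈ₛ K
      ⊝∈ x∈ y∈ = ⊕∈ x∈ (⊖∈ y∈)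

      ·∈ : ∀ n {x} → x ∈ₛ K → n · x ∈ₛ K
      ·∈ zero    x∈ = 𝟘∈
      ·∈ (suc n) x∈ = ⊕∈ x∈ (·∈ n x∈)

      ∈-⊕ʳ : ∀ {x y} → y ∈ₛ K → x ⊕ y ∈ₛ K → x ∈ₛ K
      ∈-⊕ʳ y∈ xy∈ = subst (_∈ₛ K) (⊕-⊝ _ _) (⊝∈ xy∈ y∈)

      ∈-⊕ˡ : ∀ {x y} → x ∈ₛ K → x ⊕ y ∈ₛ K → y ∈ₛ K
      ∈-⊕ˡ {x} {y} x∈ xy∈ = ∈-⊕ʳ x∈ (subst (_∈ₛ K) (G.comm x y) xy∈)

      ∈-⊝ʳ : ∀ {x y} → y ∈ₛ K → x ⊝ y ∈ₛ K → x ∈ₛ K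
      ∈-⊝ʳ y∈ xy∈ = subst (_∈ₛ K) (⊝-⊕ _ _) (⊕∈ xy∈ y∈)

      ∈-⊝ˡ : ∀ {x y} → x ∈ₛ K → x ⊝ y ∈ₛ K → y ∈ₛ K
      ∈-⊝ˡ {x} {y} x∈ xy∈ = subst (_∈ₛ K)
        (solve 2 (λ x y → x :- (x :- y) := y) refl x y) (⊝∈ x∈ xy∈)

      ⊝-sym : ∀ {x y} → x ⊝ y ∈ₛ K → y ⊝ x ∈ₛ K
      ⊝-sym xy∈ = subst (_∈ₛ K) (⊖-swap _ _) (⊖∈ xy∈)

    SetC : Set₁
    SetC = C → Set

    𝟙[_] : Set → ℕ
    𝟙[ P ] = if does (em {P}) then 1 else 0

    𝟙-mono : ∀ {P Q} → (P → Q) → 𝟙[ P ] ≤ 𝟙[ Q ]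
    𝟙-mono {P} {Q} f with em {P} | em {Q}
    ... | yes p | yes q = ≤-refl
    ... | yes p | no ¬q = contradiction (f p) ¬q
    ... | no ¬p | yes q = z≤n
    ... | no ¬p | no ¬q = z≤n

    𝟙-yes : ∀ {P} → P → 𝟙[ P ] ≡ 1
    𝟙-yes {P} p with em {P}
    ... | yes _ = refl
    ... | no ¬p = contradiction p ¬p

    𝟙-no : ∀ {P} → ¬ P → 𝟙[ P ] ≡ 0
    𝟙-no {P} ¬p with em {P}
    ... | yes p = contradiction p ¬p
    ... | no _  = refl

    count : SetC → List C → ℕ
    count X []       = 0
    count X (e ∷ es) = 𝟙[ X e ] + count X es

    card : FinSub → ℕ
    card K = length (FinSub.elements K)

    # : SetC → FinSub → ℕ
    # X K = count X (FinSub.elements K)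

    count-mono : ∀ {X Y} es → (∀ {x} → x ∈ es → X x → Y x) → count X es ≤ count Y es
    count-mono []       f = z≤n
    count-mono (e ∷ es) f = +-mono-≤ (𝟙-mono (f (here refl))) (count-mono es (f ∘ there))

    count-cong : ∀ {X Y} es → (∀ {x} → x ∈ es → X x ⇔ Y x) → count X es ≡ count Y es
    count-cong es f = ≤-antisym (count-mono es (λ e → Equivalence.to (f e)))
                                (count-mono es (λ e → Equivalence.from (f e)))

    count-map : ∀ {X} f es → count X (map f es) ≡ count (X ∘ f) es
    count-map f []       = refl
    count-map f (e ∷ es) = cong (_ +_) (count-map f es)

    count-++ : ∀ {X} es es′ → count X (es ++ es′) ≡ count X es + count X es′
    count-++ []       es′ = refl
    count-++ {X} (e ∷ es) es′ = trans (cong (𝟙[ X e ] +_) (count-++ es es′)) (sym (+-assoc 𝟙[ X e ] _ _))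

    count-↭ : ∀ {X es es′} → es ↭ es′ → count X es ≡ count X es′
    count-↭ ↭.refl = refl
    count-↭ (↭.prep x p) = cong (_ +_) (count-↭ p)
    count-↭ {X} (↭.swap {xs} {ys} x y p) = trans (cong (λ n → 𝟙[ X x ] + (𝟙[ X y ] + n)) (count-↭ p))
      (trans (sym (+-assoc 𝟙[ X x ] 𝟙[ X y ] _))
        (trans (cong (_+ count X ys) (+-comm 𝟙[ X x ] 𝟙[ X y ])) (+-assoc 𝟙[ X y ] 𝟙[ X x ] _)))
    count-↭ (↭.trans p q) = trans (count-↭ p) (count-↭ q)

    unique-↭ : ∀ {es es′ : List C} → Unique es → Unique es′ → (∀ {x} → x ∈ es ⇔ x ∈ es′) → es ↭ es′
    unique-↭ u u′ eq = ∼bag⇒↭ (unique∧set⇒bag u u′ eq)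

    count-all : ∀ {X} es → (∀ {x} → x ∈ es → X x) → count X es ≡ length es
    count-all []       f = refl
    count-all (e ∷ es) f = cong₂ _+_ (𝟙-yes (f (here refl))) (count-all es (f ∘ there))

    count-none : ∀ {X} es → (∀ {x} → x ∈ es → ¬ X x) → count X es ≡ 0
    count-none []       f = refl
    count-none (e ∷ es) f = cong₂ _+_ (𝟙-no (f (here refl))) (count-none es (f ∘ there))

    #≤card : ∀ {X} K → # X K ≤ card K
    #≤card {X} K = go (FinSub.elements K)
      where
      𝟙≤1 : ∀ {P} → 𝟙[ P ] ≤ 1
      𝟙≤1 {P} with em {P}
      ... | yes _ = ≤-refl
      ... | no _  = z≤n
      go : ∀ es → count X es ≤ length es
      go []       = z≤n
      go (e ∷ es) = +-mono-≤ 𝟙≤1 (go es)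

    translate-↭ : ∀ K {g} → g ∈ₛ K → map (_⊕ g) (FinSub.elements K) ↭ FinSub.elements K
    translate-↭ K {g} g∈ = unique-↭ (Unique.map⁺ (λ {x} {y} → cancel x y) unique) unique (mk⇔ to from)
      where
      open FinSub K
      cancel : ∀ x y → x ⊕ g ≡ y ⊕ g → x ≡ y
      cancel x y eq = trans (sym (⊕-⊝ x g)) (trans (cong (_⊝ g) eq) (⊕-⊝ y g))
      to : ∀ {x} → x ∈ map (_⊕ g) elements → x ∈ elements
      to x∈ with y , y∈ , refl ← ∈-map⁻ (_⊕ g) x∈ = ⊕∈ y∈ g∈
      from : ∀ {x} → x ∈ elements → x ∈ map (_⊕ g) elements
      from {x} x∈ = subst (_∈ _) (⊝-⊕ x g) (∈-map⁺ (_⊕ g) (⊝∈ K x∈ g∈))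

    #-translate : ∀ {X} K {g} → g ∈ₛ K → # (λ x → X (x ⊕ g)) K ≡ # X K
    #-translate K g∈ = trans (sym (count-map (_⊕ _) (FinSub.elements K))) (count-↭ (translate-↭ K g∈))

    sum : (C → ℕ) → List C → ℕ
    sum f []       = 0
    sum f (e ∷ es) = f e + sum f es

    sum-lower : ∀ {f v} es → (∀ {x} → x ∈ es → v ≤ f x) → length es * v ≤ sum f es
    sum-lower []       h = z≤n
    sum-lower (e ∷ es) h = +-mono-≤ (h (here refl)) (sum-lower es (h ∘ there))

    sum-upper : ∀ {f v} es → (∀ {x} → x ∈ es → f x ≤ v) → sum f es ≤ length es * v
    sum-upper []       h = z≤n
    sum-upper (e ∷ es) h = +-mono-≤ (h (here refl)) (sum-upper es (h ∘ there))

    sum-const : ∀ {f v} es → (∀ {x} → x ∈ es → f x ≡ v) → sum f es ≡ length es * v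
    sum-const []       h = refl
    sum-const (e ∷ es) h = cong₂ _+_ (h (here refl)) (sum-const es (h ∘ there))

    sum-swap : ∀ (R : C → C → Set) es es′ →
               sum (λ x → count (R x) es′) es ≡ sum (λ y → count (λ x → R x y) es) es′
    sum-swap R []       es′ = sym (trans (sum-const es′ λ _ → refl) (*-zeroʳ (length es′)))
    sum-swap R (e ∷ es) es′ = trans (cong (count (R e) es′ +_) (sum-swap R es es′)) (split es′)
      where
      split : ∀ es′ → count (R e) es′ + sum (λ y → count (λ x → R x y) es) es′
                    ≡ sum (λ y → 𝟙[ R e y ] + count (λ x → R x y) es) es′
      split []        = refl
      split (y ∷ es′) = trans
        (+-interchange 𝟙[ R e y ] (count (R e) es′) (count (λ x → R x y) es) _)
        (cong (𝟙[ R e y ] + count (λ x → R x y) es +_) (split es′))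

    -- Double counting of the pairs (k , g) with X (k ⊕ g).
    #-average : ∀ {X} K L → K ⊆ₛ L →
                sum (λ g → # (λ k → X (k ⊕ g)) K) (FinSub.elements L) ≡ card K * # X L
    #-average {X} K L K⊆L = trans (sum-swap (λ g k → X (k ⊕ g)) (FinSub.elements L) (FinSub.elements K))
      (sum-const (FinSub.elements K) λ {k} k∈ →
        trans (count-cong (FinSub.elements L) λ {g} _ →
                 mk⇔ (subst X (G.comm k g)) (subst X (G.comm g k)))
              (#-translate {X} L (K⊆L k∈)))

    -- Comparing coset by coset is stronger than comparing densities. The relation passes to every
    -- smaller `L`, so one proof bounds all intermediate stages; it composes along chains; and it
    -- survives `⊞ V` for V inside `K`. The representative t of the coset is left free because
    -- translating by an element of `K` does not change a count over `K`.
    Above Below : SetC → FinSub → SetC → FinSub → Set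
    Above S K X L = ∀ {g} → g ∈ₛ L → ∃ λ t → t ⊝ g ∈ₛ K × (∀ {x} → x ∈ₛ K → S x → X (x ⊕ t))
    Below S K X L = ∀ {g} → g ∈ₛ L → ∃ λ t → t ⊝ g ∈ₛ K × (∀ {x} → x ∈ₛ K → X (x ⊕ t) → S x)

    private
      recenter : ∀ X {K t g} → t ⊝ g ∈ₛ K → # (λ k → X (k ⊕ t)) K ≡ # (λ k → X (k ⊕ g)) K
      recenter X {K} {t} {g} tg∈ = trans
        (count-cong (FinSub.elements K) λ {k} _ → let eq = lem k t g in mk⇔ (subst X eq) (subst X (sym eq)))
        (#-translate {λ k → X (k ⊕ g)} K tg∈)
        where lem = solve 3 (λ k t g → k :+ t := k :+ (t :- g) :+ g) refl

    Above⇒≤ : ∀ {S K X L} → K ⊆ₛ L → Above S K X L → # S K * card L ≤ # X L * card K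
    Above⇒≤ {S} {K} {X} {L} K⊆L above = begin
      # S K * card L ≡⟨ *-comm (# S K) (card L) ⟩
      card L * # S K ≤⟨ sum-lower (FinSub.elements L) (λ g∈ → let (t , tg∈ , f) = above g∈ in
                          subst (# S K ≤_) (recenter X {K} tg∈) (count-mono (FinSub.elements K) f)) ⟩
      sum (λ g → # (λ k → X (k ⊕ g)) K) (FinSub.elements L) ≡⟨ #-average {X} K L K⊆L ⟩
      card K * # X L ≡⟨ *-comm (card K) (# X L) ⟩
      # X L * card K ∎
      where open ≤-Reasoning

    Below⇒≤ : ∀ {S K X L} → K ⊆ₛ L → Below S K X L → # X L * card K ≤ # S K * card L
    Below⇒≤ {S} {K} {X} {L} K⊆L below = begin
      # X L * card K ≡⟨ *-comm (# X L) (card K) ⟩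
      card K * # X L ≡⟨ #-average {X} K L K⊆L ⟨
      sum (λ g → # (λ k → X (k ⊕ g)) K) (FinSub.elements L) ≤⟨ sum-upper (FinSub.elements L) (λ g∈ → let (t , tg∈ , f) = below g∈ in
                          subst (_≤ # S K) (recenter X {K} tg∈) (count-mono (FinSub.elements K) f)) ⟩
      card L * # S K ≡⟨ *-comm (card L) (# S K) ⟩
      # S K * card L ∎
      where open ≤-Reasoning

    -- The shift t from the second relation agrees with g only modulo `L`. The first relation,
    -- applied to the error g ⊝ t, corrects it modulo `K`.
    Above-trans : ∀ {S K X L Y M} → K ⊆ₛ L → Above S K X L → Above X L Y M → Above S K Y M
    Above-trans {K = K} {L = L} {Y} K⊆L f h {g} g∈ with t , tg∈ , p ← h g∈ with u , ug∈ , q ← f (⊝-sym L tg∈)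
      = u ⊕ t , subst (_∈ₛ K) (solve 3 (λ u g t → u :- (g :- t) := u :+ t :- g) refl u g t) ug∈
      , λ {x} x∈ s → subst Y (G.assoc x u t)
          (p (FinSub.⊕∈ L (K⊆L x∈) (∈-⊝ʳ L (⊝-sym L tg∈) (K⊆L ug∈))) (q x∈ s))

    Below-trans : ∀ {S K X L Y M} → K ⊆ₛ L → Below S K X L → Below X L Y M → Below S K Y M
    Below-trans {K = K} {L = L} {Y} K⊆L f h {g} g∈ with t , tg∈ , p ← h g∈ with u , ug∈ , q ← f (⊝-sym L tg∈)
      = u ⊕ t , subst (_∈ₛ K) (solve 3 (λ u g t → u :- (g :- t) := u :+ t :- g) refl u g t) ug∈
      , λ {x} x∈ y → q x∈ (p (FinSub.⊕∈ L (K⊆L x∈) (∈-⊝ʳ L (⊝-sym L tg∈) (K⊆L ug∈)))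
                            (subst Y (sym (G.assoc x u t)) y))

    infixl 6 _⊞_
    _⊞_ : SetC → SetC → SetC
    (S ⊞ V) x = ∃ λ v → V v × S (x ⊝ v)

    Above-⊞ : ∀ {S K X L V} → (∀ {v} → V v → v ∈ₛ K) → Above S K X L → Above (S ⊞ V) K (X ⊞ V) L
    Above-⊞ {K = K} {X} V⊆K f g∈ with t , tg∈ , p ← f g∈ =
      t , tg∈ , λ {x} x∈ (v , v∈ , s) → v , v∈ , subst X (lem x v t) (p (⊝∈ K x∈ (V⊆K v∈)) s)
      where lem = solve 3 (λ x v t → x :- v :+ t := x :+ t :- v) refl

    Below-⊞ : ∀ {S K X L V} → (∀ {v} → V v → v ∈ₛ K) → Below S K X L → Below (S ⊞ V) K (X ⊞ V) L
    Below-⊞ {K = K} {X} V⊆K f g∈ with t , tg∈ , p ← f g∈ =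
      t , tg∈ , λ {x} x∈ (v , v∈ , s) → v , v∈ , p (⊝∈ K x∈ (V⊆K v∈)) (subst X (sym (lem x v t)) s)
      where lem = solve 3 (λ x v t → x :- v :+ t := x :+ t :- v) refl

    Below-mono : ∀ {S S′ K X X′ L} → (∀ {x} → S x → S′ x) → (∀ {x} → X′ x → X x) →
                 Below S K X L → Below S′ K X′ L
    Below-mono s h f g∈ = let (t , tg∈ , p) = f g∈ in t , tg∈ , λ x∈ → s ∘ p x∈ ∘ h

    -- Cyclic extensions and subset sums

    record Order (K : FinSub) (c : C) (N : ℕ) : Set where
      field
        positive : 0 < N
        multiple : N · c ∈ₛ K
        minimal  : ∀ {j} → 0 < j → j < N → j · c ∉ₛ K

      distinct : ∀ {a b} → a < N → b < N → a · c ⊝ b · c ∈ₛ K → a ≡ b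
      distinct {a} {b} a<N b<N ab∈ with <-cmp a b
      ... | tri≈ _ eq _ = eq
      ... | tri< a<b _ _ = contradiction (subst (_∈ₛ K) (sym (·-∸ c (<⇒≤ a<b))) (⊝-sym K ab∈))
                                         (minimal (m<n⇒0<n∸m a<b) (≤-<-trans (m∸n≤m b a) b<N))
      ... | tri> _ _ b<a = contradiction (subst (_∈ₛ K) (sym (·-∸ c (<⇒≤ b<a))) ab∈)
                                         (minimal (m<n⇒0<n∸m b<a) (≤-<-trans (m∸n≤m a b) a<N))

    private
      same-multiple : ∀ L {c} → c ∈ₛ L → ∃ λ i → ∃ λ j → i < j × i · c ≡ j · c
      same-multiple L {c} c∈ =
        let (i , j , i<j , eq) = pigeonhole (n<1+n (card L)) index in
        toℕ i , toℕ j , i<j , trans (lookup-index (∈L (toℕ i)))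
          (trans (cong (Data.List.Base.lookup (FinSub.elements L)) eq) (sym (lookup-index (∈L (toℕ j)))))
        where
        ∈L : ∀ j → j · c ∈ₛ L
        ∈L j = ·∈ L j c∈
        index : Fin (suc (card L)) → Fin (card L)
        index j = Any.index (∈L (toℕ j))

    order-exists : ∀ K L {c} → c ∈ₛ L → ∃ λ N → Order K c N
    order-exists K L {c} c∈ =
      let (i , j , i<j , eq) = same-multiple L c∈
          vanish = trans (·-∸ c (<⇒≤ i<j)) (trans (cong (_⊝ i · c) (sym eq)) (⊝-self (i · c)))
          (N , (0<N , N∈) , min) = least em (λ n → 0 < n × n · c ∈ₛ K)
            (j ∸ i , m<n⇒0<n∸m i<j , subst (_∈ₛ K) (sym vanish) (FinSub.𝟘∈ K))
      in N , record { positive = 0<N ; multiple = N∈ ; minimal = λ 0<j j<N j∈ → min j<N (0<j , j∈) }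

    sumN : ℕ → (ℕ → ℕ) → ℕ
    sumN zero    f = 0
    sumN (suc n) f = f n + sumN n f

    module Cyclic (K : FinSub) (c : C) where
      open FinSub K

      layers : ℕ → List C
      layers zero    = []
      layers (suc a) = map (a · c ⊕_) elements ++ layers a

      ∈-layers⁺ : ∀ {n x} a → a < n → x ⊝ a · c ∈ₛ K → x ∈ layers n
      ∈-layers⁺ {suc n} {x} a a<n x∈ with a ≟ n
      ... | yes refl = ∈-++⁺ˡ (subst (_∈ map (a · c ⊕_) elements) (lem (a · c) x) (∈-map⁺ (a · c ⊕_) x∈))
        where lem = solve 2 (λ a x → a :+ (x :- a) := x) refl
      ... | no a≢n = ∈-++⁺ʳ (map (n · c ⊕_) elements) (∈-layers⁺ a (≤∧≢⇒< (s≤s⁻¹ a<n) a≢n) x∈)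

      ∈-layers⁻ : ∀ {n x} → x ∈ layers n → ∃ λ a → a < n × x ⊝ a · c ∈ₛ K
      ∈-layers⁻ {suc n} x∈ with ∈-++⁻ (map (n · c ⊕_) elements) x∈
      ... | inj₂ x∈′ = let (a , a<n , p) = ∈-layers⁻ x∈′ in a , m<n⇒m<1+n a<n , p
      ... | inj₁ x∈′ with y , y∈ , refl ← ∈-map⁻ (n · c ⊕_) x∈′ =
        n , n<1+n n , subst (_∈ₛ K) (lem (n · c) y) y∈
        where lem = solve 2 (λ a y → y := a :+ y :- a) refl

      count-layers : ∀ {X} n → count X (layers n) ≡ sumN n (λ a → # (λ x → X (a · c ⊕ x)) K)
      count-layers zero    = refl
      count-layers {X} (suc n) = trans (count-++ (map (n · c ⊕_) elements) (layers n))
        (cong₂ _+_ (count-map (n · c ⊕_) elements) (count-layers n))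

      length-layers : ∀ n → length (layers n) ≡ n * card K
      length-layers zero    = refl
      length-layers (suc n) = trans (length-++ (map (n · c ⊕_) elements))
        (cong₂ _+_ (length-map (n · c ⊕_) elements) (length-layers n))

    module _ (K : FinSub) (c : C) {N : ℕ} (ord : Order K c N) where
      open FinSub K
      open Order ord
      open Cyclic K c
      private instance
        N-nonZero : NonZero N
        N-nonZero = >-nonZero positive

      private
        reduce : ∀ {x} a → x ⊝ a · c ∈ₛ K → x ∈ layers N
        reduce {x} a x∈ = ∈-layers⁺ (a % N) (m%n<n a N) (subst (_∈ₛ K) eq (⊕∈ x∈ (·∈ K (a / N) multiple)))
          where
          open ≡-Reasoning
          eq : x ⊝ a · c ⊕ (a / N) · N · c ≡ x ⊝ (a % N) · c
          eq = begin
            x ⊝ a · c ⊕ (a / N) · N · c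
              ≡⟨ cong (λ n → x ⊝ n · c ⊕ (a / N) · N · c) (m≡m%n+[m/n]*n a N) ⟩
            x ⊝ (a % N + (a / N) * N) · c ⊕ (a / N) · N · c
              ≡⟨ cong (λ y → x ⊝ y ⊕ (a / N) · N · c) (·-+ c (a % N) ((a / N) * N)) ⟩
            x ⊝ ((a % N) · c ⊕ ((a / N) * N) · c) ⊕ (a / N) · N · c
              ≡⟨ cong (λ y → x ⊝ ((a % N) · c ⊕ ((a / N) * N) · c) ⊕ y) (·-* c (a / N) N) ⟩
            x ⊝ ((a % N) · c ⊕ ((a / N) * N) · c) ⊕ ((a / N) * N) · c
              ≡⟨ solve 3 (λ x r y → x :- (r :+ y) :+ y := x :- r) refl x ((a % N) · c) (((a / N) * N) · c) ⟩
            x ⊝ (a % N) · c ∎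

        layers-unique : ∀ n → n ≤ N → Unique (layers n)
        layers-unique zero    _   = []
        layers-unique (suc n) n<N = Unique.++⁺
          (Unique.map⁺ (⊕-cancelˡ (n · c)) unique) (layers-unique n (<⇒≤ n<N)) λ (p , q) → disjoint p q
          where
          disjoint : ∀ {x} → x ∈ map (n · c ⊕_) elements → ¬ x ∈ layers n
          disjoint p q with y , y∈ , refl ← ∈-map⁻ (n · c ⊕_) p with a , a<n , x∈ ← ∈-layers⁻ {n} q =
            <⇒≢ a<n (sym (distinct n<N (<-trans a<n n<N)
              (subst (_∈ₛ K) (solve 3 (λ n y a → n :+ y :- a :- y := n :- a) refl (n · c) y (a · c))
                (⊝∈ K x∈ y∈))))

      adjoin : FinSub
      adjoin = record
        { elements = layers N
        ; unique   = layers-unique N ≤-refl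
        ; 𝟘∈       = reduce 0 (subst (_∈ₛ K) (sym (⊝-self 𝟘)) 𝟘∈)
        ; ⊕∈       = plus
        ; ⊖∈       = minus
        }
        where
        plus : ∀ {x y} → x ∈ layers N → y ∈ layers N → x ⊕ y ∈ layers N
        plus {x} {y} x∈ y∈ with a , _ , p ← ∈-layers⁻ {N} x∈ | b , _ , q ← ∈-layers⁻ {N} y∈ =
          reduce (a + b) (subst (_∈ₛ K) (trans (lem x y (a · c) (b · c)) (cong (x ⊕ y ⊝_) (sym (·-+ c a b))))
            (⊕∈ p q))
          where lem = solve 4 (λ x y a b → x :- a :+ (y :- b) := x :+ y :- (a :+ b)) refl
        minus : ∀ {x} → x ∈ layers N → ⊖ x ∈ layers N
        minus {x} x∈ with a , _ , p ← ∈-layers⁻ {N} x∈ =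
          -- Multiples are indexed by natural numbers, so -a is replaced by a(N - 1), which is
          -- congruent to it modulo N.
          reduce (a * (N ∸ 1)) (subst (_∈ₛ K) eq (⊝∈ K (⊖∈ p) (·∈ K a multiple)))
          where
          open ≡-Reasoning
          aN : a * N ≡ a + a * (N ∸ 1)
          aN = trans (cong (a *_) (sym (suc-pred N))) (*-suc a (pred N))
          eq : ⊖ (x ⊝ a · c) ⊝ a · N · c ≡ ⊖ x ⊝ (a * (N ∸ 1)) · c
          eq = begin
            ⊖ (x ⊝ a · c) ⊝ a · N · c ≡⟨ cong (⊖ (x ⊝ a · c) ⊝_) (·-* c a N) ⟩
            ⊖ (x ⊝ a · c) ⊝ (a * N) · c ≡⟨ cong (λ n → ⊖ (x ⊝ a · c) ⊝ n · c) aN ⟩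
            ⊖ (x ⊝ a · c) ⊝ (a + a * (N ∸ 1)) · c ≡⟨ cong (⊖ (x ⊝ a · c) ⊝_) (·-+ c a (a * (N ∸ 1))) ⟩
            ⊖ (x ⊝ a · c) ⊝ (a · c ⊕ (a * (N ∸ 1)) · c)
              ≡⟨ solve 3 (λ x a b → :- (x :- a) :- (a :+ b) := :- x :- b) refl x (a · c) ((a * (N ∸ 1)) · c) ⟩
            ⊖ x ⊝ (a * (N ∸ 1)) · c ∎

      ∈-adjoin⁺ : ∀ a {x} → x ⊝ a · c ∈ₛ K → x ∈ₛ adjoin
      ∈-adjoin⁺ a = reduce a

      ∈-adjoin⁻ : ∀ {x} → x ∈ₛ adjoin → ∃ λ a → a < N × x ⊝ a · c ∈ₛ K
      ∈-adjoin⁻ = ∈-layers⁻ {N}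

      ⊆-adjoin : K ⊆ₛ adjoin
      ⊆-adjoin x∈ = reduce 0 (subst (_∈ₛ K) (sym (⊝-𝟘 _)) x∈)

      generator∈adjoin : c ∈ₛ adjoin
      generator∈adjoin = reduce 1 (subst (_∈ₛ K) (sym (trans (cong (c ⊝_) (G.identityʳ c)) (⊝-self c))) 𝟘∈)

      adjoin-⊆ : ∀ {L} → K ⊆ₛ L → c ∈ₛ L → adjoin ⊆ₛ L
      adjoin-⊆ {L} K⊆L c∈ x∈ = let (a , _ , p) = ∈-adjoin⁻ x∈ in ∈-⊝ʳ L (·∈ L a c∈) (K⊆L p)

      #-adjoin : ∀ {X} → # X adjoin ≡ sumN N (λ a → # (λ x → X (a · c ⊕ x)) K)
      #-adjoin = count-layers N

      card-adjoin : card adjoin ≡ N * card K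
      card-adjoin = length-layers N

    -- The sumset of `X` with the subset sums of the list. As an operation on sets it turns
    -- concatenation into composition, so the effect of newly adjoined elements can be computed on
    -- an arbitrary set.
    Act : List C → SetC → SetC
    Act []      X   = X
    Act (c ∷ D) X x = Act D X x ⊎ Act D X (x ⊝ c)

    Act-cong : ∀ D {X Y} → (∀ {x} → X x → Y x) → ∀ {x} → Act D X x → Act D Y x
    Act-cong []      f p        = f p
    Act-cong (c ∷ D) f (inj₁ p) = inj₁ (Act-cong D f p)
    Act-cong (c ∷ D) f (inj₂ p) = inj₂ (Act-cong D f p)

    Act-⊇ : ∀ D {X x} → X x → Act D X x
    Act-⊇ []      p = p
    Act-⊇ (c ∷ D) p = inj₁ (Act-⊇ D p)

    Act-++⁺ : ∀ D D′ {X x} → Act D (Act D′ X) x → Act (D ++ D′) X x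
    Act-++⁺ []      D′ p        = p
    Act-++⁺ (c ∷ D) D′ (inj₁ p) = inj₁ (Act-++⁺ D D′ p)
    Act-++⁺ (c ∷ D) D′ (inj₂ p) = inj₂ (Act-++⁺ D D′ p)

    Act-++⁻ : ∀ D D′ {X x} → Act (D ++ D′) X x → Act D (Act D′ X) x
    Act-++⁻ []      D′ p        = p
    Act-++⁻ (c ∷ D) D′ (inj₁ p) = inj₁ (Act-++⁻ D D′ p)
    Act-++⁻ (c ∷ D) D′ (inj₂ p) = inj₂ (Act-++⁻ D D′ p)

    Act-shift : ∀ D {X Y k} → (∀ {x} → X x → Y (x ⊕ k)) → ∀ {x} → Act D X x → Act D Y (x ⊕ k)
    Act-shift []      f p        = f p
    Act-shift (c ∷ D) f (inj₁ p) = inj₁ (Act-shift D f p)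
    Act-shift (c ∷ D) {Y = Y} {k} f {x} (inj₂ p) =
      inj₂ (subst (Act D Y) (solve 3 (λ x c k → x :- c :+ k := x :+ k :- c) refl x c k) (Act-shift D f p))

    S : List C → SetC
    S L = Act L (_≡ 𝟘)

    S⊆ : ∀ K L → (∀ {x} → x ∈ L → x ∈ₛ K) → ∀ {x} → S L x → x ∈ₛ K
    S⊆ K []      L⊆K refl     = FinSub.𝟘∈ K
    S⊆ K (c ∷ L) L⊆K (inj₁ p) = S⊆ K L (L⊆K ∘ there) p
    S⊆ K (c ∷ L) L⊆K (inj₂ p) = ∈-⊝ʳ K (L⊆K (here refl)) (S⊆ K L (L⊆K ∘ there) p)

    Digit : ℕ → C → SetC → SetC
    Digit m c X x = ∃ λ j → j ≤ m × X (x ⊝ j · c)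

    -- Every sumset below is invariant under the nontrivial subgroup K₀; the
    -- element h makes it possible to use the same class modulo K₀ twice.
    h : C
    h = proj₁ (unbounded-doubles 0)

    i₀ : ℕ
    i₀ = proj₁ (E-cover h)

    K₀ : FinSub
    K₀ = stage i₀

    h∈ : h ∈ₛ K₀
    h∈ = proj₂ (E-cover h)

    h≢𝟘 : h ≢ 𝟘
    h≢𝟘 eq = proj₂ (unbounded-doubles 0)
      (subst (_∈ E 0) (sym (trans (cong₂ _⊕_ eq eq) (G.identityʳ 𝟘))) (E-𝟘 0))

    Periodic : SetC → Set
    Periodic X = ∀ {x k} → k ∈ₛ K₀ → X x → X (x ⊕ k)

    periodic-shift : ∀ {X} → Periodic X → ∀ {x y} → x ⊝ y ∈ₛ K₀ → X y → X x
    periodic-shift {X} per {x} {y} xy∈ p = subst X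
      (solve 2 (λ x y → y :+ (x :- y) := x) refl x y) (per xy∈ p)

    Act-periodic : ∀ D {X} → Periodic X → Periodic (Act D X)
    Act-periodic D per k∈ = Act-shift D (per k∈)

    -- The elements of the list are multiples of `c` only modulo `K₀`, so their subset sums can
    -- replace 0, c, ..., mc only when a `K₀`-periodic set is added to them.
    ActsAsDigits : ℕ → C → List C → Set₁
    ActsAsDigits m c D = ∀ {X} → Periodic X → ∀ {x} → Act D X x ⇔ Digit m c X x

    -- With a ≤ b + 1 the digit ranges 0, ..., b and a, ..., a + b leave no gap, so together they
    -- are 0, ..., a + b.
    module DigitStep {c e : C} {a b : ℕ} {D : List C} (e∼ac : e ⊝ a · c ∈ₛ K₀) (a≤1+b : a ≤ suc b)
                     (acts : ActsAsDigits b c D) where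

      private
        rearrange : ∀ x j → x ⊝ e ⊝ j · c ⊝ (x ⊝ (a + j) · c) ∈ₛ K₀
        rearrange x j = subst (_∈ₛ K₀)
          (trans (solve 4 (λ x e a j → a :- e := x :- e :- j :- (x :- (a :+ j))) refl x e (a · c) (j · c))
                 (cong (λ y → x ⊝ e ⊝ j · c ⊝ (x ⊝ y)) (sym (·-+ c a j))))
          (⊝-sym K₀ e∼ac)

        rearrange′ : ∀ x j → x ⊝ (a + j) · c ⊝ (x ⊝ e ⊝ j · c) ∈ₛ K₀
        rearrange′ x j = ⊝-sym K₀ (rearrange x j)

      digit-step : ActsAsDigits (a + b) c (e ∷ D)
      digit-step {X} per {x} = mk⇔ to from
        where
        to : Act (e ∷ D) X x → Digit (a + b) c X x
        to (inj₁ p) = let (j , j≤b , q) = Equivalence.to (acts per) p in j , ≤-trans j≤b (m≤n+m b a) , q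
        to (inj₂ p) = let (j , j≤b , q) = Equivalence.to (acts per) p in
          a + j , +-monoʳ-≤ a j≤b , periodic-shift {X} per (rearrange′ x j) q
        from : Digit (a + b) c X x → Act (e ∷ D) X x
        from (j , j≤ab , p) with j ≤? b
        ... | yes j≤b = inj₁ (Equivalence.from (acts per) (j , j≤b , p))
        ... | no j≰b  = inj₂ (Equivalence.from (acts per)
          (j ∸ a , ≤-trans (∸-monoˡ-≤ a j≤ab) (≤-reflexive (m+n∸m≡n a b))
          , periodic-shift {X} per (rearrange x (j ∸ a)) (subst (λ i → X (x ⊝ i · c)) (sym (m+[n∸m]≡n a≤j)) p)))
          where a≤j = ≤-trans a≤1+b (≰⇒> j≰b)

    -- The bound in `near` serves two purposes: within the recursion it keeps older elements below
    -- the next, larger one, and outside it shows that the elements avoid `K`.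
    record DigitList (K : FinSub) (c : C) (m : ℕ) : Set₁ where
      field
        list   : List C
        unique : Unique list
        near   : ∀ {x} → x ∈ list → ∃ λ j → 0 < j × j ≤ ⌈ m /2⌉ × x ⊝ j · c ∈ₛ K₀
        acts   : ActsAsDigits m c list

    no-digits : ∀ c → ActsAsDigits 0 c []
    no-digits c {X} per {x} = mk⇔
      (λ p → 0 , z≤n , subst X (sym (⊝-𝟘 x)) p)
      (λ { (zero , _ , p) → subst X (⊝-𝟘 x) p })

    ·1-∼ : ∀ c → c ⊝ 1 · c ∈ₛ K₀
    ·1-∼ c = subst (_∈ₛ K₀) (sym (trans (cong (c ⊝_) (G.identityʳ c)) (⊝-self c))) (FinSub.𝟘∈ K₀)

    ⌈m/2⌉-decreases : ∀ k → ⌈ ⌊ 3 + k /2⌋ /2⌉ < ⌈ 3 + k /2⌉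
    ⌈m/2⌉-decreases k = s≤s (s≤s (⌊n/2⌋-mono (s≤s⁻¹ (⌊n/2⌋<n k))))

    -- The distinct elements ⌈m/2⌉ c, ⌈⌊m/2⌋/2⌉ c, … have all multiples 0, …, m of c
    -- as subset sums; only the last two can coincide, which h repairs.
    digit-list : ∀ K → K₀ ⊆ₛ K → ∀ c m → (∀ {j} → 0 < j → j ≤ m → j · c ∉ₛ K) → DigitList K c m
    digit-list K K₀⊆K c m = go m (<-wellFounded m)
      where
      go : ∀ m → Acc _<_ m → (∀ {j} → 0 < j → j ≤ m → j · c ∉ₛ K) → DigitList K c m
      go 0 _ _ = record
        { list = [] ; unique = [] ; near = λ () ; acts = no-digits c }
      go 1 _ _ = record
        { list = c ∷ [] ; unique = [] ∷ []
        ; near = λ { (here refl) → 1 , s≤s z≤n , s≤s z≤n , ·1-∼ c }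
        ; acts = DigitStep.digit-step {b = 0} (·1-∼ c) (s≤s z≤n) (no-digits c) }
      go 2 _ _ = record
        { list   = c ⊕ h ∷ c ∷ []
        ; unique = ((λ eq → h≢𝟘 (⊕-cancelˡ c (trans eq (sym (G.identityʳ c))))) ∷ []) ∷ [] ∷ []
        ; near   = λ { (here refl) → 1 , s≤s z≤n , s≤s z≤n , ch∼
                     ; (there (here refl)) → 1 , s≤s z≤n , s≤s z≤n , ·1-∼ c }
        ; acts   = DigitStep.digit-step {b = 1} ch∼ (s≤s z≤n)
                     (DigitStep.digit-step {b = 0} (·1-∼ c) (s≤s z≤n) (no-digits c)) }
        where
        ch∼ : c ⊕ h ⊝ 1 · c ∈ₛ K₀
        ch∼ = subst (_∈ₛ K₀) (sym (trans (cong (c ⊕ h ⊝_) (G.identityʳ c))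
                (solve 2 (λ c h → c :+ h :- c := h) refl c h))) h∈
      go m@(suc (suc (suc k))) (acc rs) free = record
        { list   = a · c ∷ R.list
        ; unique = All.tabulate fresh ∷ R.unique
        ; near   = λ { (here refl) → a , s≤s z≤n , ≤-refl , ac∼
                     ; (there x∈) → let (j , 0<j , j≤ , p) = R.near x∈ in
                                    j , 0<j , ≤-trans j≤ (<⇒≤ (⌈m/2⌉-decreases k)) , p }
        ; acts   = subst (λ n → ActsAsDigits n c (a · c ∷ R.list)) a+b≡m
                     (DigitStep.digit-step ac∼ (⌈n/2⌉≤1+⌊n/2⌋ m) R.acts) }
        where
        a b : ℕ
        a = ⌈ m /2⌉
        b = ⌊ m /2⌋
        ⌈n/2⌉≤1+⌊n/2⌋ : ∀ n → ⌈ n /2⌉ ≤ suc ⌊ n /2⌋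
        ⌈n/2⌉≤1+⌊n/2⌋ 0 = z≤n
        ⌈n/2⌉≤1+⌊n/2⌋ 1 = s≤s z≤n
        ⌈n/2⌉≤1+⌊n/2⌋ (suc (suc n)) = s≤s (⌈n/2⌉≤1+⌊n/2⌋ n)
        a+b≡m : a + b ≡ m
        a+b≡m = trans (+-comm a b) (⌊n/2⌋+⌈n/2⌉≡n m)
        rest : DigitList K c b
        rest = go b (rs (⌊n/2⌋<n (suc (suc k)))) λ 0<j j≤b → free 0<j (≤-trans j≤b (⌊n/2⌋≤n m))
        module R = DigitList rest
        ac∼ : a · c ⊝ a · c ∈ₛ K₀
        ac∼ = subst (_∈ₛ K₀) (sym (⊝-self _)) (FinSub.𝟘∈ K₀)
        fresh : ∀ {y} → y ∈ R.list → a · c ≢ y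
        fresh y∈ refl = let (j , 0<j , j≤ , p) = R.near y∈
                            j<a = ≤-<-trans j≤ (⌈m/2⌉-decreases k) in
          free (m<n⇒0<n∸m j<a) (≤-trans (m∸n≤m a j) (⌈n/2⌉≤n m))
            (subst (_∈ₛ K) (sym (·-∸ c (<⇒≤ j<a))) (K₀⊆K p))

    -- Extensions of equal density

    record Valid (K : FinSub) (L : List C) : Set where
      field
        unique   : Unique L
        inside   : ∀ {x} → x ∈ L → x ∈ₛ K
        periodic : Periodic (S L)
        K₀⊆      : K₀ ⊆ₛ K

      S-inside : ∀ {x} → S L x → x ∈ₛ K
      S-inside = S⊆ K L inside

    record Grow (K : FinSub) (L : List C) (K′ : FinSub) (L′ : List C) : Set where
      field
        K⊆       : K ⊆ₛ K′
        valid    : Valid K′ L′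
        extends  : ∀ {x} → x ∈ L → x ∈ L′
        S⊆S      : ∀ {x} → S L x → S L′ x
        restrict : ∀ {x} → x ∈ₛ K → S L′ x → S L x

    grow-refl : ∀ {K L} → Valid K L → Grow K L K L
    grow-refl v = record { K⊆ = id ; valid = v ; extends = id ; S⊆S = id ; restrict = λ _ → id }

    grow-trans : ∀ {K L K′ L′ K″ L″} → Grow K L K′ L′ → Grow K′ L′ K″ L″ → Grow K L K″ L″
    grow-trans p q = record
      { K⊆ = K⊆ q ∘ K⊆ p ; valid = valid q ; extends = extends q ∘ extends p ; S⊆S = S⊆S q ∘ S⊆S p
      ; restrict = λ x∈ → restrict p x∈ ∘ restrict q (K⊆ p x∈) }
      where open Grow

    grow-enlarge : ∀ {K L K′ L′ K″} → Grow K L K′ L′ → K′ ⊆ₛ K″ → Grow K L K″ L′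
    grow-enlarge p K′⊆ = record
      { K⊆ = K′⊆ ∘ K⊆ p ; extends = extends p ; S⊆S = S⊆S p ; restrict = restrict p
      ; valid = record { unique = V.unique ; inside = K′⊆ ∘ V.inside ; periodic = V.periodic ; K₀⊆ = K′⊆ ∘ V.K₀⊆ }
        }
      where
      open Grow
      module V = Valid (valid p)

    valid-by : ∀ {K L K′} D → Valid K L → K ⊆ₛ K′ → Unique D → (∀ {x} → x ∈ D → x ∉ₛ K) →
               (∀ {x} → x ∈ D → x ∈ₛ K′) → Valid K′ (D ++ L)
    valid-by {K} {L} {K′} D v K⊆K′ uD out inside = record
      { unique = Unique.++⁺ uD V.unique λ (p , q) → out p (V.inside q)
      ; inside = λ x∈ → case-++ (∈-++⁻ D x∈)
      ; periodic = λ k∈ p → Act-++⁺ D L (Act-periodic D V.periodic k∈ (Act-++⁻ D L p))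
      ; K₀⊆ = K⊆K′ ∘ V.K₀⊆ }
      where
      module V = Valid v
      case-++ : ∀ {x} → x ∈ D ⊎ x ∈ L → x ∈ₛ K′
      case-++ (inj₁ x∈) = inside x∈
      case-++ (inj₂ x∈) = K⊆K′ (V.inside x∈)

    grow-by : ∀ {K L K′} D → Valid K L → K ⊆ₛ K′ → Unique D → (∀ {x} → x ∈ D → x ∉ₛ K) →
              (∀ {x} → x ∈ D → x ∈ₛ K′) → (∀ {x} → x ∈ₛ K → Act D (S L) x → S L x) →
              Grow K L K′ (D ++ L)
    grow-by {K} {L} {K′} D v K⊆K′ uD out inside restr = record
      { K⊆ = K⊆K′
      ; valid = valid-by {K} {L} {K′} D v K⊆K′ uD out inside
      ; extends = ∈-++⁺ʳ D
      ; S⊆S = λ p → Act-++⁺ D L (Act-⊇ D p)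
      ; restrict = λ x∈ p → restr x∈ (Act-++⁻ D L p) }

    same-digit : ∀ {K c N} → Order K c N → ∀ {a b x} → a < N → b < N → x ∈ₛ K → x ⊕ a · c ⊝ b · c ∈ₛ K → a ≡ b
    same-digit {K} {c} ord {a} {b} {x} a<N b<N x∈ p = Order.distinct ord a<N b<N
      (∈-⊕ˡ K x∈ (subst (_∈ₛ K) (G.assoc x (a · c) (⊖ (b · c))) p))

    cancel-digit : ∀ {X : SetC} {c a b x} → a ≡ b → X (x ⊕ a · c ⊝ b · c) → X x
    cancel-digit {X} {c} {a} {x = x} refl = subst X (⊕-⊝ x (a · c))

    near-∉ : ∀ {K c N} → K₀ ⊆ₛ K → Order K c N → ∀ {x j} → 0 < j → j < N → x ⊝ j · c ∈ₛ K₀ → x ∉ₛ K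
    near-∉ {K} K₀⊆K ord 0<j j<N p x∈ = Order.minimal ord 0<j j<N (∈-⊝ˡ K x∈ (K₀⊆K p))

    near-∈ : ∀ {K c N x} → K₀ ⊆ₛ K → (ord : Order K c N) → ∀ j → x ⊝ j · c ∈ₛ K₀ → x ∈ₛ adjoin K c ord
    near-∈ K₀⊆K ord j p = ∈-adjoin⁺ _ _ ord j (K₀⊆K p)

    -- The exact form of `Above` and `Below`, used where the density is kept. The shift is recorded
    -- to lie in `M` because `finish-drop` compares it with elements of an earlier stage and must
    -- not leave that stage.
    Copies : FinSub → SetC → FinSub → SetC → FinSub → Set
    Copies M S K X L = ∀ {g} → g ∈ₛ L → ∃ λ t → t ∈ₛ M × t ⊝ g ∈ₛ K × (∀ {x} → x ∈ₛ K → S x ⇔ X (x ⊕ t))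

    Copies⇒Above : ∀ {M S K X L} → Copies M S K X L → Above S K X L
    Copies⇒Above f g∈ = let (t , _ , tg∈ , p) = f g∈ in t , tg∈ , λ x∈ → Equivalence.to (p x∈)

    Copies⇒Below : ∀ {M S K X L} → Copies M S K X L → Below S K X L
    Copies⇒Below f g∈ = let (t , _ , tg∈ , p) = f g∈ in t , tg∈ , λ x∈ → Equivalence.from (p x∈)

    Copies-refl : ∀ {M X K} → Copies M X K X K
    Copies-refl {M} {X} {K} {g} g∈ = 𝟘 , FinSub.𝟘∈ M , subst (_∈ₛ K) (sym (G.identityˡ _)) (FinSub.⊖∈ K g∈) ,
      λ {x} _ → mk⇔ (subst X (sym (G.identityʳ x))) (subst X (G.identityʳ x))

    Copies-trans : ∀ {M S K X L Y N} → K ⊆ₛ L → Copies M S K X L → Copies M X L Y N → Copies M S K Y N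
    Copies-trans {M} {K = K} {L = L} {Y} K⊆L f k {g} g∈ with t , t∈ , tg∈ , p ← k g∈ with u , u∈ , ug∈ ,
      q ← f (⊝-sym L tg∈)
      = u ⊕ t , FinSub.⊕∈ M u∈ t∈ , subst (_∈ₛ K) (solve 3 (λ u g t → u :- (g :- t) := u :+ t :- g) refl u g t)
        ug∈
      , λ {x} x∈ →
          let r = p (FinSub.⊕∈ L (K⊆L x∈) (∈-⊝ʳ L (⊝-sym L tg∈) (K⊆L ug∈))) in
          mk⇔ (λ s → subst Y (G.assoc x u t) (Equivalence.to r (Equivalence.to (q x∈) s)))
              (λ y → Equivalence.from (q x∈) (Equivalence.from r (subst Y (sym (G.assoc x u t)) y)))

    -- The digits 0, ..., N - 1 represent every coset of `K` in the extension exactly once, so each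
    -- coset receives one translate of `S L` and the density stays the same.
    module Keep (M K : FinSub) (L : List C) (v : Valid K L) {c : C} {N : ℕ} (c∈M : c ∈ₛ M) (ord : Order K c N) where
      open Valid v
      open Order ord
      digits : DigitList K c (N ∸ 1)
      digits = digit-list K K₀⊆ c (N ∸ 1) λ 0<j j≤ → minimal 0<j (≤-<-trans j≤ (∸-monoʳ-< (s≤s z≤n) positive))
      open DigitList digits using (list; near; acts)

      digit<N : ∀ {j} → j ≤ N ∸ 1 → j < N
      digit<N j≤ = ≤-<-trans j≤ (∸-monoʳ-< (s≤s z≤n) positive)

      keep-grow : Grow K L (adjoin K c ord) (list ++ L)
      keep-grow = grow-by list v (⊆-adjoin K c ord) (DigitList.unique digits)
        (λ x∈ → let (j , 0<j , j≤ , p) = near x∈ in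
                near-∉ {K} {c} {N} K₀⊆ ord {j = j} 0<j (digit<N (≤-trans j≤ (⌈n/2⌉≤n (N ∸ 1)))) p)
        (λ x∈ → let (j , _ , _ , p) = near x∈ in near-∈ {K} {c} {N} K₀⊆ ord j p)
        λ x∈ p → restr x∈ (Equivalence.to (acts periodic) p)
        where
        restr : ∀ {x} → x ∈ₛ K → Digit (N ∸ 1) c (S L) x → S L x
        restr {x} x∈ (zero , _ , p)  = subst (S L) (⊝-𝟘 x) p
        restr x∈ (suc j , j≤ , p) = contradiction (∈-⊝ˡ K x∈ (S-inside p)) (minimal (s≤s z≤n) (digit<N j≤))

      keep-copies : Copies M (S L) K (S (list ++ L)) (adjoin K c ord)
      keep-copies {g} g∈ with a , a<N , p ← ∈-adjoin⁻ K c ord g∈ =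
        a · c , ·∈ M a c∈M , ⊝-sym K p , λ {x} x∈ → mk⇔
          (λ s → Act-++⁺ list L (Equivalence.from (acts periodic)
            (a , s≤s⁻¹ (subst (a <_) (sym (suc-pred N {{>-nonZero positive}})) a<N) ,
                   subst (S L) (sym (⊕-⊝ x (a · c))) s)))
          (λ s → digit x∈ (Equivalence.to (acts periodic) (Act-++⁻ list L s)))
        where
        digit : ∀ {x} → x ∈ₛ K → Digit (N ∸ 1) c (S L) (x ⊕ a · c) → S L x
        digit x∈ (j , j≤ , s) = cancel-digit {S L} {c} {a} {j}
          (same-digit {K} {c} {N} ord a<N (digit<N j≤) x∈ (S-inside s)) s

    -- `B⊆` and `within` bound `K′` from below and above. When `B` lists a stage that contains `K`
    -- and `M` is that stage, they identify `K′` with it; this is how `settle` returns from an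
    -- auxiliary subgroup to the filtration.
    record KeepChain (M : FinSub) (B : List C) (K : FinSub) (L : List C) : Set₁ where
      field
        K′ : FinSub
        L′ : List C
        grow   : Grow K L K′ L′
        copies : Copies M (S L) K (S L′) K′
        B⊆     : ∀ {x} → x ∈ B → x ∈ₛ K′
        within : ∀ {Z} → K ⊆ₛ Z → M ⊆ₛ Z → K′ ⊆ₛ Z

    keep-chain : ∀ M B K L → (∀ {x} → x ∈ B → x ∈ₛ M) → Valid K L → KeepChain M B K L
    keep-chain M [] K L _ v = record
      { K′ = K ; L′ = L ; grow = grow-refl v ; copies = Copies-refl {M} {S L} {K} ; B⊆ = λ () ; within = λ K⊆Z _ →
        K⊆Z }
    keep-chain M (b ∷ B) K L B⊆M v with em {b ∈ₛ K}
    ... | yes b∈K = record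
      { K′ = R.K′ ; L′ = R.L′ ; grow = R.grow ; copies = R.copies ; within = λ {Z} →
        R.within {Z} ; B⊆ = λ { (here refl) → Grow.K⊆ R.grow b∈K ; (there x∈) → R.B⊆ x∈ } }
      where module R = KeepChain (keep-chain M B K L (B⊆M ∘ there) v)
    ... | no _ = record
      { K′ = R.K′ ; L′ = R.L′ ; grow = grow-trans keep-grow R.grow
      ; copies = Copies-trans {M} {S L} {K} {S (list ++ L)} {adjoin K b ord} {S R.L′} {R.K′}
        (⊆-adjoin K b ord) keep-copies R.copies
      ; B⊆ = λ { (here refl) → Grow.K⊆ R.grow (generator∈adjoin K b ord) ; (there x∈) → R.B⊆ x∈ }
      ; within = λ {Z} K⊆Z M⊆Z → R.within {Z} (adjoin-⊆ K b ord {Z} K⊆Z (M⊆Z (B⊆M (here refl)))) M⊆Z }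
      where
      order : ∃ λ N → Order K b N
      order = order-exists K M (B⊆M (here refl))
      ord = proj₂ order
      open Keep M K L v (B⊆M (here refl)) ord
      open DigitList digits using (list)
      module R = KeepChain (keep-chain M B (adjoin K b ord) (list ++ L) (B⊆M ∘ there) (Grow.valid keep-grow))

    -- Densities

    card-positive : ∀ K → 0 < card K
    card-positive K = go (FinSub.𝟘∈ K)
      where
      go : ∀ {x} {es : List C} → x ∈ es → 0 < length es
      go (here _)  = s≤s z≤n
      go (there _) = s≤s z≤n

    dens : SetC → FinSub → ℚ
    dens X K = frac (# X K) (card K)

    0≤dens : ∀ X K → 0ℚ ℚ.≤ dens X K
    0≤dens X K = 0≤frac (# X K) (card K)

    dens≤1 : ∀ X K → dens X K ℚ.≤ 1ℚ
    dens≤1 X K = subst (dens X K ℚ.≤_) ι-1 (frac-mono (card-positive K) (s≤s z≤n)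
      (≤-trans (≤-reflexive (*-identityʳ _)) (≤-trans (#≤card {X} K) (≤-reflexive (sym (*-identityˡ _))))))

    dens-mono : ∀ X Y K → (∀ {x} → x ∈ₛ K → X x → Y x) → dens X K ℚ.≤ dens Y K
    dens-mono X Y K f = frac-mono (card-positive K) (card-positive K)
      (*-monoˡ-≤ (card K) (count-mono {X} {Y} (FinSub.elements K) f))

    dens-Above : ∀ S K X L → K ⊆ₛ L → Above S K X L → dens S K ℚ.≤ dens X L
    dens-Above S K X L K⊆L a =
      frac-mono (card-positive K) (card-positive L) (Above⇒≤ {S} {K} {X} {L} K⊆L a)

    dens-Below : ∀ S K X L → K ⊆ₛ L → Below S K X L → dens X L ℚ.≤ dens S K
    dens-Below S K X L K⊆L b =
      frac-mono (card-positive L) (card-positive K) (Below⇒≤ {S} {K} {X} {L} K⊆L b)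

    δ : List C → ℕ → ℚ
    δ L j = dens (S L) (stage j)

    Stage-Grow : ℕ → List C → ℕ → List C → Set
    Stage-Grow i L l L′ = Grow (stage i) L (stage l) L′

    δ-stable : ∀ {i L l L′} → Stage-Grow i L l L′ → ∀ {j} → j ≤ i → δ L′ j ≡ δ L j
    δ-stable {i} {L} {l} {L′} g {j} j≤i = ℚP.≤-antisym
      (dens-mono (S L′) (S L) (stage j) (λ x∈ → Grow.restrict g (stage-mono j≤i x∈)))
      (dens-mono (S L) (S L′) (stage j) (λ _ → Grow.S⊆S g))

    record Path (i : ℕ) (L : List C) (l : ℕ) (L′ : List C) (lo hi : ℚ) : Set where
      field
        i≤l   : i ≤ l
        grow  : Stage-Grow i L l L′
        above : ∀ {j} → i ≤ j → j ≤ l → lo ℚ.≤ δ L′ j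
        below : ∀ {j} → i ≤ j → j ≤ l → δ L′ j ℚ.≤ hi

    path-refl : ∀ {i L lo hi} → Valid (stage i) L → lo ℚ.≤ δ L i → δ L i ℚ.≤ hi → Path i L i L lo hi
    path-refl {i} {L} {lo} {hi} v lo≤ ≤hi = record
      { i≤l = ≤-refl ; grow = grow-refl v
      ; above = λ i≤j j≤i → subst (λ k → lo ℚ.≤ δ L k) (≤-antisym i≤j j≤i) lo≤
      ; below = λ i≤j j≤i → subst (λ k → δ L k ℚ.≤ hi) (≤-antisym i≤j j≤i) ≤hi }

    path-trans : ∀ {i L l L′ m L″ lo hi} → Path i L l L′ lo hi → Path l L′ m L″ lo hi → Path i L m L″ lo hi
    path-trans {i} {L} {l} {L′} {m} {L″} {lo} {hi} p q = record
      { i≤l = ≤-trans P.i≤l P′.i≤l ; grow = grow-trans P.grow P′.grow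
      ; above = λ {j} i≤j j≤m → by-cases (lo ℚ.≤_) j (P.above i≤j) (λ l≤j → P′.above l≤j j≤m)
      ; below = λ {j} i≤j j≤m → by-cases (ℚ._≤ hi) j (P.below i≤j) (λ l≤j → P′.below l≤j j≤m) }
      where
      module P = Path p
      module P′ = Path q
      by-cases : (R : ℚ → Set) → ∀ j → (j ≤ l → R (δ L′ j)) → (l ≤ j → R (δ L″ j)) → R (δ L″ j)
      by-cases R j f g with j ≤? l
      ... | yes j≤l = subst R (sym (δ-stable P′.grow j≤l)) (f j≤l)
      ... | no j≰l  = g (<⇒≤ (≰⇒> j≰l))

    path-weaken : ∀ {i L l L′ lo hi lo′ hi′} → lo′ ℚ.≤ lo → hi ℚ.≤ hi′ → Path i L l L′ lo hi →
      Path i L l L′ lo′ hi′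
    path-weaken lo hi p = record
      { i≤l = P.i≤l ; grow = P.grow
      ; above = λ i≤j j≤l → ℚP.≤-trans lo (P.above i≤j j≤l)
      ; below = λ i≤j j≤l → ℚP.≤-trans (P.below i≤j j≤l) hi }
      where module P = Path p

    -- Descending and climbing back by abstract gadgets

    One : ℕ → Set
    One j = j ≤ 1

    V1 : (ℕ → Set) → C → SetC
    V1 ok q v = ∃ λ j → ok j × v ≡ j · q

    VS : (ℕ → Set) → List C → SetC
    VS ok []       v = v ≡ 𝟘
    VS ok (q ∷ qs) v = ∃ λ j → ok j × VS ok qs (v ⊝ j · q)

    VS-inside : ∀ ok K qs → (∀ {q} → q ∈ qs → q ∈ₛ K) → ∀ {v} → VS ok qs v → v ∈ₛ K
    VS-inside ok K []       qs⊆ refl        = FinSub.𝟘∈ K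
    VS-inside ok K (q ∷ qs) qs⊆ (j , _ , w) =
      ∈-⊝ʳ K (·∈ K j (qs⊆ (here refl))) (VS-inside ok K qs (qs⊆ ∘ there) w)

    V1-inside : ∀ ok K {q v} → q ∈ₛ K → V1 ok q v → v ∈ₛ K
    V1-inside ok K q∈ (j , _ , refl) = ·∈ K j q∈

    ⊞VS-∷⁺ : ∀ ok S q qs {x} → ((S ⊞ V1 ok q) ⊞ VS ok qs) x → (S ⊞ VS ok (q ∷ qs)) x
    ⊞VS-∷⁺ ok S q qs {x} (w , w∈ , _ , (j , okj , refl) , s) =
      w ⊕ j · q , (j , okj , subst (VS ok qs) (sym (⊕-⊝ w (j · q))) w∈)
      , subst S (solve 3 (λ x w y → x :- w :- y := x :- (w :+ y)) refl x w (j · q)) s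

    ⊞VS-∷⁻ : ∀ ok S q qs {x} → (S ⊞ VS ok (q ∷ qs)) x → ((S ⊞ V1 ok q) ⊞ VS ok qs) x
    ⊞VS-∷⁻ ok S q qs {x} (v , (j , okj , w∈) , s) =
      v ⊝ j · q , w∈ , j · q , (j , okj , refl)
      , subst S (solve 3 (λ x v y → x :- v := x :- (v :- y) :- y) refl x v (j · q)) s

    ⊞VS-[]⁺ : ∀ ok S {x} → S x → (S ⊞ VS ok []) x
    ⊞VS-[]⁺ ok S {x} s = 𝟘 , refl , subst S (sym (⊝-𝟘 x)) s

    ⊞VS-[]⁻ : ∀ ok S {x} → (S ⊞ VS ok []) x → S x
    ⊞VS-[]⁻ ok S {x} (_ , refl , s) = subst S (⊝-𝟘 x) s

    ⊞VS-⊇ : ∀ ok S → ok 0 → ∀ qs {x} → S x → (S ⊞ VS ok qs) x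
    ⊞VS-⊇ ok S ok0 [] s = ⊞VS-[]⁺ ok S s
    ⊞VS-⊇ ok S ok0 (q ∷ qs) {x} s =
      ⊞VS-∷⁺ ok S q qs (⊞VS-⊇ ok (S ⊞ V1 ok q) ok0 qs (𝟘 , (0 , ok0 , refl) , subst S (sym (⊝-𝟘 x)) s))

    ⊞V1-⊇ : ∀ ok S q → ok 0 → ∀ {x} → S x → (S ⊞ V1 ok q) x
    ⊞V1-⊇ ok S q ok0 {x} s = 𝟘 , (0 , ok0 , refl) , subst S (sym (⊝-𝟘 x)) s

    -- A density lost in a drop is recovered by adding the element q again; ok says
    -- which multiples of q may be added without exceeding the old density.
    record Drop (ok : ℕ → Set) (M M′ i : ℕ) (L : List C) : Set where
      field
        l     : ℕ
        L′    : List C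
        q     : C
        i≤l   : i ≤ l
        grow  : Stage-Grow i L l L′
        q∈    : q ∈ₛ stage l
        q∉    : q ∉ₛ K₀
        above : ∀ {j} → j < l → Above (S L) (stage i) (S L′) (stage j)
        hull  : Below (S L) (stage i) (S L′ ⊞ V1 ok q) (stage l)
        full  : Above (S L) (stage i) (S L′ ⊞ V1 One q) (stage l)
        small : ι M ℚ.* δ L i ℚ.≤ ι M ℚ.* δ L′ l ℚ.+ 1ℚ
        large : ι M′ ℚ.* δ L′ l ℚ.+ δ L i ℚ.≤ ι M′ ℚ.* δ L i

    -- Lost densities are recovered one q at a time. The set U in `gain` stands for the sums of the
    -- elements that are still waiting, so that the errors of successive fills simply add up.
    record Fill (ok : ℕ → Set) (M i : ℕ) (L : List C) (q : C) : Set₁ where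
      field
        l     : ℕ
        L′    : List C
        i≤l   : i ≤ l
        grow  : Stage-Grow i L l L′
        above : Above (S L) (stage i) (S L′) (stage l)
        below : Below (S L ⊞ V1 ok q) (stage i) (S L′) (stage l)
        gain  : ∀ {U} → (∀ {u} → U u → u ∈ₛ stage i) →
                dens (S L ⊞ V1 One q ⊞ U) (stage i) ℚ.≤ dens (S L′ ⊞ U) (stage l) ℚ.+ frac 1 M

    -- The distinction between unbounded and bounded orders enters the oscillation only through this
    -- interface. A drop loses at most 1/M and at least the fraction 1/M′ of the present density; M′
    -- depends on M alone, which makes a descent finite.
    record Gadgets : Set₁ where
      field
        ok   : ℕ → Set
        ok-0 : ok 0
        drop : ∀ M → 2 ≤ M → ∃ λ M′ → 0 < M′ × (∀ i L → Valid (stage i) L → Drop ok M M′ i L)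
        fill : ∀ M → 0 < M → ∀ i L q → Valid (stage i) L → q ∈ₛ stage i → q ∉ₛ K₀ → Fill ok M i L q

    module Moves (gadgets : Gadgets) where
      open Gadgets gadgets

      record Up (M i : ℕ) (L : List C) (qs : List C) : Set where
        field
          l    : ℕ
          L′   : List C
          path : Path i L l L′ (δ L i) (dens (S L ⊞ VS ok qs) (stage i))
          gain : dens (S L ⊞ VS One qs) (stage i) ℚ.≤ δ L′ l ℚ.+ frac 1 M

      up : ∀ qs M → 0 < M → ∀ i L → Valid (stage i) L →
           (∀ {q} → q ∈ qs → q ∈ₛ stage i × q ∉ₛ K₀) → Up M i L qs
      up [] M 0<M i L v _ = record
        { l = i ; L′ = L ; path = path-refl v ℚP.≤-refl
          (dens-mono (S L) (S L ⊞ VS ok []) (stage i) (λ _ → ⊞VS-[]⁺ ok (S L)))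
        ; gain = ≤-by (frac 1 M ℚ.+ (δ L i ℚ.- d))
          (+-nonNeg (0≤frac 1 M) (0≤p-q (dens-mono (S L ⊞ VS One []) (S L) (stage i) (λ _ → ⊞VS-[]⁻ One (S L)))))
            (ℚsolve 3 (λ a b c → a :+q b :=q c :+q (b :+q (a :-q c))) refl (δ L i) (frac 1 M) d) }
        where
        d = dens (S L ⊞ VS One []) (stage i)
      up (q ∷ qs) M 0<M i L v qs∈ = record
        { l = R.l ; L′ = R.L′
        ; path = path-trans (path-weaken ℚP.≤-refl F≤ (record
            { i≤l = F.i≤l ; grow = F.grow
            ; above = λ {j} i≤j j≤l → dens-Above (S L) (stage i) (S F.L′) (stage j) (stage-mono i≤j)
              (λ g∈ → F.above (stage-mono j≤l g∈))
            ; below = λ {j} i≤j j≤l → dens-Below (S L ⊞ V1 ok q) (stage i) (S F.L′) (stage j) (stage-mono i≤j)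
              (λ g∈ → F.below (stage-mono j≤l g∈)) }))
            (path-weaken (dens-Above (S L) (stage i) (S F.L′) (stage F.l) i⊆l F.above) hull R.path)
        ; gain = gain }
        where
        -- Half of the error 1/M is spent on `q` and the other half on the remaining list.
        2M = M + M
        module F = Fill (fill 2M (≤-trans 0<M (m≤m+n M M)) i L q v (proj₁ (qs∈ (here refl))) (proj₂ (qs∈ (here refl))))
        i⊆l : stage i ⊆ₛ stage F.l
        i⊆l = stage-mono F.i≤l
        qs⊆ : ∀ {q} → q ∈ qs → q ∈ₛ stage i
        qs⊆ = proj₁ ∘ qs∈ ∘ there
        module R = Up (up qs 2M (≤-trans 0<M (m≤m+n M M)) F.l F.L′ (Grow.valid F.grow)
                          (λ q∈ → i⊆l (proj₁ (qs∈ (there q∈))) , proj₂ (qs∈ (there q∈))))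
        F≤ : dens (S L ⊞ V1 ok q) (stage i) ℚ.≤ dens (S L ⊞ VS ok (q ∷ qs)) (stage i)
        F≤ = dens-mono (S L ⊞ V1 ok q) (S L ⊞ VS ok (q ∷ qs)) (stage i)
               (λ _ s → ⊞VS-∷⁺ ok (S L) q qs (⊞VS-⊇ ok (S L ⊞ V1 ok q) ok-0 qs s))
        hull : dens (S F.L′ ⊞ VS ok qs) (stage F.l) ℚ.≤ dens (S L ⊞ VS ok (q ∷ qs)) (stage i)
        hull = ℚP.≤-trans (dens-Below (S L ⊞ V1 ok q ⊞ VS ok qs) (stage i) (S F.L′ ⊞ VS ok qs) (stage F.l) i⊆l
                            (Below-⊞ {S L ⊞ V1 ok q} {stage i} {S F.L′} {stage F.l} {VS ok qs}
                              (VS-inside ok (stage i) qs qs⊆) F.below))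
                          (dens-mono (S L ⊞ V1 ok q ⊞ VS ok qs) (S L ⊞ VS ok (q ∷ qs)) (stage i)
                            (λ _ → ⊞VS-∷⁺ ok (S L) q qs))
        gain : dens (S L ⊞ VS One (q ∷ qs)) (stage i) ℚ.≤ δ R.L′ R.l ℚ.+ frac 1 M
        gain = begin
          dens (S L ⊞ VS One (q ∷ qs)) (stage i)
            ≤⟨ dens-mono (S L ⊞ VS One (q ∷ qs)) (S L ⊞ V1 One q ⊞ VS One qs) (stage i)
            (λ _ → ⊞VS-∷⁻ One (S L) q qs) ⟩
          dens (S L ⊞ V1 One q ⊞ VS One qs) (stage i)
            ≤⟨ F.gain {VS One qs} (VS-inside One (stage i) qs qs⊆) ⟩
          dens (S F.L′ ⊞ VS One qs) (stage F.l) ℚ.+ frac 1 2M ≤⟨ ℚP.+-monoˡ-≤ (frac 1 2M) R.gain ⟩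
          δ R.L′ R.l ℚ.+ frac 1 2M ℚ.+ frac 1 2M             ≡⟨ ℚP.+-assoc (δ R.L′ R.l) (frac 1 2M) (frac 1 2M) ⟩
          δ R.L′ R.l ℚ.+ (frac 1 2M ℚ.+ frac 1 2M)           ≡⟨ cong (δ R.L′ R.l ℚ.+_) (halves 0<M) ⟩
          δ R.L′ R.l ℚ.+ frac 1 M                            ∎
          where open ℚP.≤-Reasoning

      -- The invariant of a descent that started at density `e`; `qs` collects the recovery elements
      -- of its drops. Adding each of them at most once regains `e`, and adding all multiples that a
      -- climb may introduce stays below `e`, so the way back can neither fall short nor overshoot.
      record Hull (i : ℕ) (L : List C) (qs : List C) (e : ℚ) : Set where
        field
          qs∈   : ∀ {q} → q ∈ qs → q ∈ₛ stage i × q ∉ₛ K₀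
          upper : dens (S L ⊞ VS ok qs) (stage i) ℚ.≤ e
          lower : e ℚ.≤ dens (S L ⊞ VS One qs) (stage i)

      record Down (M i : ℕ) (L : List C) (t e : ℚ) : Set where
        field
          l    : ℕ
          L′   : List C
          qs   : List C
          path : Path i L l L′ t e
          hull : Hull l L′ qs e
          near : δ L′ l ℚ.≤ t ℚ.+ frac 1 M

      -- A drop is made only while the density exceeds t + 1/M. Losing at most 1/M, it stays above
      -- `t`; losing at least the fraction 1/M′ of more than 1/M, it loses at least 1/(M M′). As
      -- densities are at most 1, M M′ steps suffice, and `go` recurses on the number of steps left.
      down : ∀ M → 2 ≤ M → ∀ t e → 0ℚ ℚ.≤ t → ∀ i L qs → Valid (stage i) L → t ℚ.≤ δ L i → Hull i L qs e →
        Down M i L t e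
      down M 2≤M t e 0≤t i L qs v t≤ H = go (M * M′) i L qs v t≤ H (begin
        δ L i                           ≤⟨ dens≤1 (S L) (stage i) ⟩
        1ℚ                              ≡⟨ ι-1 ⟨
        ι 1                             ≡⟨ ι-frac 1 {M * M′} 0<MM′ ⟨
        ι (M * M′) ℚ.* ε                ≤⟨ ≤-by (t ℚ.+ frac 1 M) (+-nonNeg 0≤t (0≤frac 1 M))
          (ℚP.+-comm (t ℚ.+ frac 1 M) _) ⟩
        t ℚ.+ frac 1 M ℚ.+ ι (M * M′) ℚ.* ε ∎)
        where
        open ℚP.≤-Reasoning
        M′ = proj₁ (drop M 2≤M)
        0<M = ≤-trans (s≤s z≤n) 2≤M
        0<M′ = proj₁ (proj₂ (drop M 2≤M))
        0<MM′ : 0 < M * M′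
        0<MM′ = *-mono-≤ 0<M 0<M′
        ε = frac 1 (M * M′)
        εM : ι M′ ℚ.* ε ≡ frac 1 M
        εM = ι-cancel-≡ 0<M (trans (sym (ℚP.*-assoc (ι M) (ι M′) ε)) (trans (cong (ℚ._* ε) (sym (ι-* M M′)))
               (trans (ι-frac 1 0<MM′) (sym (ι-frac 1 0<M)))))
        go : ∀ k i L qs → Valid (stage i) L → t ℚ.≤ δ L i → Hull i L qs e →
             δ L i ℚ.≤ t ℚ.+ frac 1 M ℚ.+ ι k ℚ.* ε → Down M i L t e
        go k i L qs v t≤ H bound with δ L i ℚP.≤? t ℚ.+ frac 1 M
        ... | yes near = record
          { l = i ; L′ = L ; qs = qs ; hull = H ; near = near
          ; path = path-refl v t≤ (ℚP.≤-trans (dens-mono (S L) (S L ⊞ VS ok qs) (stage i)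
            (λ _ → ⊞VS-⊇ ok (S L) ok-0 qs)) (Hull.upper H)) }
        go zero i L qs v t≤ H bound | no far = contradiction
          (ℚP.≤-trans bound (ℚP.≤-reflexive (trans (cong (λ z → t ℚ.+ frac 1 M ℚ.+ z ℚ.* ε) ι-0)
            (trans (cong (t ℚ.+ frac 1 M ℚ.+_) (ℚP.*-zeroˡ ε)) (ℚP.+-identityʳ _))))) far
        go (suc k) i L qs v t≤ H bound | no far = record
          { l = R.l ; L′ = R.L′ ; qs = R.qs ; hull = R.hull ; near = R.near
          ; path = path-trans dpath R.path }
          where
          module D = Drop (proj₂ (proj₂ (drop M 2≤M)) i L v)
          module H = Hull H
          far′ : t ℚ.+ frac 1 M ℚ.≤ δ L i
          far′ = ℚP.<⇒≤ (ℚP.≰⇒> far)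
          i⊆l : stage i ⊆ₛ stage D.l
          i⊆l = stage-mono D.i≤l
          qs⊆ : ∀ {q} → q ∈ qs → q ∈ₛ stage i
          qs⊆ = proj₁ ∘ H.qs∈
          t≤′ : t ℚ.≤ δ D.L′ D.l
          t≤′ = ι-cancel-≤ 0<M (begin
            ι M ℚ.* t
              ≡⟨ ℚsolve 3 (λ m t f → m :*q t :=q m :*q (t :+q f) :-q m :*q f) refl (ι M) t (frac 1 M) ⟩
            ι M ℚ.* (t ℚ.+ frac 1 M) ℚ.- ι M ℚ.* frac 1 M
              ≤⟨ ℚP.+-monoˡ-≤ (ℚ.- (ι M ℚ.* frac 1 M)) (ℚP.≤-trans (ι*-mono M far′) D.small) ⟩
            ι M ℚ.* δ D.L′ D.l ℚ.+ 1ℚ ℚ.- ι M ℚ.* frac 1 M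
              ≡⟨ cong (λ z → ι M ℚ.* δ D.L′ D.l ℚ.+ 1ℚ ℚ.- z) (trans (ι-frac 1 0<M) ι-1) ⟩
            ι M ℚ.* δ D.L′ D.l ℚ.+ 1ℚ ℚ.- 1ℚ
              ≡⟨ ℚsolve 2 (λ x o → x :+q o :-q o :=q x) refl (ι M ℚ.* δ D.L′ D.l) 1ℚ ⟩
            ι M ℚ.* δ D.L′ D.l ∎)
          step : δ D.L′ D.l ℚ.+ ε ℚ.≤ δ L i
          step = ι-cancel-≤ 0<M′ (begin
            ι M′ ℚ.* (δ D.L′ D.l ℚ.+ ε) ≡⟨ ℚP.*-distribˡ-+ (ι M′) _ _ ⟩
            ι M′ ℚ.* δ D.L′ D.l ℚ.+ ι M′ ℚ.* ε ≡⟨ cong (ι M′ ℚ.* δ D.L′ D.l ℚ.+_) εM ⟩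
            ι M′ ℚ.* δ D.L′ D.l ℚ.+ frac 1 M ≤⟨ ℚP.+-monoʳ-≤ (ι M′ ℚ.* δ D.L′ D.l)
              (≤-by t 0≤t (ℚP.+-comm t (frac 1 M))) ⟩
            ι M′ ℚ.* δ D.L′ D.l ℚ.+ (t ℚ.+ frac 1 M) ≤⟨ ℚP.+-monoʳ-≤ (ι M′ ℚ.* δ D.L′ D.l) far′ ⟩
            ι M′ ℚ.* δ D.L′ D.l ℚ.+ δ L i ≤⟨ D.large ⟩
            ι M′ ℚ.* δ L i ∎)
          bound′ : δ D.L′ D.l ℚ.≤ t ℚ.+ frac 1 M ℚ.+ ι k ℚ.* ε
          bound′ = begin
            δ D.L′ D.l ≡⟨ ℚsolve 2 (λ d e → d :=q d :+q e :-q e) refl (δ D.L′ D.l) ε ⟩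
            δ D.L′ D.l ℚ.+ ε ℚ.- ε ≤⟨ ℚP.+-monoˡ-≤ (ℚ.- ε) (ℚP.≤-trans step bound) ⟩
            t ℚ.+ frac 1 M ℚ.+ ι (suc k) ℚ.* ε ℚ.- ε
              ≡⟨ cong (λ z → t ℚ.+ frac 1 M ℚ.+ z ℚ.* ε ℚ.- ε) (trans (ι-+ 1 k) (cong (ℚ._+ ι k) ι-1)) ⟩
            t ℚ.+ frac 1 M ℚ.+ (1ℚ ℚ.+ ι k) ℚ.* ε ℚ.- ε
              ≡⟨ cong (λ z → t ℚ.+ frac 1 M ℚ.+ z ℚ.- ε)
                (trans (ℚP.*-distribʳ-+ ε 1ℚ (ι k)) (cong (ℚ._+ ι k ℚ.* ε) (ℚP.*-identityˡ ε))) ⟩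
            t ℚ.+ frac 1 M ℚ.+ (ε ℚ.+ ι k ℚ.* ε) ℚ.- ε
              ≡⟨ ℚsolve 3 (λ a e x → a :+q (e :+q x) :-q e :=q a :+q x) refl (t ℚ.+ frac 1 M) ε (ι k ℚ.* ε) ⟩
            t ℚ.+ frac 1 M ℚ.+ ι k ℚ.* ε ∎
          δ≤e : δ L i ℚ.≤ e
          δ≤e = ℚP.≤-trans (dens-mono (S L) (S L ⊞ VS ok qs) (stage i) (λ _ → ⊞VS-⊇ ok (S L) ok-0 qs)) H.upper
          dpath : Path i L D.l D.L′ t e
          dpath = record
            { i≤l = D.i≤l ; grow = D.grow
            ; above = λ {j} i≤j j≤l → above′ i≤j j≤l (m≤n⇒m<n∨m≡n j≤l)
            ; below = λ {j} i≤j j≤l → ℚP.≤-trans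
              (ℚP.≤-trans (dens-mono (S D.L′) (S D.L′ ⊞ V1 ok D.q) (stage j) (λ _ → ⊞V1-⊇ ok (S D.L′) D.q ok-0))
                (dens-Below (S L) (stage i) (S D.L′ ⊞ V1 ok D.q) (stage j) (stage-mono i≤j)
                  (λ g∈ → D.hull (stage-mono j≤l g∈)))) δ≤e }
            where
            above′ : ∀ {j} → i ≤ j → j ≤ D.l → j < D.l ⊎ j ≡ D.l → t ℚ.≤ δ D.L′ j
            -- Cosets are missing only in the last stage `D.l`; before it the density is not below
            -- the old one.
            above′ {j} i≤j _ (inj₁ j<l) = ℚP.≤-trans t≤
              (dens-Above (S L) (stage i) (S D.L′) (stage j) (stage-mono i≤j) (D.above j<l))
            above′ i≤j _ (inj₂ refl) = t≤′
          H′ : Hull D.l D.L′ (D.q ∷ qs) e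
          H′ = record
            { qs∈ = λ { (here refl) → D.q∈ , D.q∉ ; (there q∈) → i⊆l (proj₁ (H.qs∈ q∈)) , proj₂ (H.qs∈ q∈) }
            ; upper = ℚP.≤-trans (dens-mono (S D.L′ ⊞ VS ok (D.q ∷ qs)) (S D.L′ ⊞ V1 ok D.q ⊞ VS ok qs)
              (stage D.l) (λ _ → ⊞VS-∷⁻ ok (S D.L′) D.q qs)) (ℚP.≤-trans
                (dens-Below (S L ⊞ VS ok qs) (stage i) (S D.L′ ⊞ V1 ok D.q ⊞ VS ok qs) (stage D.l) i⊆l
                  (Below-⊞ {S L} {stage i} {S D.L′ ⊞ V1 ok D.q} {stage D.l} {VS ok qs}
                    (VS-inside ok (stage i) qs qs⊆) D.hull)) H.upper)
            ; lower = ℚP.≤-trans H.lower (ℚP.≤-trans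
                (dens-Above (S L ⊞ VS One qs) (stage i) (S D.L′ ⊞ V1 One D.q ⊞ VS One qs) (stage D.l) i⊆l
                  (Above-⊞ {S L} {stage i} {S D.L′ ⊞ V1 One D.q} {stage D.l} {VS One qs}
                    (VS-inside One (stage i) qs qs⊆) D.full))
                (dens-mono (S D.L′ ⊞ V1 One D.q ⊞ VS One qs) (S D.L′ ⊞ VS One (D.q ∷ qs)) (stage D.l)
                  (λ _ → ⊞VS-∷⁺ One (S D.L′) D.q qs))) }
          module R = Down (go k D.l D.L′ (D.q ∷ qs) (Grow.valid D.grow) t≤′ H′ bound′)

    -- Raising the density

    sumN-lower : ∀ n {f v} → (∀ {a} → a < n → v ≤ f a) → n * v ≤ sumN n f
    sumN-lower zero    h = z≤n
    sumN-lower (suc n) h = +-mono-≤ (h (n<1+n n)) (sumN-lower n (λ a<n → h (m<n⇒m<1+n a<n)))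

    sumN-shift : ∀ n f → sumN (suc n) f ≡ sumN n (f ∘ suc) + f 0
    sumN-shift zero    f = +-comm (f 0) 0
    sumN-shift (suc n) f = trans (cong (f (suc n) +_) (sumN-shift n f)) (sym (+-assoc (f (suc n)) _ (f 0)))

    -- The digit 0 of c receives S L, the digit n + 1 receives S L + q, and all
    -- others receive the union of the two.
    module FillStep (K : FinSub) (L : List C) (v : Valid K L) {q : C} (q∈ : q ∈ₛ K) (q∉ : q ∉ₛ K₀)
                    {c : C} {n : ℕ} (1≤n : 1 ≤ n) (ord : Order K c (suc (suc n))) where
      open Valid v
      open Order ord
      digits : DigitList K c n
      digits = digit-list K K₀⊆ c n λ 0<j j≤ → minimal 0<j (s≤s (m≤n⇒m≤1+n j≤))
      open DigitList digits using (list; near; acts)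

      new : List C
      new = c ⊕ q ∷ list

      L′ : List C
      L′ = new ++ L

      K′ : FinSub
      K′ = adjoin K c ord

      low : ∀ {x} j → j ≤ n → S L (x ⊝ j · c) → S L′ x
      low j j≤ s = Act-++⁺ new L (inj₁ (Equivalence.from (acts periodic) (j , j≤ , s)))

      high : ∀ {x} j → j ≤ n → S L (x ⊝ (c ⊕ q) ⊝ j · c) → S L′ x
      high j j≤ s = Act-++⁺ new L (inj₂ (Equivalence.from (acts periodic) (j , j≤ , s)))

      split : ∀ {x} → S L′ x → (∃ λ j → j ≤ n × S L (x ⊝ j · c)) ⊎ (∃ λ j → j ≤ n × S L (x ⊝ (c ⊕ q) ⊝ j · c))
      split p with Act-++⁻ new L p
      ... | inj₁ p′ = inj₁ (Equivalence.to (acts periodic) p′)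
      ... | inj₂ p′ = inj₂ (Equivalence.to (acts periodic) p′)

      digit : ∀ {a x} → a < suc (suc n) → x ∈ₛ K → S L′ (x ⊕ a · c) → (a ≤ n × S L x) ⊎ (0 < a × S L (x ⊝ q))
      digit {a} {x} a<N x∈ p = by-cases (split p)
        where
        by-cases : (∃ λ j → j ≤ n × S L (x ⊕ a · c ⊝ j · c)) ⊎
          (∃ λ j → j ≤ n × S L (x ⊕ a · c ⊝ (c ⊕ q) ⊝ j · c)) →
                   (a ≤ n × S L x) ⊎ (0 < a × S L (x ⊝ q))
        by-cases (inj₁ (j , j≤ , s)) = inj₁ (subst (_≤ n) (sym a≡j) j≤ , cancel-digit {S L} {c} {a} {j} a≡j s)
          where
          a≡j : a ≡ j
          a≡j = same-digit {K} {c} {suc (suc n)} ord a<N (s≤s (m≤n⇒m≤1+n j≤)) x∈ (S-inside s)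
        by-cases (inj₂ (j , j≤ , s)) = inj₂ (subst (0 <_) (sym a≡1+j) (s≤s z≤n) ,
          cancel-digit {S L} {c} {a} {suc j} a≡1+j s′)
          where
          s′ : S L (x ⊝ q ⊕ a · c ⊝ suc j · c)
          s′ = subst (S L) (solve 5 (λ x a c q j → x :+ a :- (c :+ q) :- j := x :- q :+ a :- (c :+ j)) refl x
            (a · c) c q (j · c)) s
          a≡1+j : a ≡ suc j
          a≡1+j = same-digit {K} {c} {suc (suc n)} ord a<N (s≤s (s≤s j≤)) (⊝∈ K x∈ q∈) (S-inside s′)

      new-near : ∀ {x} → x ∈ new → ∃ λ j → 0 < j × j < suc (suc n) × x ⊝ j · c ∈ₛ K
      new-near (here refl) = 1 , s≤s z≤n , s≤s (s≤s z≤n) , subst (_∈ₛ K)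
        (solve 2 (λ c q → q := c :+ q :- (c :+ :0)) refl c q) q∈
      new-near (there x∈) = let (j , 0<j , j≤ , p) = near x∈ in
        j , 0<j , s≤s (m≤n⇒m≤1+n (≤-trans j≤ (⌈n/2⌉≤n n))) , K₀⊆ p

      fresh : ∀ {y} → y ∈ list → c ⊕ q ≢ y
      fresh y∈ refl with near y∈
      -- The list may contain elements congruent to `c` modulo `K₀`. They differ from c ⊕ q because
      -- `q` lies outside `K₀`.
      ... | suc zero , _ , _ , p = q∉ (subst (_∈ₛ K₀) (solve 2 (λ c q → c :+ q :- (c :+ :0) := q) refl c q) p)
      ... | suc (suc j) , _ , j≤ , p = minimal (s≤s z≤n)
        (s≤s (≤-trans (n≤1+n (suc j)) (≤-trans j≤ (≤-trans (⌈n/2⌉≤n n) (n≤1+n n)))))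
        (∈-⊝ˡ K q∈ (subst (_∈ₛ K) (solve 3 (λ c q j → c :+ q :- (c :+ (c :+ j)) := q :- (c :+ j)) refl c q
          (j · c)) (K₀⊆ p)))

      grow : Grow K L K′ L′
      grow = grow-by new v (⊆-adjoin K c ord) (All.tabulate fresh ∷ DigitList.unique digits)
        (λ x∈ x∈K → let (j , 0<j , j< , p) = new-near x∈ in minimal 0<j j< (∈-⊝ˡ K x∈K p))
        (λ x∈ → let (j , _ , _ , p) = new-near x∈ in ∈-adjoin⁺ K c ord j p)
        λ {x} x∈ p → restr x∈ (digit (s≤s z≤n) x∈ (subst (S L′) (sym (G.identityʳ x)) (Act-++⁺ new L p)))
        where
        restr : ∀ {x} → x ∈ₛ K → (0 ≤ n × S L x) ⊎ (0 < 0 × S L (x ⊝ q)) → S L x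
        restr _ (inj₁ (_ , s)) = s

      above : Above (S L) K (S L′) K′
      above {g} g∈ with a , a<N , p ← ∈-adjoin⁻ K c ord g∈ with a ≤? n
      ... | yes a≤n = a · c , ⊝-sym K p , λ {x} x∈ s → low a a≤n (subst (S L) (sym (⊕-⊝ x (a · c))) s)
      -- The last coset is reached only through c ⊕ q, so its copy of `S L` is displaced by `q`; the
      -- freedom of the representative in `Above` absorbs this.
      ... | no a≰n with refl ← ≤-antisym (s≤s⁻¹ a<N) (≰⇒> a≰n) = suc n · c ⊕ q
          , subst (_∈ₛ K) (solve 3 (λ y q g → y :- g :+ q := y :+ q :- g) refl (suc n · c) q g)
            (FinSub.⊕∈ K (⊝-sym K p) q∈)
          , λ {x} x∈ s → high n ≤-refl (subst (S L)
              (solve 4 (λ x c q j → x := x :+ (c :+ j :+ q) :- (c :+ q) :- j) refl x c q (n · c)) s)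

      below : Below (S L ⊞ V1 One q) K (S L′) K′
      below {g} g∈ with a , a<N , p ← ∈-adjoin⁻ K c ord g∈ =
        a · c , ⊝-sym K p , λ {x} x∈ s → hull (digit a<N x∈ s)
        where
        hull : ∀ {a x} → (a ≤ n × S L x) ⊎ (0 < a × S L (x ⊝ q)) → (S L ⊞ V1 One q) x
        hull {x = x} (inj₁ (_ , s)) = ⊞V1-⊇ One (S L) q z≤n s
        hull {x = x} (inj₂ (_ , s)) = 1 · q , (1 , ≤-refl , refl) ,
          subst (S L) (cong (x ⊝_) (sym (G.identityʳ q))) s

      module _ {U : SetC} (U⊆ : ∀ {u} → U u → u ∈ₛ K) where
        private
          A B : ℕ
          A = # (S L ⊞ U) K
          B = # (S L ⊞ V1 One q ⊞ U) K
          f : ℕ → ℕ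
          f a = # (λ x → (S L′ ⊞ U) (a · c ⊕ x)) K

          first : A ≤ f 0
          first = count-mono (FinSub.elements K) λ {x} _ (u , u∈ , s) →
            u , u∈ , low 0 z≤n (subst (S L) (solve 2 (λ x u → x :- u := :0 :+ x :- u :- :0) refl x u) s)

          last : A ≤ f (suc n)
          last = ≤-trans (≤-reflexive (sym (#-translate {S L ⊞ U} K (FinSub.⊖∈ K q∈))))
            (count-mono (FinSub.elements K) λ {x} _ (u , u∈ , s) → u , u∈ , high n ≤-refl (subst (S L)
              (solve 5 (λ x q u c j → x :- q :- u := c :+ j :+ x :- u :- (c :+ q) :- j) refl x q u c (n · c)) s))

          middle : ∀ {a} → a < n → B ≤ f (suc a)
          middle {a} a<n = count-mono (FinSub.elements K) λ { {x} _ (u , u∈ , _ , (0 , _ , refl) , s) →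
              u , u∈ , low (suc a) a<n (subst (S L)
                (solve 4 (λ x u c a → x :- u :- :0 := c :+ a :+ x :- u :- (c :+ a)) refl x u c (a · c)) s)
            ; {x} _ (u , u∈ , _ , (1 , _ , refl) , s) →
              u , u∈ , high a (<⇒≤ a<n) (subst (S L)
                (solve 5 (λ x u q c a → x :- u :- (q :+ :0) := c :+ a :+ x :- u :- (c :+ q) :- a) refl x u q c
                  (a · c)) s)
            ; _ (_ , _ , _ , (suc (suc _) , s≤s () , _) , _) }

          total : A + (n * B + A) ≤ # (S L′ ⊞ U) K′
          total = ≤-trans (+-mono-≤ last (≤-trans (+-mono-≤ (sumN-lower n middle) first)
            (≤-reflexive (sym (sumN-shift n f))))) (≤-reflexive (sym (#-adjoin K c ord {S L′ ⊞ U})))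

        gain : ι 2 ℚ.* dens (S L ⊞ U) K ℚ.+ ι n ℚ.* dens (S L ⊞ V1 One q ⊞ U) K
               ℚ.≤ ι (2 + n) ℚ.* dens (S L′ ⊞ U) K′
        gain = ι-cancel-≤ (card-positive K) (begin
          k ℚ.* (ι 2 ℚ.* dA ℚ.+ ι n ℚ.* dB)
            ≡⟨ cong (λ z → k ℚ.* (z ℚ.* dA ℚ.+ ι n ℚ.* dB)) (ι-+ 1 1) ⟩
          k ℚ.* ((ι 1 ℚ.+ ι 1) ℚ.* dA ℚ.+ ι n ℚ.* dB)
            ≡⟨ cong (λ z → k ℚ.* ((z ℚ.+ z) ℚ.* dA ℚ.+ ι n ℚ.* dB)) ι-1 ⟩
          k ℚ.* ((1ℚ ℚ.+ 1ℚ) ℚ.* dA ℚ.+ ι n ℚ.* dB)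
            ≡⟨ ℚsolve 4 (λ k a n b → k :*q ((conq 1ℚ :+q conq 1ℚ) :*q a :+q n :*q b) :=q k :*q a :+q
              (n :*q (k :*q b) :+q k :*q a)) refl k dA (ι n) dB ⟩
          k ℚ.* dA ℚ.+ (ι n ℚ.* (k ℚ.* dB) ℚ.+ k ℚ.* dA)
            ≡⟨ cong₂ (λ y z → y ℚ.+ (ι n ℚ.* z ℚ.+ y)) (ι-frac A (card-positive K)) (ι-frac B (card-positive K)) ⟩
          ι A ℚ.+ (ι n ℚ.* ι B ℚ.+ ι A)
            ≡⟨ cong (λ z → ι A ℚ.+ (z ℚ.+ ι A)) (ι-* n B) ⟨
          ι A ℚ.+ (ι (n * B) ℚ.+ ι A)
            ≡⟨ cong (ι A ℚ.+_) (ι-+ (n * B) A) ⟨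
          ι A ℚ.+ ι (n * B + A)
            ≡⟨ ι-+ A (n * B + A) ⟨
          ι (A + (n * B + A))
            ≤⟨ ι-mono-≤ total ⟩
          ι (# (S L′ ⊞ U) K′)
            ≡⟨ ι-frac _ (card-positive K′) ⟨
          ι (card K′) ℚ.* d′
            ≡⟨ cong (λ z → ι z ℚ.* d′) (card-adjoin K c ord) ⟩
          ι ((2 + n) * card K) ℚ.* d′
            ≡⟨ cong (ℚ._* d′) (ι-* (2 + n) (card K)) ⟩
          ι (2 + n) ℚ.* k ℚ.* d′
            ≡⟨ ℚsolve 3 (λ n k d → n :*q k :*q d :=q k :*q (n :*q d)) refl (ι (2 + n)) k d′ ⟩
          k ℚ.* (ι (2 + n) ℚ.* d′) ∎)
          where
          open ℚP.≤-Reasoning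
          k dA dB d′ : ℚ
          k = ι (card K)
          dA = dens (S L ⊞ U) K
          dB = dens (S L ⊞ V1 One q ⊞ U) K
          d′ = dens (S L′ ⊞ U) K′

    record FillChain (ok : ℕ → Set) (b : ℚ) (K : FinSub) (L : List C) (q : C) : Set₁ where
      field
        K′    : FinSub
        L′    : List C
        j     : ℕ
        K′⊆   : K′ ⊆ₛ stage j
        grow  : Grow K L K′ L′
        above : Above (S L) K (S L′) K′
        below : Below (S L ⊞ V1 ok q) K (S L′) K′
        gain  : ∀ {U} → (∀ {u} → U u → u ∈ₛ K) →
                dens (S L ⊞ V1 One q ⊞ U) K ℚ.≤ dens (S L′ ⊞ U) K′ ℚ.+ b

    fill-start : ∀ {ok} → ok 0 → ∀ i L q → Valid (stage i) L → FillChain ok 1ℚ (stage i) L q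
    fill-start {ok} ok0 i L q v = record
      { K′ = stage i ; L′ = L ; j = i ; K′⊆ = id ; grow = grow-refl v
      ; above = Copies⇒Above {K} {S L} {K} {S L} {K} copies
      ; below = Below-mono {S L} {S L ⊞ V1 ok q} {K} {S L} {S L} {K} (⊞V1-⊇ ok (S L) q ok0) id
                  (Copies⇒Below {K} {S L} {K} {S L} {K} copies)
      ; gain = λ {U} _ → ℚP.≤-trans (dens≤1 (S L ⊞ V1 One q ⊞ U) K)
          (≤-by (dens (S L ⊞ U) K) (0≤dens (S L ⊞ U) K) (ℚP.+-comm (dens (S L ⊞ U) K) 1ℚ)) }
      where K = stage i
            copies = Copies-refl {K} {S L} {K}

    -- Of the n + 2 cosets two keep the old error `b`, while the other n carry the union with the
    -- translate by `q` and have no error, so the average error is 2b/(n + 2). The second hypothesis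
    -- says that adding `q` once more stays within the permitted hull: `One` allows this for a first
    -- step, `Any-multiple` for every step.
    fill-extend : ∀ {ok b b′ K L q} (ch : FillChain ok b K L q) → let module F = FillChain ch in
                  Below (S L ⊞ V1 ok q) K (S F.L′ ⊞ V1 One q) F.K′ →
                  q ∈ₛ K → q ∉ₛ K₀ → ∀ {c n} → 1 ≤ n → Order F.K′ c (suc (suc n)) →
                  ι 2 ℚ.* b ℚ.≤ ι (2 + n) ℚ.* b′ → FillChain ok b′ K L q
    fill-extend {ok} {b} {b′} {K} {L} {q} ch hull q∈ q∉ {c} {n} 1≤n ord b≤b′ = record
      { K′ = T.K′ ; L′ = T.L′ ; j = j ⊔ jc ; grow = grow-trans F.grow T.grow
      ; K′⊆ = adjoin-⊆ F.K′ c ord {stage (j ⊔ jc)} (stage-mono (m≤m⊔n j jc) ∘ F.K′⊆)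
        (stage-mono (m≤n⊔m j jc) (proj₂ (E-cover c)))
      ; above = Above-trans {S L} {K} {S F.L′} {F.K′} {S T.L′} {T.K′} K⊆ F.above T.above
      ; below = Below-trans {S L ⊞ V1 ok q} {K} {S F.L′ ⊞ V1 One q} {F.K′} {S T.L′} {T.K′} K⊆ hull T.below
      ; gain = gain }
      where
      module F = FillChain ch
      open F using (j)
      jc = proj₁ (E-cover c)
      K⊆ : K ⊆ₛ F.K′
      K⊆ = Grow.K⊆ F.grow
      module T = FillStep F.K′ F.L′ (Grow.valid F.grow) (K⊆ q∈) q∉ 1≤n ord
      gain : ∀ {U} → (∀ {u} → U u → u ∈ₛ K) → dens (S L ⊞ V1 One q ⊞ U) K ℚ.≤ dens (S T.L′ ⊞ U) T.K′ ℚ.+ b′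
      gain {U} U⊆ = ι-cancel-≤ {2 + n} (s≤s z≤n) (begin
        ι (2 + n) ℚ.* e ≡⟨ cong (ℚ._* e) (ι-+ 2 n) ⟩
        (ι 2 ℚ.+ ι n) ℚ.* e ≡⟨ ℚP.*-distribʳ-+ e (ι 2) (ι n) ⟩
        ι 2 ℚ.* e ℚ.+ ι n ℚ.* e ≤⟨ ℚP.+-mono-≤ (ι*-mono 2 (F.gain U⊆)) (ι*-mono n e≤) ⟩
        ι 2 ℚ.* (d ℚ.+ b) ℚ.+ ι n ℚ.* e′
          ≡⟨ ℚsolve 5 (λ t d b n e → t :*q (d :+q b) :+q n :*q e :=q t :*q d :+q n :*q e :+q t :*q b) refl
            (ι 2) d b (ι n) e′ ⟩
        ι 2 ℚ.* d ℚ.+ ι n ℚ.* e′ ℚ.+ ι 2 ℚ.* b ≤⟨ ℚP.+-mono-≤ (T.gain (K⊆ ∘ U⊆)) b≤b′ ⟩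
        ι (2 + n) ℚ.* d′ ℚ.+ ι (2 + n) ℚ.* b′ ≡⟨ ℚP.*-distribˡ-+ (ι (2 + n)) d′ b′ ⟨
        ι (2 + n) ℚ.* (d′ ℚ.+ b′) ∎)
        where
        open ℚP.≤-Reasoning
        e e′ d d′ : ℚ
        e = dens (S L ⊞ V1 One q ⊞ U) K
        e′ = dens (S F.L′ ⊞ V1 One q ⊞ U) F.K′
        d = dens (S F.L′ ⊞ U) F.K′
        d′ = dens (S T.L′ ⊞ U) T.K′
        e≤ : e ℚ.≤ e′
        e≤ = dens-Above (S L ⊞ V1 One q ⊞ U) K (S F.L′ ⊞ V1 One q ⊞ U) F.K′ K⊆
          (Above-⊞ {S L ⊞ V1 One q} {K} {S F.L′ ⊞ V1 One q} {F.K′} {U} U⊆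
            (Above-⊞ {S L} {K} {S F.L′} {F.K′} {V1 One q} (V1-inside One K q∈) F.above))

    record Settled (K : FinSub) (L : List C) (j : ℕ) (M : FinSub) : Set where
      field
        L′     : List C
        grow   : Grow K L (stage j) L′
        copies : Copies M (S L) K (S L′) (stage j)

    settle : ∀ {K L j} → Valid K L → K ⊆ₛ stage j → Settled K L j (stage j)
    settle {K} {L} {j} v K⊆ = record
      { L′ = R.L′ ; grow = grow-enlarge R.grow (R.within {stage j} K⊆ id) ; copies = λ g∈ → R.copies (R.B⊆ g∈) }
      where module R = KeepChain (keep-chain (stage j) (E j) K L id v)

    finish-fill : ∀ {ok M i L q} → q ∈ₛ stage i → FillChain ok (frac 1 M) (stage i) L q → Fill ok M i L q
    finish-fill {ok} {M} {i} {L} {q} q∈ ch = record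
      { l = l ; L′ = R.L′ ; i≤l = m≤n⊔m F.j i ; grow = grow-trans F.grow R.grow
      ; above = Above-trans {S L} {stage i} {S F.L′} {F.K′} {S R.L′} {stage l} K⊆ F.above copies-above
      ; below = Below-trans {S L ⊞ V1 ok q} {stage i} {S F.L′} {F.K′} {S R.L′} {stage l} K⊆ F.below
                  (Copies⇒Below {stage l} {S F.L′} {F.K′} {S R.L′} {stage l} R.copies)
      ; gain = λ {U} U⊆ → ℚP.≤-trans (F.gain U⊆) (ℚP.+-monoˡ-≤ (frac 1 M)
          (dens-Above (S F.L′ ⊞ U) F.K′ (S R.L′ ⊞ U) (stage l) (Grow.K⊆ R.grow)
            (Above-⊞ {S F.L′} {F.K′} {S R.L′} {stage l} {U} (K⊆ ∘ U⊆) copies-above))) }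
      where
      module F = FillChain ch
      l = F.j ⊔ i
      K⊆ : stage i ⊆ₛ F.K′
      K⊆ = Grow.K⊆ F.grow
      module R = Settled (settle {F.K′} {F.L′} {l} (Grow.valid F.grow) (stage-mono (m≤m⊔n F.j i) ∘ F.K′⊆))
      copies-above : Above (S F.L′) F.K′ (S R.L′) (stage l)
      copies-above = Copies⇒Above {stage l} {S F.L′} {F.K′} {S R.L′} {stage l} R.copies

    -- Filling when orders are unbounded, and when only order at least three is known

    Unbounded : Set
    Unbounded = ∀ i M → ∃ λ c → ∀ {k} → 0 < k → k ≤ M → k · c ∉ E i

    order-large : ∀ {K c N M} → Order K c N → (∀ {k} → 0 < k → k ≤ M → k · c ∉ₛ K) → M < N
    order-large ord free = ≰⇒> λ N≤M → free (Order.positive ord) N≤M (Order.multiple ord)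

    -- One step is enough: the trivial error 1 becomes 2/N for an element of order N > 2M.
    fill-unbounded : Unbounded → ∀ M → 0 < M → ∀ i L q → Valid (stage i) L → q ∈ₛ stage i → q ∉ₛ K₀ →
      Fill One M i L q
    fill-unbounded unb M 0<M i L q v q∈ q∉ =
      let (c , free) = unb i (2 + 2 * M)
          (N , ord)  = order-exists (stage i) (stage (proj₁ (E-cover c))) (proj₂ (E-cover c))
          large      = order-large {stage i} {c} {N} {2 + 2 * M} ord free
          N≡         = m+[n∸m]≡n {2} (≤-trans (s≤s (s≤s z≤n)) large)
      in fill-with c (N ∸ 2) (subst (Order (stage i) c) (sym N≡) ord)
        (s≤s⁻¹ (s≤s⁻¹ (subst (2 + 2 * M <_) (sym N≡) large)))
      where
      fill-with : ∀ c n → Order (stage i) c (2 + n) → 2 * M < n → Fill One M i L q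
      fill-with c n ord large = finish-fill q∈ (fill-extend (fill-start z≤n i L q v)
          (Copies⇒Below {stage i} {S L ⊞ V1 One q} {stage i} {S L ⊞ V1 One q} {stage i}
            (Copies-refl {stage i} {S L ⊞ V1 One q} {stage i}))
          q∈ q∉ (≤-trans (s≤s z≤n) large) ord bound)
        where
        open ℚP.≤-Reasoning
        bound : ι 2 ℚ.* 1ℚ ℚ.≤ ι (2 + n) ℚ.* frac 1 M
        bound = begin
          ι 2 ℚ.* 1ℚ               ≡⟨ cong (ι 2 ℚ.*_) (trans (ι-frac 1 0<M) ι-1) ⟨
          ι 2 ℚ.* (ι M ℚ.* frac 1 M) ≡⟨ ℚP.*-assoc (ι 2) (ι M) (frac 1 M) ⟨
          ι 2 ℚ.* ι M ℚ.* frac 1 M   ≡⟨ cong (ℚ._* frac 1 M) (ι-* 2 M) ⟨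
          ι (2 * M) ℚ.* frac 1 M
            ≤⟨ ℚP.*-monoʳ-≤-nonNeg (frac 1 M) {{ℚ.nonNegative (0≤frac 1 M)}}
                 (ι-mono-≤ {2 * M} {2 + n} (≤-trans (<⇒≤ large) (m≤n+m n 2))) ⟩
          ι (2 + n) ℚ.* frac 1 M     ∎

    Any-multiple : ℕ → Set
    Any-multiple _ = ⊤

    -- An element whose double is outside `stage j` has order neither 1 nor 2 modulo `K`. Order 2
    -- would leave no coset between the first and the last, and `fill-extend` would gain nothing.
    order-≥3 : ∀ K j → K ⊆ₛ stage j → ∃ λ c → ∃ λ n → 1 ≤ n × Order K c (suc (suc n))
    order-≥3 K j K⊆ =
      let (c , 2c∉) = unbounded-doubles j
          (N , ord) = order-exists K (stage (proj₁ (E-cover c))) (proj₂ (E-cover c))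
      in go c 2c∉ N ord
      where
      go : ∀ c → c ⊕ c ∉ E j → ∀ N → Order K c N → ∃ λ c → ∃ λ n → 1 ≤ n × Order K c (suc (suc n))
      go c 2c∉ 0 ord = contradiction (Order.positive ord) λ ()
      go c 2c∉ 1 ord = contradiction (E-⊕ j c∈ c∈) 2c∉
        where c∈ = K⊆ (subst (_∈ₛ K) (G.identityʳ c) (Order.multiple ord))
      go c 2c∉ 2 ord = contradiction (K⊆ (subst (_∈ₛ K) (cong (c ⊕_) (G.identityʳ c)) (Order.multiple ord))) 2c∉
      go c 2c∉ (suc (suc (suc n))) ord = c , suc n , s≤s z≤n , ord

    -- With orders at least 3 a step multiplies the error by at most 2/3. The weaker bound 2/(2 + k)
    -- after k steps avoids powers and is at most 1/M for k = 2M. Each step may add `q` again, which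
    -- is why all multiples must be permitted.
    fill-any : ∀ M → 0 < M → ∀ i L q → Valid (stage i) L → q ∈ₛ stage i → q ∉ₛ K₀ → Fill Any-multiple M i L q
    fill-any M 0<M i L q v q∈ q∉ = finish-fill q∈ (weaken (chain (M + M)))
      where
      K = stage i
      Chain : ℚ → Set₁
      Chain b = FillChain Any-multiple b K L q
      weaken : Chain (frac 2 (2 + (M + M))) → Chain (frac 1 M)
      weaken ch = record { FillChain ch hiding (gain) ; gain = λ {U} U⊆ → ℚP.≤-trans (FillChain.gain ch U⊆)
        (ℚP.+-monoʳ-≤ (dens (S (FillChain.L′ ch) ⊞ U) (FillChain.K′ ch))
          (frac-mono (s≤s z≤n) 0<M (subst (_≤ 1 * (2 + (M + M))) (cong (M +_) (sym (+-identityʳ M)))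
            (≤-trans (m≤n+m (M + M) 2) (≤-reflexive (sym (*-identityˡ (2 + (M + M)))))))))  }
      absorb : ∀ {x} → (S L ⊞ V1 Any-multiple q ⊞ V1 One q) x → (S L ⊞ V1 Any-multiple q) x
      absorb {x} (_ , (j , _ , refl) , _ , (k , _ , refl) , s) = (j + k) · q , (j + k , tt , refl) ,
        subst (S L) (trans (solve 3 (λ x j k → x :- j :- k := x :- (j :+ k)) refl x (j · q) (k · q))
          (cong (x ⊝_) (sym (·-+ q j k)))) s
      chain : ∀ k → Chain (frac 2 (2 + k))
      chain zero    = subst Chain (ι-cancel-≡ {2} (s≤s z≤n)
        (trans (ℚP.*-identityʳ (ι 2)) (sym (ι-frac 2 (s≤s z≤n)))))
                        (fill-start tt i L q v)
      chain (suc k) = let ch = chain k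
                          module F = FillChain ch
                          (c , n , 1≤n , ord) = order-≥3 F.K′ F.j F.K′⊆ in
        fill-extend ch
          (Below-mono {S L ⊞ V1 Any-multiple q ⊞ V1 One q} {S L ⊞ V1 Any-multiple q} {K} {S F.L′ ⊞ V1 One q}
            {S F.L′ ⊞ V1 One q} {F.K′} absorb id
            (Below-⊞ {S L ⊞ V1 Any-multiple q} {K} {S F.L′} {F.K′} {V1 One q} (V1-inside One K q∈) F.below))
          q∈ q∉ 1≤n ord (shrink k 1≤n)
        where
        shrink : ∀ k {n} → 1 ≤ n → ι 2 ℚ.* frac 2 (2 + k) ℚ.≤ ι (2 + n) ℚ.* frac 2 (3 + k)
        shrink k {n} 1≤n = ι-cancel-≤ {2 + k} (s≤s z≤n) (ι-cancel-≤ {3 + k} (s≤s z≤n) (begin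
          ι (3 + k) ℚ.* (ι (2 + k) ℚ.* (ι 2 ℚ.* frac 2 (2 + k)))
            ≡⟨ ℚsolve 4 (λ a b c f → a :*q (b :*q (c :*q f)) :=q a :*q (c :*q (b :*q f))) refl (ι (3 + k))
              (ι (2 + k)) (ι 2) (frac 2 (2 + k)) ⟩
          ι (3 + k) ℚ.* (ι 2 ℚ.* (ι (2 + k) ℚ.* frac 2 (2 + k)))
            ≡⟨ cong (λ z → ι (3 + k) ℚ.* (ι 2 ℚ.* z)) (ι-frac 2 (s≤s z≤n)) ⟩
          ι (3 + k) ℚ.* (ι 2 ℚ.* ι 2) ≡⟨ cong (ι (3 + k) ℚ.*_) (ι-* 2 2) ⟨
          ι (3 + k) ℚ.* ι 4 ≡⟨ ι-* (3 + k) 4 ⟨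
          ι ((3 + k) * 4) ≤⟨ ι-mono-≤ arith ⟩
          ι ((2 + k) * ((2 + n) * 2)) ≡⟨ trans (ι-* (2 + k) ((2 + n) * 2)) (cong (ι (2 + k) ℚ.*_) (ι-* (2 + n) 2))
            ⟩
          ι (2 + k) ℚ.* (ι (2 + n) ℚ.* ι 2) ≡⟨ cong (λ z → ι (2 + k) ℚ.* (ι (2 + n) ℚ.* z))
            (ι-frac 2 {3 + k} (s≤s z≤n)) ⟨
          ι (2 + k) ℚ.* (ι (2 + n) ℚ.* (ι (3 + k) ℚ.* frac 2 (3 + k)))
            ≡⟨ ℚsolve 4 (λ a b c f → b :*q (c :*q (a :*q f)) :=q a :*q (b :*q (c :*q f))) refl (ι (3 + k))
              (ι (2 + k)) (ι (2 + n)) (frac 2 (3 + k)) ⟩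
          ι (3 + k) ℚ.* (ι (2 + k) ℚ.* (ι (2 + n) ℚ.* frac 2 (3 + k))) ∎))
          where
          open ℚP.≤-Reasoning
          arith : (3 + k) * 4 ≤ (2 + k) * ((2 + n) * 2)
          arith = ≤-trans (≤-trans (m≤m+n ((3 + k) * 4) (k * 2))
            (≤-reflexive (ℕsolve 1 (λ k → (con 3 :+n k) :*n con 4 :+n k :*n con 2 :=n (con 2 :+n k) :*n con 6)
              refl k)))
            (*-monoʳ-≤ (2 + k) (*-monoˡ-≤ 2 (+-monoʳ-≤ 2 1≤n)))
            where open ℕSolver.+-*-Solver using (con) renaming (solve to ℕsolve; _:+_ to _:+n_; _:*_ to _:*n_; _:=_ to _:=n_)

    -- A drop in a subgroup `K₁` that need not be a stage. `visible` is the essential condition: the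
    -- cosets of `K₁` that meet `stage l′` all carry a copy of `S L`. An empty coset in a smaller
    -- stage could take up a much larger share there than in `K₁`.
    record PreDrop (ok : ℕ → Set) (M M′ i : ℕ) (L : List C) : Set where
      field
        l′      : ℕ
        K₁      : FinSub
        L₁      : List C
        q       : C
        i≤l′    : i ≤ l′
        K₁⊆     : K₁ ⊆ₛ stage (suc l′)
        grow    : Grow (stage i) L K₁ L₁
        q∈      : q ∈ₛ K₁
        q∉      : q ∉ₛ K₀
        visible : ∀ {g} → g ∈ₛ K₁ → g ∈ₛ stage l′ →
                  ∃ λ t → t ⊝ g ∈ₛ stage i × (∀ {x} → x ∈ₛ stage i → S L x → S L₁ (x ⊕ t))
        hull    : Below (S L) (stage i) (S L₁ ⊞ V1 ok q) K₁
        full    : Above (S L) (stage i) (S L₁ ⊞ V1 One q) K₁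
        small   : ι M ℚ.* δ L i ℚ.≤ ι M ℚ.* dens (S L₁) K₁ ℚ.+ 1ℚ
        large   : ι M′ ℚ.* dens (S L₁) K₁ ℚ.+ δ L i ℚ.≤ ι M′ ℚ.* δ L i

    -- The elements of stage l′ are added first, so that all missing cosets lie outside it.
    finish-drop : ∀ {ok M M′ i L} → PreDrop ok M M′ i L → Drop ok M M′ i L
    finish-drop {ok} {M} {M′} {i} {L} pre = record
      { l = suc l′ ; L′ = R₂.L′ ; q = q ; i≤l = m≤n⇒m≤1+n i≤l′
      ; grow = grow-trans P.grow (grow-trans R₁.grow R₂.grow)
      ; q∈ = K₁⊆ q∈ ; q∉ = q∉ ; above = λ j<l g∈ → above (stage-mono (s≤s⁻¹ j<l) g∈)
      ; hull = Below-trans {S L} {stage i} {S L₁ ⊞ V1 ok q} {K₁} {S R₂.L′ ⊞ V1 ok q} {stage (suc l′)}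
        (Grow.K⊆ P.grow) P.hull
          (Below-⊞ {S L₁} {K₁} {S R₂.L′} {stage (suc l′)} {V1 ok q} (V1-inside ok K₁ q∈) below₁)
      ; full = Above-trans {S L} {stage i} {S L₁ ⊞ V1 One q} {K₁} {S R₂.L′ ⊞ V1 One q} {stage (suc l′)}
        (Grow.K⊆ P.grow) P.full
          (Above-⊞ {S L₁} {K₁} {S R₂.L′} {stage (suc l′)} {V1 One q} (V1-inside One K₁ q∈) above₁)
      ; small = subst (λ d → ι M ℚ.* δ L i ℚ.≤ ι M ℚ.* d ℚ.+ 1ℚ) same-density P.small
      ; large = subst (λ d → ι M′ ℚ.* d ℚ.+ δ L i ℚ.≤ ι M′ ℚ.* δ L i) same-density P.large }
      where
      module P = PreDrop pre
      open P using (l′; K₁; L₁; q; i≤l′; K₁⊆; q∈; q∉)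
      module R₁ = KeepChain (keep-chain (stage l′) (E l′) K₁ L₁ id (Grow.valid P.grow))
      module R₂ = Settled (settle {R₁.K′} {R₁.L′} {suc l′} (Grow.valid R₁.grow)
        (R₁.within {stage (suc l′)} K₁⊆ (stage-mono (n≤1+n l′))))
      copies : Copies (stage (suc l′)) (S L₁) K₁ (S R₂.L′) (stage (suc l′))
      copies = Copies-trans {stage (suc l′)} {S L₁} {K₁} {S R₁.L′} {R₁.K′} {S R₂.L′} {stage (suc l′)}
        (Grow.K⊆ R₁.grow)
        (λ g∈ → let (t , t∈ , p) = R₁.copies g∈ in t , E-suc l′ t∈ , p) R₂.copies
      above₁ : Above (S L₁) K₁ (S R₂.L′) (stage (suc l′))
      above₁ = Copies⇒Above {stage (suc l′)} {S L₁} {K₁} {S R₂.L′} {stage (suc l′)} copies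
      below₁ : Below (S L₁) K₁ (S R₂.L′) (stage (suc l′))
      below₁ = Copies⇒Below {stage (suc l′)} {S L₁} {K₁} {S R₂.L′} {stage (suc l′)} copies
      same-density : dens (S L₁) K₁ ≡ δ R₂.L′ (suc l′)
      same-density = ℚP.≤-antisym (dens-Above (S L₁) K₁ (S R₂.L′) (stage (suc l′)) K₁⊆ above₁)
                                  (dens-Below (S L₁) K₁ (S R₂.L′) (stage (suc l′)) K₁⊆ below₁)
      above : Above (S L) (stage i) (S R₂.L′) (stage l′)
      above {g} g∈ with t , t∈ , tg∈ , p ← R₁.copies (R₁.B⊆ g∈)
        with u , ug∈ , r ← P.visible (⊝-sym K₁ tg∈) (⊝∈ (stage l′) g∈ t∈) =
        u ⊕ t , subst (_∈ₛ stage i) (solve 3 (λ u g t → u :- (g :- t) := u :+ t :- g) refl u g t) ug∈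
        , λ {x} x∈ s → Grow.S⊆S R₂.grow (subst (S R₁.L′) (G.assoc x u t)
            (Equivalence.to (p (FinSub.⊕∈ K₁ (K⊆ x∈) (∈-⊝ʳ K₁ (⊝-sym K₁ tg∈) (K⊆ ug∈)))) (r x∈ s)))
        where K⊆ : stage i ⊆ₛ K₁
              K⊆ = Grow.K⊆ P.grow

    -- Lowering the density

    sumN-head : ∀ m p {f v} → (∀ {a} → a < p → f a ≡ v) → (∀ {a} → p ≤ a → a < m + p → f a ≡ 0) →
      sumN (m + p) f ≡ p * v
    sumN-head zero    zero    low high = refl
    sumN-head zero    (suc p) low high = cong₂ _+_ (low (n<1+n p)) (sumN-head zero p (λ a<p → low (m<n⇒m<1+n a<p))
      λ p≤a a<p → contradiction a<p (≤⇒≯ p≤a))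
    sumN-head (suc m) p       low high = cong₂ _+_ (high (m≤n+m p m) (n<1+n (m + p)))
      (sumN-head m p low (λ p≤a a< → high p≤a (m<n⇒m<1+n a<)))

    -- `lost` expresses that m of N cosets are empty, so that d - d′ = (m/N) d. Bounds on m/N from
    -- above and below become the two bounds required of a drop.
    module DropAmount {d d′ : ℚ} (0≤d : 0ℚ ℚ.≤ d) (d≤1 : d ℚ.≤ 1ℚ) {m N : ℕ} (0<N : 0 < N)
                      (lost : ι N ℚ.* d′ ℚ.+ ι m ℚ.* d ≡ ι N ℚ.* d) where
      open ℚP.≤-Reasoning

      drop-small : ∀ {M} → M * m ≤ N → ι M ℚ.* d ℚ.≤ ι M ℚ.* d′ ℚ.+ 1ℚ
      drop-small {M} Mm≤N = ι-cancel-≤ 0<N (begin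
        ι N ℚ.* (ι M ℚ.* d) ≡⟨ ℚsolve 3 (λ n m d → n :*q (m :*q d) :=q m :*q (n :*q d)) refl (ι N) (ι M) d ⟩
        ι M ℚ.* (ι N ℚ.* d) ≡⟨ cong (ι M ℚ.*_) lost ⟨
        ι M ℚ.* (ι N ℚ.* d′ ℚ.+ ι m ℚ.* d)
          ≡⟨ ℚsolve 5 (λ n M d′ m d → M :*q (n :*q d′ :+q m :*q d) :=q n :*q (M :*q d′) :+q (M :*q m) :*q d) refl
            (ι N) (ι M) d′ (ι m) d ⟩
        ι N ℚ.* (ι M ℚ.* d′) ℚ.+ (ι M ℚ.* ι m) ℚ.* d
          ≡⟨ cong (λ z → ι N ℚ.* (ι M ℚ.* d′) ℚ.+ z ℚ.* d) (ι-* M m) ⟨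
        ι N ℚ.* (ι M ℚ.* d′) ℚ.+ ι (M * m) ℚ.* d
          ≤⟨ ℚP.+-monoʳ-≤ (ι N ℚ.* (ι M ℚ.* d′)) (ℚP.≤-trans (ι*-mono (M * m) d≤1)
               (ℚP.*-monoʳ-≤-nonNeg 1ℚ (ι-mono-≤ Mm≤N))) ⟩
        ι N ℚ.* (ι M ℚ.* d′) ℚ.+ ι N ℚ.* 1ℚ ≡⟨ ℚP.*-distribˡ-+ (ι N) (ι M ℚ.* d′) 1ℚ ⟨
        ι N ℚ.* (ι M ℚ.* d′ ℚ.+ 1ℚ) ∎)

      drop-large : ∀ {M′} → N ≤ M′ * m → ι M′ ℚ.* d′ ℚ.+ d ℚ.≤ ι M′ ℚ.* d
      drop-large {M′} N≤ = ι-cancel-≤ 0<N (begin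
        ι N ℚ.* (ι M′ ℚ.* d′ ℚ.+ d) ≡⟨ ℚP.*-distribˡ-+ (ι N) (ι M′ ℚ.* d′) d ⟩
        ι N ℚ.* (ι M′ ℚ.* d′) ℚ.+ ι N ℚ.* d
          ≤⟨ ℚP.+-monoʳ-≤ (ι N ℚ.* (ι M′ ℚ.* d′)) (ℚP.*-monoʳ-≤-nonNeg d {{ℚ.nonNegative 0≤d}} (ι-mono-≤ N≤)) ⟩
        ι N ℚ.* (ι M′ ℚ.* d′) ℚ.+ ι (M′ * m) ℚ.* d ≡⟨ cong (λ z → ι N ℚ.* (ι M′ ℚ.* d′) ℚ.+ z ℚ.* d) (ι-* M′ m) ⟩
        ι N ℚ.* (ι M′ ℚ.* d′) ℚ.+ (ι M′ ℚ.* ι m) ℚ.* d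
          ≡⟨ ℚsolve 5 (λ n M d′ m d → M :*q (n :*q d′ :+q m :*q d) :=q n :*q (M :*q d′) :+q (M :*q m) :*q d) refl
            (ι N) (ι M′) d′ (ι m) d ⟨
        ι M′ ℚ.* (ι N ℚ.* d′ ℚ.+ ι m ℚ.* d) ≡⟨ cong (ι M′ ℚ.*_) lost ⟩
        ι M′ ℚ.* (ι N ℚ.* d) ≡⟨ ℚsolve 3 (λ n m d → n :*q (m :*q d) :=q m :*q (n :*q d)) refl (ι N) (ι M′) d ⟨
        ι N ℚ.* (ι M′ ℚ.* d) ∎)

    -- The digits 0, …, P of a generator of order m + (1 + P); the last m cosets are missing.
    module DropStep (K : FinSub) (L : List C) (v : Valid K L) {c : C} (m P : ℕ)
                    (ord : Order K c (m + suc P)) (0<m : 0 < m) where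
      open Valid v
      open Order ord
      N : ℕ
      N = m + suc P

      P<N : P < N
      P<N = m≤n+m (suc P) m

      digits : DigitList K c P
      digits = digit-list K K₀⊆ c P λ 0<j j≤ → minimal 0<j (≤-<-trans j≤ P<N)
      open DigitList digits using (list; near; acts)

      L′ : List C
      L′ = list ++ L

      K′ : FinSub
      K′ = adjoin K c ord

      mem⁺ : ∀ {x} j → j ≤ P → S L (x ⊝ j · c) → S L′ x
      mem⁺ j j≤ s = Act-++⁺ list L (Equivalence.from (acts periodic) (j , j≤ , s))

      mem⁻ : ∀ {x} → S L′ x → ∃ λ j → j ≤ P × S L (x ⊝ j · c)
      mem⁻ p = Equivalence.to (acts periodic) (Act-++⁻ list L p)

      digit : ∀ {a b x} → a < N → b < N → x ∈ₛ K → S L (x ⊕ a · c ⊝ b · c) → a ≡ b × S L x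
      digit {a} {b} a<N b<N x∈ s = a≡b , cancel-digit {S L} {c} {a} {b} a≡b s
        where
        a≡b : a ≡ b
        a≡b = same-digit {K} {c} {N} ord a<N b<N x∈ (S-inside s)

      grow : Grow K L K′ L′
      grow = grow-by list v (⊆-adjoin K c ord) (DigitList.unique digits)
        (λ x∈ → let (j , 0<j , j≤ , p) = near x∈ in
                near-∉ {K} {c} {N} K₀⊆ ord {j = j} 0<j (≤-<-trans (≤-trans j≤ (⌈n/2⌉≤n P)) P<N) p)
        (λ x∈ → let (j , _ , _ , p) = near x∈ in near-∈ {K} {c} {N} K₀⊆ ord j p)
        λ {x} x∈ p → let (j , j≤ , s) = mem⁻ (Act-++⁺ list L p) in
          proj₂ (digit {0} {j} (≤-<-trans z≤n P<N) (≤-<-trans j≤ P<N) x∈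
            (subst (λ y → S L (y ⊝ j · c)) (sym (G.identityʳ x)) s))

      above : ∀ {g a} → a ≤ P → g ⊝ a · c ∈ₛ K → ∃ λ t → t ⊝ g ∈ₛ K × (∀ {x} → x ∈ₛ K → S L x → S L′ (x ⊕ t))
      above {a = a} a≤P p = a · c , ⊝-sym K p , λ {x} _ s → mem⁺ a a≤P (subst (S L) (sym (⊕-⊝ x (a · c))) s)

      lost : ι N ℚ.* dens (S L′) K′ ℚ.+ ι m ℚ.* dens (S L) K ≡ ι N ℚ.* dens (S L) K
      lost = trans (cong (ℚ._+ ι m ℚ.* dens (S L) K) kept)
        (trans (sym (ℚP.*-distribʳ-+ (dens (S L) K) (ι (suc P)) (ι m)))
          (cong (ℚ._* dens (S L) K) (trans (sym (ι-+ (suc P) m)) (cong ι (+-comm (suc P) m)))))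
        where
        count-digits : # (S L′) K′ ≡ suc P * # (S L) K
        count-digits = trans (#-adjoin K c ord) (sumN-head m (suc P)
          (λ {a} a≤P → count-cong (FinSub.elements K) λ {x} x∈ → mk⇔
            (λ s → let (j , j≤ , s′) = mem⁻ s in
               proj₂ (digit {a} {j} (<-≤-trans a≤P P<N) (≤-<-trans j≤ P<N) x∈
                 (subst (λ y → S L (y ⊝ j · c)) (G.comm (a · c) x) s′)))
            (λ s → mem⁺ a (s≤s⁻¹ a≤P) (subst (S L) (solve 2 (λ x a → x := a :+ x :- a) refl x (a · c)) s)))
          λ {a} P<a a<N → count-none (FinSub.elements K) λ {x} x∈ s →
            let (j , j≤ , s′) = mem⁻ s in
            <⇒≢ (≤-<-trans j≤ P<a) (sym (proj₁
              (digit {a} {j} a<N (≤-<-trans j≤ P<N) x∈ (subst (λ y → S L (y ⊝ j · c)) (G.comm (a · c) x) s′)))))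
        kept : ι N ℚ.* dens (S L′) K′ ≡ ι (suc P) ℚ.* dens (S L) K
        kept = ι-cancel-≡ (card-positive K) (begin
          k ℚ.* (ι N ℚ.* d′) ≡⟨ ℚsolve 3 (λ k n d → k :*q (n :*q d) :=q n :*q k :*q d) refl k (ι N) d′ ⟩
          ι N ℚ.* k ℚ.* d′ ≡⟨ cong (ℚ._* d′) (ι-* N (card K)) ⟨
          ι (N * card K) ℚ.* d′ ≡⟨ cong (λ z → ι z ℚ.* d′) (card-adjoin K c ord) ⟨
          ι (card K′) ℚ.* d′ ≡⟨ ι-frac (# (S L′) K′) (card-positive K′) ⟩
          ι (# (S L′) K′) ≡⟨ cong ι count-digits ⟩
          ι (suc P * # (S L) K) ≡⟨ ι-* (suc P) (# (S L) K) ⟩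
          ι (suc P) ℚ.* ι (# (S L) K) ≡⟨ cong (ι (suc P) ℚ.*_) (ι-frac (# (S L) K) (card-positive K)) ⟨
          ι (suc P) ℚ.* (k ℚ.* d) ≡⟨ ℚsolve 3 (λ p k d → p :*q (k :*q d) :=q k :*q (p :*q d)) refl
            (ι (suc P)) k d ⟩
          k ℚ.* (ι (suc P) ℚ.* d) ∎)
          where
          open ≡-Reasoning
          k d d′ : ℚ
          k = ι (card K)
          d = dens (S L) K
          d′ = dens (S L′) K′

    -- m = ⌈N/M²⌉ keeps the proportion m/N of the missing cosets between 1/M² and 1/M.
    missing-digits : ∀ M N → 2 ≤ M → M < N → ∃ λ m → 0 < m × M * m < N × N ≤ M * M * m
    missing-digits M N 2≤M M<N =
      let (m , N≤ , min) = least em (λ m → N ≤ M * M * m) (N , ≤-trans (≤-reflexive (sym (*-identityˡ N)))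
            (*-monoˡ-≤ N (*-mono-≤ (≤-trans (s≤s z≤n) 2≤M) (≤-trans (s≤s z≤n) 2≤M))))
      in go m N≤ min
      where
      go : ∀ m → N ≤ M * M * m → (∀ {k} → k < m → ¬ N ≤ M * M * k) → ∃ λ m → 0 < m × M * m < N × N ≤ M * M * m
      go zero N≤ _ = contradiction (≤-trans M<N (≤-trans N≤ (≤-reflexive (*-zeroʳ (M * M))))) λ ()
      go (suc zero) N≤ _ = 1 , s≤s z≤n , subst (_< N) (sym (*-identityʳ M)) M<N , N≤
      go (suc (suc m)) N≤ min = suc (suc m) , s≤s z≤n , (begin-strict
        M * suc (suc m)   ≤⟨ *-monoʳ-≤ M (≤-trans (s≤s (s≤s (m≤m+n m (m + 0))))
                               (≤-reflexive (cong suc (sym (+-suc m (m + 0)))))) ⟩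
        M * (2 * suc m)   ≤⟨ *-monoʳ-≤ M (*-monoˡ-≤ (suc m) 2≤M) ⟩
        M * (M * suc m)   ≡⟨ *-assoc M M (suc m) ⟨
        M * M * suc m     <⟨ ≰⇒> (min (n<1+n (suc m))) ⟩
        N                 ∎) , N≤
        where open ≤-Reasoning

    -- Applied with large order modulo `stage i` as R, this bounds the orders of all elements of the
    -- preceding stage, hence how far the new cyclic extension reaches into it.
    least-stage : ∀ (R : C → Set) i → (∃ λ c → R c) → (∀ {c} → R c → c ∉ E i) →
                  ∃ λ l′ → i ≤ l′ × (∃ λ c → R c × c ∈ E (suc l′)) × (∀ {c} → R c → c ∉ E l′)
    least-stage R i (c , r) out =
      let (l , found , min) = least em (λ l → ∃ λ c → R c × c ∈ E l)
            (proj₁ (E-cover c) , c , r , proj₂ (E-cover c))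
      in go l found min
      where
      go : ∀ l → (∃ λ c → R c × c ∈ E l) → (∀ {k} → k < l → ¬ ∃ λ c → R c × c ∈ E k) →
           ∃ λ l′ → i ≤ l′ × (∃ λ c → R c × c ∈ E (suc l′)) × (∀ {c} → R c → c ∉ E l′)
      go zero     (c , r , c∈) _   = contradiction (stage-mono {0} {i} z≤n c∈) (out r)
      go (suc l′) (c , r , c∈) min = l′ , i≤l′ , (c , r , c∈) , λ r c∈ → min (n<1+n l′) (_ , r , c∈)
        where
        i≤l′ : i ≤ l′
        i≤l′ = ≮⇒≥ λ l′<i → out r (stage-mono l′<i c∈)

    -- The missing digits are -m, ..., -1 modulo N. If one of them were visible in `stage l′`, then
    -- kc would lie there for some 0 < k ≤ m, although the order n′ of c modulo `stage l′` exceeds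
    -- m. Adding mc shifts the present digits onto the missing ones because 2m ≤ N.
    drop-unbounded : Unbounded → ∀ M → 2 ≤ M → ∃ λ M′ → 0 < M′ × (∀ i L → Valid (stage i) L → Drop One M M′ i L)
    drop-unbounded unb M 2≤M = M * M , *-mono-≤ 1≤M 1≤M , λ i L v → finish-drop (pre i L v)
      where
      1≤M = ≤-trans (s≤s z≤n) 2≤M
      pre : ∀ i L → Valid (stage i) L → PreDrop One M (M * M) i L
      pre i L v =
        let (l′ , i≤l′ , (c , free , c∈) , low) = least-stage (λ c → ∀ {k} → 0 < k → k ≤ M → k · c ∉ E i) i
              (unb i M)
               (λ {c} free c∈ → free (s≤s z≤n) 1≤M (subst (_∈ E i) (sym (G.identityʳ c)) c∈))
            (N , ord)   = order-exists (stage i) (stage (suc l′)) c∈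
            (n′ , ord′) = order-exists (stage l′) (stage (suc l′)) c∈
            (m , 0<m , Mm<N , N≤) = missing-digits M N 2≤M (order-large {stage i} {c} {N} {M} ord free)
        in pre-drop v l′ i≤l′ c c∈ low N ord n′ ord′ m 0<m Mm<N N≤
        where
        pre-drop : Valid (stage i) L → ∀ l′ → i ≤ l′ → ∀ c → c ∈ E (suc l′) →
                   (∀ {x} → (∀ {k} → 0 < k → k ≤ M → k · x ∉ E i) → x ∉ E l′) →
                   ∀ N → Order (stage i) c N → ∀ n′ → Order (stage l′) c n′ →
                   ∀ m → 0 < m → M * m < N → N ≤ M * M * m → PreDrop One M (M * M) i L
        pre-drop v l′ i≤l′ c c∈ low N ord n′ ord′ m 0<m Mm<N N≤ = result (N ∸ suc m)
          (trans (+-suc m (N ∸ suc m)) (m+[n∸m]≡n m<N))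
          where
          m<N : m < N
          m<N = ≤-<-trans (≤-trans (≤-reflexive (sym (*-identityˡ m))) (*-monoˡ-≤ m 1≤M)) Mm<N
          -- Every element of stage l′ has order at most M modulo stage i, so N ≤ M n′.
          N≤Mn′ : N ≤ M * n′
          N≤Mn′ with em {∃ λ k → 0 < k × k ≤ M × k · n′ · c ∈ E i}
          ... | no none = contradiction (Order.multiple ord′) (low λ 0<k k≤M k∈ → none (_ , 0<k , k≤M , k∈))
          ... | yes (k , 0<k , k≤M , k∈) = ≤-trans (≮⇒≥ λ kn′<N →
              Order.minimal ord (*-mono-≤ 0<k (Order.positive ord′)) kn′<N (subst (_∈ E i) (·-* c k n′) k∈))
              (*-monoˡ-≤ n′ k≤M)
          m<n′ : m < n′
          m<n′ = *-cancelˡ-< M m n′ (<-≤-trans Mm<N N≤Mn′)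
          result : ∀ P → m + suc P ≡ N → PreDrop One M (M * M) i L
          result P refl = record
            { l′ = l′ ; K₁ = D.K′ ; L₁ = D.L′ ; q = m · c ; i≤l′ = i≤l′
            ; K₁⊆ = adjoin-⊆ (stage i) c ord {stage (suc l′)} (stage-mono (m≤n⇒m≤1+n i≤l′)) c∈
            ; grow = D.grow
            ; q∈ = ·∈ D.K′ m (generator∈adjoin (stage i) c ord)
            ; q∉ = λ q∈ → Order.minimal ord 0<m m<N (Valid.K₀⊆ v q∈)
            ; visible = visible ; hull = hull ; full = full
            ; small = A.drop-small {M} (<⇒≤ Mm<N) ; large = A.drop-large {M * M} N≤ }
            where
            module D = DropStep (stage i) L v m P ord 0<m
            module A = DropAmount (0≤dens (S L) (stage i)) (dens≤1 (S L) (stage i)) {m} {m + suc P} (Order.positive ord) D.lost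
            visible : ∀ {g} → g ∈ₛ D.K′ → g ∈ E l′ →
                      ∃ λ t → t ⊝ g ∈ E i × (∀ {x} → x ∈ E i → S L x → S D.L′ (x ⊕ t))
            visible g∈ g∈′ with ∈-adjoin⁻ (stage i) c ord g∈
            ... | a , a<N , p with a ≤? P
            ... | yes a≤P = D.above a≤P p
            ... | no a≰P = contradiction
              (subst (_∈ E l′) (sym (·-∸ c (<⇒≤ a<N))) (⊝∈ (stage l′) (stage-mono i≤l′ (Order.multiple ord))
                (∈-⊝ˡ (stage l′) g∈′ (stage-mono i≤l′ p))))
              (Order.minimal ord′ (m<n⇒0<n∸m a<N)
                (≤-<-trans (≤-trans (∸-monoʳ-≤ (m + suc P) (≰⇒> a≰P)) (≤-reflexive (m+n∸n≡m m (suc P)))) m<n′))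
            -- Both j and m + j stay below N for j ≤ P, so no digit wraps around and each coset
            -- still holds a single copy of `S L`. A second multiple of mc could wrap around and
            -- displace the copy by N · c, an element of `stage i`; this is why `One` is used here.
            hull : Below (S L) (stage i) (S D.L′ ⊞ V1 One (m · c)) D.K′
            hull g∈ with ∈-adjoin⁻ (stage i) c ord g∈
            ... | a , a<N , p = a · c , ⊝-sym (stage i) p , λ {x} x∈ → λ
              { (_ , (0 , _ , refl) , s) → let (j , j≤ , s′) = D.mem⁻ s in
                  proj₂ (D.digit {a} {j} a<N (≤-<-trans j≤ D.P<N) x∈
                    (subst (λ y → S L (y ⊝ j · c)) (⊝-𝟘 (x ⊕ a · c)) s′))
              ; (_ , (1 , _ , refl) , s) → let (j , j≤ , s′) = D.mem⁻ s in
                  proj₂ (D.digit {a} {m + j} a<N (+-monoʳ-< m (s≤s j≤)) x∈ (subst (S L)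
                    (trans (solve 4 (λ x a m j → x :+ a :- (m :+ :0) :- j := x :+ a :- (m :+ j)) refl x (a · c)
                      (m · c) (j · c))
                      (cong (x ⊕ a · c ⊝_) (sym (·-+ c m j)))) s′))
              ; (_ , (suc (suc _) , s≤s () , _) , _) }
            m≤1+P : m ≤ suc P
            m≤1+P = +-cancelˡ-≤ m m (suc P) (≤-trans (≤-reflexive (cong (m +_) (sym (+-identityʳ m))))
              (≤-trans (*-monoˡ-≤ m 2≤M) (<⇒≤ Mm<N)))
            full : Above (S L) (stage i) (S D.L′ ⊞ V1 One (m · c)) D.K′
            full g∈ with ∈-adjoin⁻ (stage i) c ord g∈
            ... | a , a<N , p with a ≤? P
            ... | yes a≤P = let (t , tg∈ , f) = D.above a≤P p in t , tg∈ , λ x∈ s → ⊞V1-⊇ One (S D.L′) (m · c) z≤n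
                                  (f x∈ s)
            ... | no a≰P = a · c , ⊝-sym (stage i) p , λ {x} _ s → 1 · m · c , (1 , ≤-refl , refl) ,
              D.mem⁺ (a ∸ m) (≤-trans (∸-monoˡ-≤ m (s≤s⁻¹ (≤-trans a<N (≤-reflexive (+-suc m P)))))
                (≤-reflexive (m+n∸m≡n m P)))
                (subst (S L) (trans (solve 3 (λ x a m → x := x :+ a :- (m :+ :0) :- (a :- m)) refl x (a · c)
                  (m · c))
                  (cong (x ⊕ a · c ⊝ 1 · m · c ⊝_) (sym (·-∸ c (≤-trans m≤1+P (≰⇒> a≰P)))))) s)

    -- Bounded orders: independent elements and groups with one element missing

    open Algebra.Properties.CommutativeMonoid.Mult G.commutativeMonoid using () renaming (×-distrib-+ to ·-distrib-⊕)

    -- The solver proves identities without hypotheses. Writing the difference of the two sides as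
    -- that of a known equation reduces a linear consequence to such an identity.
    shift-≡ : ∀ {a b p q} → a ≡ b → p ⊝ q ≡ a ⊝ b → p ≡ q
    shift-≡ {a} {b} {p} {q} eq shift = trans (sym (⊝-⊕ p q)) (trans (cong (_⊕ q)
      (trans shift (trans (cong (_⊝ b) eq) (⊝-self b)))) (G.identityˡ q))

    ·-⊝ : ∀ n x y → n · (x ⊝ y) ≡ n · x ⊝ n · y
    ·-⊝ n x y = trans (sym (⊕-⊝ (n · (x ⊝ y)) (n · y)))
      (cong (_⊝ n · y) (trans (sym (·-distrib-⊕ (x ⊝ y) y n)) (cong (n ·_) (⊝-⊕ x y))))

    -- A candidate that fails at `j₀` fails at every larger index, so it can be discarded by looking
    -- only beyond `j₀`.
    infinite-pigeonhole : ∀ {A : Set} (Q : A → ℕ → Set) → (∀ {a i j} → i ≤ j → Q a j → Q a i) →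
                          ∀ as → (∀ j → ∃ λ a → a ∈ as × Q a j) → ∃ λ a → a ∈ as × (∀ j → Q a j)
    infinite-pigeonhole Q anti []       h with () ← proj₁ (proj₂ (h 0))
    infinite-pigeonhole Q anti (a ∷ as) h with em {∀ j → Q a j}
    ... | yes always = a , here refl , always
    ... | no ¬always with em {∃ λ j → ¬ Q a j}
    ...   | no none = contradiction (λ j → case-em j) ¬always
      where
      case-em : ∀ j → Q a j
      case-em j with em {Q a j}
      ... | yes q = q
      ... | no ¬q = contradiction (j , ¬q) none
    ...   | yes (j₀ , ¬q) = let (b , b∈ , q) = infinite-pigeonhole Q anti as tail in b , there b∈ , q
      where
      tail : ∀ j → ∃ λ b → b ∈ as × Q b j
      tail j with h (j ⊔ j₀)
      ... | b , here refl , q = contradiction (anti (m≤n⊔m j j₀) q) ¬q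
      ... | b , there b∈ , q  = b , b∈ , anti (m≤m⊔n j j₀) q

    -- `nz≡𝟘` and `outside` together make the sum of ⟨z⟩ and `E i` direct. Hence z has the same
    -- order modulo every subgroup of `stage i`, the trivial one included.
    record Independent (B i : ℕ) : Set where
      field
        z       : C
        n       : ℕ
        n≤B     : 2 + n ≤ B
        1≤n     : 1 ≤ n
        nz≡𝟘    : (2 + n) · z ≡ 𝟘
        outside : ∀ {j} → 0 < j → j < 2 + n → j · z ∉ E i

      order : ∀ {K} → K ⊆ₛ stage i → Order K z (2 + n)
      order {K} K⊆ = record { positive = s≤s z≤n ; multiple = subst (_∈ₛ K) (sym nz≡𝟘) (FinSub.𝟘∈ K)
                            ; minimal = λ 0<j j< j∈ → outside 0<j j< (K⊆ j∈) }

    module Bounded (i₁ B : ℕ) (torsion : ∀ c → ∃ λ k → 0 < k × k ≤ B × k · c ∈ E i₁) where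

      module Minimal (i₀′ : ℕ) where
        i = i₀′ ⊔ i₁

        Deep : ℕ → ℕ → Set
        Deep o j = ∃ λ x → x ⊕ x ∉ E j × o · x ∈ E i

        deep-anti : ∀ {o j k} → j ≤ k → Deep o k → Deep o j
        deep-anti j≤k (x , 2x∉ , ox∈) = x , 2x∉ ∘ stage-mono j≤k , ox∈

        Good : ℕ → Set
        Good o = 0 < o × o ≤ B × (∀ j → Deep o j)

        ∈-range : ∀ {k n} → 0 < k → k ≤ n → k ∈ applyUpTo suc n
        ∈-range {suc k} _ k<n = ∈-applyUpTo⁺ suc k<n

        range-∈ : ∀ {k n} → k ∈ applyUpTo suc n → 0 < k × k ≤ n
        range-∈ k∈ = let (a , a<n , eq) = ∈-applyUpTo⁻ suc k∈ in
          subst (λ k → 0 < k × k ≤ _) (sym eq) (s≤s z≤n , a<n)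

        some-good : ∃ Good
        some-good =
          let (o , o∈ , deep) = infinite-pigeonhole Deep (λ {o} → deep-anti {o}) (applyUpTo suc B) λ j →
                let (x , 2x∉) = unbounded-doubles j
                    (k , 0<k , k≤B , kx∈) = torsion x in
                k , ∈-range 0<k k≤B , x , 2x∉ , stage-mono (m≤n⊔m i₀′ i₁) kx∈
              (0<o , o≤B) = range-∈ o∈ in
          o , 0<o , o≤B , deep

        Escape : ℕ → ℕ → Set
        Escape o j = ∀ {x} → x ⊕ x ∉ E j → ∀ {b} → 0 < b → b < o → b · x ∉ E i

        -- Each b below a minimal good o fails to be deep from some index on. There are finitely
        -- many b, so the pigeonhole principle yields one index that works for all of them.
        escape : ∀ o → o ≤ B → (∀ {b} → b < o → ¬ Good b) → ∃ (Escape o)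
        escape o o≤B minimal with em {∃ (Escape o)}
        ... | yes e   = e
        ... | no none = contradiction (infinite-pigeonhole Deep (λ {o} → deep-anti {o})
          (applyUpTo suc (o ∸ 1)) bad) no-deep
          where
          no-deep : ¬ ∃ λ b → b ∈ applyUpTo suc (o ∸ 1) × (∀ j → Deep b j)
          no-deep (b , b∈ , deep) = let (0<b , b≤) = range-∈ b∈ in
            minimal (<-≤-trans (s≤s b≤) (pred-suc o (≤-trans 0<b b≤)))
              (0<b , ≤-trans b≤ (≤-trans (m∸n≤m o 1) o≤B) , deep)
            where
            pred-suc : ∀ o → 0 < o ∸ 1 → suc (o ∸ 1) ≤ o
            pred-suc (suc o) _ = ≤-refl
          bad : ∀ j → ∃ λ b → b ∈ applyUpTo suc (o ∸ 1) × Deep b j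
          bad j with em {∃ λ b → b ∈ applyUpTo suc (o ∸ 1) × Deep b j}
          ... | yes d = d
          ... | no ¬d = contradiction
            (j , λ {x} 2x∉ {b} 0<b b<o bx∈ → ¬d (b , ∈-range 0<b (∸-monoˡ-≤ 1 b<o) , x , 2x∉ , bx∈)) none

        Value : ℕ → C → ℕ → Set
        Value o v j = ∃ λ x → x ⊕ x ∉ E j × o · x ≡ v

        difference : ∀ o → (∀ j → Deep o j) → ∀ j → ∃ λ z → o · z ≡ 𝟘 × z ⊕ z ∉ E j
        difference o deep j =
          let (v , _ , value) = infinite-pigeonhole (Value o)
                (λ j≤k (x , 2x∉ , eq) → x , 2x∉ ∘ stage-mono j≤k , eq) (E i)
                λ j → let (x , 2x∉ , ox∈) = deep j in o · x , ox∈ , x , 2x∉ , refl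
              (x , _ , ox≡v)   = value j
              -- The second element is taken deep relative to a stage that contains x, so
              -- subtracting 2x cannot bring its double back into `E j`.
              k                = j ⊔ proj₁ (E-cover x)
              x∈               = stage-mono (m≤n⊔m j (proj₁ (E-cover x))) (proj₂ (E-cover x))
              (y , 2y∉ , oy≡v) = value k
          in y ⊝ x , trans (·-⊝ o y x) (trans (cong₂ _⊝_ oy≡v ox≡v) (⊝-self v))
             , λ 2z∈ → 2y∉ (subst (_∈ E k) (solve 2 (λ y x → y :- x :+ (y :- x) :+ (x :+ x) := y :+ y) refl y x)
                 (E-⊕ k (stage-mono (m≤m⊔n j (proj₁ (E-cover x))) 2z∈) (E-⊕ k x∈ x∈)))

        order≥3 : ∀ o → Good o → ∃ λ n → o ≡ 3 + n
        order≥3 0 (() , _)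
        order≥3 1 (_ , _ , deep) = let (x , 2x∉ , x∈) = deep i
                                       x∈′ = subst (_∈ E i) (G.identityʳ x) x∈ in contradiction
                                         (E-⊕ i x∈′ x∈′) 2x∉
        order≥3 2 (_ , _ , deep) = let (x , 2x∉ , 2x∈) = deep i in
          contradiction (subst (_∈ E i) (cong (x ⊕_) (G.identityʳ x)) 2x∈) 2x∉
        order≥3 (suc (suc (suc n))) _ = n , refl

      -- With o minimal such that o x ∈ E i for elements x with 2x arbitrarily deep,
      -- two such x with the same o x have a difference of order exactly o.
      abstract
        independent : ∀ i → Independent B i
        independent i =
          let (o , good , minimal) = least em Good some-good
              (0<o , o≤B , deep)   = good
              (n , o≡3+n)          = order≥3 o good
              (j , escapes)        = escape o o≤B minimal
              (z , oz≡𝟘 , 2z∉)    = difference o deep j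
          in record
            { z = z ; n = suc n ; n≤B = subst (_≤ B) o≡3+n o≤B ; 1≤n = s≤s z≤n
            ; nz≡𝟘 = subst (λ m → m · z ≡ 𝟘) o≡3+n oz≡𝟘
            ; outside = λ 0<b b< b∈ → escapes 2z∉ 0<b (subst (_ <_) (sym o≡3+n) b<) (stage-mono (m≤m⊔n i i₁) b∈) }
          where open Minimal i hiding (i)

      -- S L₁ is S L plus all elements of Q except y, and stage i is a complement of Q in K₁.
      record Punctured (i : ℕ) (L : List C) (size : ℕ) : Set where
        field
          l′ : ℕ
          Q K₁ : FinSub
          L₁ : List C
          y z₁ : C
          i≤l′  : i ≤ l′
          Q⊆    : Q ⊆ₛ K₁
          K₁⊆   : K₁ ⊆ₛ stage (suc l′)
          split : ∀ {g} → g ∈ₛ K₁ → ∃ λ u → u ∈ₛ Q × g ⊝ u ∈ E i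
          Q∩    : ∀ {u} → u ∈ₛ Q → u ∈ E i → u ≡ 𝟘
          y∈    : y ∈ₛ Q
          z₁∈   : z₁ ∈ₛ Q
          y∉    : y ∉ E l′
          2z₁≢𝟘 : z₁ ⊕ z₁ ≢ 𝟘
          grow  : Grow (stage i) L K₁ L₁
          mem⁺  : ∀ {u x} → u ∈ₛ Q → u ≢ y → S L (x ⊝ u) → S L₁ x
          mem⁻  : ∀ {x} → S L₁ x → ∃ λ u → u ∈ₛ Q × u ≢ y × S L (x ⊝ u)
          0<size : 0 < size
          lost  : ι size ℚ.* dens (S L₁) K₁ ℚ.+ ι 1 ℚ.* δ L i ≡ ι size ℚ.* δ L i

        z₁≢𝟘 : z₁ ≢ 𝟘
        z₁≢𝟘 eq = 2z₁≢𝟘 (trans (cong₂ _⊕_ eq eq) (G.identityʳ 𝟘))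

        same-class : Valid (stage i) L → ∀ {u w x} → u ∈ₛ Q → w ∈ₛ Q → x ∈ E i → S L (x ⊕ u ⊝ w) → u ≡ w × S L x
        same-class v {u} {w} {x} u∈ w∈ x∈ s =
          trans (sym (⊝-⊕ u w)) (trans (cong (_⊕ w) u-w≡𝟘) (G.identityˡ w))
          , subst (S L) (trans (G.assoc x u (⊖ w)) (trans (cong (x ⊕_) u-w≡𝟘) (G.identityʳ x))) s
          where
          u-w≡𝟘 : u ⊝ w ≡ 𝟘
          u-w≡𝟘 = Q∩ (⊝∈ Q u∈ w∈)
            (∈-⊕ˡ (stage i) x∈ (subst (_∈ E i) (G.assoc x u (⊖ w)) (Valid.S-inside v s)))

      -- The missing y is regained as (y ⊝ z₁) ⊕ z₁. As `Q` is a group that meets `stage i` only in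
      -- zero, adding any multiple of z₁ merely permutes the classes and never superposes different
      -- copies of `S L`; hence all multiples are permitted.
      punctured⇒pre-drop : ∀ {M M′ i L size} → Valid (stage i) L → M ≤ size → size ≤ M′ →
                           Punctured i L size → PreDrop Any-multiple M M′ i L
      punctured⇒pre-drop {M} {M′} {i} {L} {size} v M≤ ≤M′ pun = record
        { l′ = l′ ; K₁ = K₁ ; L₁ = L₁ ; q = z₁ ; i≤l′ = i≤l′ ; K₁⊆ = K₁⊆ ; grow = grow
        ; q∈ = Q⊆ z₁∈ ; q∉ = λ z₁∈K₀ → z₁≢𝟘 (Q∩ z₁∈ (Valid.K₀⊆ v z₁∈K₀))
        ; visible = visible ; hull = hull ; full = full
        ; small = A.drop-small {M} (≤-trans (≤-reflexive (*-identityʳ M)) M≤)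
        ; large = A.drop-large {M′} (≤-trans ≤M′ (≤-reflexive (sym (*-identityʳ M′)))) }
        where
        open Punctured pun
        module A = DropAmount (0≤dens (S L) (stage i)) (dens≤1 (S L) (stage i)) {1} {size} 0<size lost
        u∼g : ∀ {g u} → g ⊝ u ∈ E i → u ⊝ g ∈ E i
        u∼g = ⊝-sym (stage i)
        keep : ∀ {u x} → u ∈ₛ Q → u ≢ y → S L x → S L₁ (x ⊕ u)
        keep {u} {x} u∈ u≢y s = mem⁺ u∈ u≢y (subst (S L) (sym (⊕-⊝ x u)) s)
        visible : ∀ {g} → g ∈ₛ K₁ → g ∈ E l′ → ∃ λ t → t ⊝ g ∈ E i × (∀ {x} → x ∈ E i → S L x → S L₁ (x ⊕ t))
        visible g∈ g∈′ = let (u , u∈ , p) = split g∈ in u , u∼g p , λ _ → keep u∈ λ u≡y →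
          y∉ (subst (_∈ E l′) u≡y (∈-⊝ˡ (stage l′) g∈′ (stage-mono i≤l′ p)))
        hull : Below (S L) (stage i) (S L₁ ⊞ V1 Any-multiple z₁) K₁
        hull g∈ = let (u , u∈ , p) = split g∈ in u , u∼g p , λ { {x} x∈ (_ , (j , _ , refl) , s) →
          let (w , w∈ , _ , s′) = mem⁻ s in
          proj₂ (same-class v u∈ (FinSub.⊕∈ Q (·∈ Q j z₁∈) w∈) x∈
            (subst (S L) (solve 4 (λ x u j w → x :+ u :- j :- w := x :+ u :- (j :+ w)) refl x u (j · z₁) w) s′)) }
        full : Above (S L) (stage i) (S L₁ ⊞ V1 One z₁) K₁
        full g∈ with u , u∈ , p ← split g∈ with em {u ≡ y}
        ... | no u≢y = u , u∼g p , λ {x} _ s → ⊞V1-⊇ One (S L₁) z₁ z≤n (keep u∈ u≢y s)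
        ... | yes refl = u , u∼g p , λ {x} _ s → 1 · z₁ , (1 , ≤-refl , refl) ,
                subst (S L₁) (solve 3 (λ x u z → x :+ (u :- z) := x :+ u :- (z :+ :0)) refl x u z₁)
                  (keep (⊝∈ Q u∈ z₁∈) (λ eq → z₁≢𝟘 (trans (solve 2 (λ y z → z := y :- (y :- z)) refl u z₁)
                    (trans (cong (u ⊝_) eq) (⊝-self u)))) s)

      trivial : FinSub
      trivial = record
        { elements = 𝟘 ∷ [] ; unique = [] ∷ [] ; 𝟘∈ = here refl
        ; ⊕∈ = λ { (here refl) (here refl) → here (G.identityʳ 𝟘) }
        ; ⊖∈ = λ { (here refl) → here (Algebra.Properties.Group.ε⁻¹≈ε G.group) } }

      trivial⊆ : ∀ K → trivial ⊆ₛ K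
      trivial⊆ K (here refl) = FinSub.𝟘∈ K

      2z≡ : ∀ z → z ⊕ z ≡ 2 · z
      2z≡ z = cong (z ⊕_) (sym (G.identityʳ z))

      first-stage : ∀ i z → z ∉ E i → ∃ λ l′ → i ≤ l′ × z ∈ E (suc l′) × z ∉ E l′
      first-stage i z z∉ =
        let (l′ , i≤l′ , (c , c≡z , c∈) , low) = least-stage (_≡ z) i (z , refl) (λ { refl → z∉ })
        in l′ , i≤l′ , subst (_∈ E (suc l′)) c≡z c∈ , low refl

      puncture : ∀ i L → Valid (stage i) L → ∃ λ size → 1 ≤ size × size ≤ B × Punctured i L size
      puncture i L v = 2 + n , s≤s z≤n , n≤B , record
        { l′ = l′ ; Q = Q ; K₁ = D.K′ ; L₁ = D.L′ ; y = y ; z₁ = z ; i≤l′ = i≤l′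
        ; Q⊆ = adjoin-⊆ trivial z ord₀ {D.K′} (trivial⊆ D.K′) (generator∈adjoin (stage i) z ord)
        ; K₁⊆ = adjoin-⊆ (stage i) z ord {stage (suc l′)} (stage-mono (m≤n⇒m≤1+n i≤l′)) z∈
        ; split = λ g∈ → let (a , _ , p) = ∈-adjoin⁻ (stage i) z ord g∈ in a · z , multiple∈ a , p
        ; Q∩ = λ u∈ u∈E → let (a , a< , p) = ∈-adjoin⁻ trivial z ord₀ u∈ in
                 trans (multiple a p) (vanish a a< (subst (_∈ E i) (multiple a p) u∈E))
        ; y∈ = multiple∈ (1 + n) ; z₁∈ = generator∈adjoin trivial z ord₀
        ; y∉ = λ y∈ → z∉′ (subst (_∈ E l′) (⊕-⊝ z y) (z-from-y y∈))
        ; 2z₁≢𝟘 = λ eq → outside {2} (s≤s z≤n) (s≤s (s≤s 1≤n)) (subst (_∈ E i) (trans (sym eq) (2z≡ z)) (E-𝟘 i))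
        ; grow = D.grow
        ; mem⁺ = λ {u} {x} u∈ u≢y s → let (a , a< , p) = ∈-adjoin⁻ trivial z ord₀ u∈ in
            D.mem⁺ a (s≤s⁻¹ (≤∧≢⇒< (s≤s⁻¹ a<) (λ a≡ → u≢y (trans (multiple a p) (cong (_· z) a≡)))))
              (subst (λ w → S L (x ⊝ w)) (multiple a p) s)
        ; mem⁻ = λ s → let (j , j≤n , s′) = D.mem⁻ s in
            j · z , multiple∈ j , (λ eq → <⇒≢ (s≤s j≤n) (Order.distinct ord₀ (s≤s (m≤n⇒m≤1+n j≤n)) (n<1+n (1 + n))
              (here (trans (cong (_⊝ y) eq) (⊝-self y))))) , s′
        ; 0<size = s≤s z≤n ; lost = D.lost }
        where
        open Independent (independent i)
        ord : Order (stage i) z (2 + n)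
        ord = order id
        ord₀ : Order trivial z (2 + n)
        ord₀ = order (trivial⊆ (stage i))
        Q : FinSub
        Q = adjoin trivial z ord₀
        z∉ : z ∉ E i
        z∉ z∈ = outside {1} (s≤s z≤n) (s≤s (s≤s z≤n)) (subst (_∈ E i) (sym (G.identityʳ z)) z∈)
        fs = first-stage i z z∉
        l′ = proj₁ fs
        i≤l′ = proj₁ (proj₂ fs)
        z∈ = proj₁ (proj₂ (proj₂ fs))
        z∉′ = proj₂ (proj₂ (proj₂ fs))
        module D = DropStep (stage i) L v 1 n ord (s≤s z≤n)
        y : C
        -- This is -z, since (2 + n) z = 0; so y and z lie in the same subgroups, in particular in
        -- the same stages.
        y = (1 + n) · z
        z-from-y : y ∈ E l′ → z ⊕ y ⊝ y ∈ E l′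
        z-from-y y∈ = ⊝∈ (stage l′) (subst (_∈ E l′) (sym nz≡𝟘) (E-𝟘 l′)) y∈
        multiple : ∀ {u} a → u ⊝ a · z ∈ₛ trivial → u ≡ a · z
        multiple {u} a (here eq) = trans (sym (⊝-⊕ u (a · z))) (trans (cong (_⊕ a · z) eq) (G.identityˡ (a · z)))
        multiple∈ : ∀ a → a · z ∈ₛ Q
        multiple∈ a = ·∈ Q a (generator∈adjoin trivial z ord₀)
        vanish : ∀ a → a < 2 + n → a · z ∈ E i → a · z ≡ 𝟘
        vanish zero    _  _   = refl
        vanish (suc a) a< az∈ = contradiction az∈ (outside (s≤s z≤n) a<)

      -- The sums {0, …, n}z + {0, −z − z₁} + {0, z − z₁} reach each of the digits 0, …, n
      -- of z both by az and by az − 2z₁, which fills the gap at y; the digit −1 is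
      -- only reached by −z − z₁, since (2 + n)z = 0.
      module Extend {i : ℕ} {L : List C} {size : ℕ} (v : Valid (stage i) L) (pun : Punctured i L size) where
        open Punctured pun
        open Independent (independent (suc l′)) using (z; n; n≤B; 1≤n; nz≡𝟘; outside; order)

        V₁ : Valid K₁ L₁
        V₁ = Grow.valid grow
        open Valid V₁ using (K₀⊆; periodic)

        N : ℕ
        N = 2 + n

        ord : Order K₁ z N
        ord = order K₁⊆

        ordQ : Order Q z N
        ordQ = order (K₁⊆ ∘ Q⊆)

        K₂ Q₂ : FinSub
        K₂ = adjoin K₁ z ord
        Q₂ = adjoin Q z ordQ

        jz∉Q : ∀ {j} → 0 < j → j < N → j · z ∉ₛ Q
        jz∉Q = Order.minimal ordQ

        jz∉K₁ : ∀ {j} → 0 < j → j < N → j · z ∉ₛ K₁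
        jz∉K₁ = Order.minimal ord

        z∉ : z ∉ E (suc l′)
        z∉ z∈ = outside {1} (s≤s z≤n) (s≤s (s≤s z≤n)) (subst (_∈ E (suc l′)) (sym (G.identityʳ z)) z∈)

        l″ : ℕ
        l″ = proj₁ (first-stage (suc l′) z z∉)
        l′<l″ : suc l′ ≤ l″
        l′<l″ = proj₁ (proj₂ (first-stage (suc l′) z z∉))
        z∈ : z ∈ E (suc l″)
        z∈ = proj₁ (proj₂ (proj₂ (first-stage (suc l′) z z∉)))
        z∉l″ : z ∉ E l″
        z∉l″ = proj₂ (proj₂ (proj₂ (first-stage (suc l′) z z∉)))

        digits : DigitList K₁ z n
        digits = digit-list K₁ K₀⊆ z n λ 0<j j≤ → jz∉K₁ 0<j (s≤s (m≤n⇒m≤1+n j≤))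
        open DigitList digits using (list; near; acts)

        e₁ e₂ y₂ : C
        e₁ = ⊖ z ⊝ z₁
        e₂ = z ⊝ z₁
        y₂ = y ⊝ z₁ ⊝ z

        new L₂ : List C
        new = e₁ ∷ e₂ ∷ list
        L₂ = new ++ L₁

        z₁∈K₁ : z₁ ∈ₛ K₁
        z₁∈K₁ = Q⊆ z₁∈

        z∈Q₂ : z ∈ₛ Q₂
        z∈Q₂ = generator∈adjoin Q z ordQ

        Q⊆Q₂ : Q ⊆ₛ Q₂
        Q⊆Q₂ = ⊆-adjoin Q z ordQ

        -- y₂ lies in the class of -z modulo `Q`. Among the sums of new elements only -z - z₁ is in
        -- that class, arising as e₁ or as e₂ + nz, and reaching y₂ from it would require the
        -- forbidden summand y.
        mem₂⁻ : ∀ {x} → S L₂ x → ∃ λ u → u ∈ₛ Q₂ × u ≢ y₂ × S L (x ⊝ u)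
        mem₂⁻ {x} p = by-cases (Act-++⁻ new L₁ p)
          where
          jz∈ : ∀ j → j · z ∈ₛ Q₂
          jz∈ j = ·∈ Q₂ j z∈Q₂
          e₁∈ : e₁ ∈ₛ Q₂
          e₁∈ = ⊝∈ Q₂ (FinSub.⊖∈ Q₂ z∈Q₂) (Q⊆Q₂ z₁∈)
          e₂∈ : e₂ ∈ₛ Q₂
          e₂∈ = ⊝∈ Q₂ z∈Q₂ (Q⊆Q₂ z₁∈)
          move : ∀ w → w ∈ₛ Q₂ → (∀ {u} → u ∈ₛ Q → u ≢ y → w ⊕ u ≢ y₂) → S L₁ (x ⊝ w) → ∃ λ u →
            u ∈ₛ Q₂ × u ≢ y₂ × S L (x ⊝ u)
          move w w∈ ≢y₂ s = let (u , u∈ , u≢y , s′) = mem⁻ s in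
            w ⊕ u , FinSub.⊕∈ Q₂ w∈ (Q⊆Q₂ u∈) , ≢y₂ u∈ u≢y ,
            subst (S L) (solve 3 (λ x w u → x :- w :- u := x :- (w :+ u)) refl x w u) s′
          by-cases : Act new (S L₁) x → ∃ λ u → u ∈ₛ Q₂ × u ≢ y₂ × S L (x ⊝ u)
          by-cases (inj₁ (inj₁ p)) = let (j , j≤ , s) = Equivalence.to (acts periodic) p in
            move (j · z) (jz∈ j) (λ {u} u∈ _ eq → jz∉Q {suc j} (s≤s z≤n) (s≤s (s≤s j≤)) (subst (_∈ₛ Q)
                (sym (shift-≡ eq (solve 5 (λ y z₁ u z j → z :+ j :- (y :- z₁ :- u) := j :+ u :- (y :- z₁ :- z))
                  refl y z₁ u z (j · z))))
                (⊝∈ Q (⊝∈ Q y∈ z₁∈) u∈))) s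
          by-cases (inj₁ (inj₂ p)) = let (j , j≤ , s) = Equivalence.to (acts periodic) p in
            move (e₂ ⊕ j · z) (FinSub.⊕∈ Q₂ e₂∈ (jz∈ j)) (λ {u} u∈ u≢y eq →
                let eq′ = shift-≡ {p = (2 + j) · z} {y ⊝ u} eq
                      (solve 5 (λ y z₁ u z j → z :+ (z :+ j) :- (y :- u) := z :- z₁ :+ j :+ u :- (y :- z₁ :- z))
                        refl y z₁ u z (j · z)) in
                last-digit j j≤ eq′ u∈ u≢y)
              (subst (S L₁) (solve 3 (λ x e j → x :- e :- j := x :- (e :+ j)) refl x e₂ (j · z)) s)
            where
            last-digit : ∀ j → j ≤ n → ∀ {u} → (2 + j) · z ≡ y ⊝ u → u ∈ₛ Q → u ≢ y → ⊥
            last-digit j j≤ {u} eq u∈ u≢y with j ≟ n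
            ... | no j≢n = jz∉Q (s≤s z≤n) (s≤s (s≤s (≤∧≢⇒< j≤ j≢n))) (subst (_∈ₛ Q) (sym eq) (⊝∈ Q y∈ u∈))
            ... | yes refl = u≢y (sym (shift-≡ (trans (sym eq) nz≡𝟘)
              (solve 2 (λ y u → y :- u := y :- u :- :0) refl y u)))
          by-cases (inj₂ (inj₁ p)) = let (j , j≤ , s) = Equivalence.to (acts periodic) p in
            move (e₁ ⊕ j · z) (FinSub.⊕∈ Q₂ e₁∈ (jz∈ j)) (λ {u} u∈ u≢y eq →
                let eq′ = shift-≡ {p = j · z} {y ⊝ u} eq
                      (solve 5 (λ y z₁ u z j → j :- (y :- u) := :- z :- z₁ :+ j :+ u :- (y :- z₁ :- z)) refl y z₁
                        u z (j · z)) in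
                first-digit j j≤ eq′ u∈ u≢y)
              (subst (S L₁) (solve 3 (λ x e j → x :- e :- j := x :- (e :+ j)) refl x e₁ (j · z)) s)
            where
            first-digit : ∀ j → j ≤ n → ∀ {u} → j · z ≡ y ⊝ u → u ∈ₛ Q → u ≢ y → ⊥
            first-digit zero    _  {u} eq u∈ u≢y = u≢y
              (sym (shift-≡ (sym eq) (solve 2 (λ y u → y :- u := y :- u :- :0) refl y u)))
            first-digit (suc j) j≤ eq u∈ _ = jz∉Q (s≤s z≤n) (s≤s (m≤n⇒m≤1+n j≤))
              (subst (_∈ₛ Q) (sym eq) (⊝∈ Q y∈ u∈))
          by-cases (inj₂ (inj₂ p)) = let (j , j≤ , s) = Equivalence.to (acts periodic) p in
            move (e₁ ⊕ e₂ ⊕ j · z) (FinSub.⊕∈ Q₂ (FinSub.⊕∈ Q₂ e₁∈ e₂∈) (jz∈ j)) (λ {u} u∈ _ eq →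
                jz∉Q {suc j} (s≤s z≤n) (s≤s (s≤s j≤)) (subst (_∈ₛ Q)
                  (sym (shift-≡ eq (solve 5 (λ y z₁ u z j → z :+ j :- (y :+ z₁ :- u) := :- z :- z₁ :+
                    (z :- z₁) :+ j :+ u :- (y :- z₁ :- z)) refl y z₁ u z (j · z))))
                  (⊝∈ Q (FinSub.⊕∈ Q y∈ z₁∈) u∈)))
              (subst (S L₁) (solve 4 (λ x e f j → x :- e :- f :- j := x :- (e :+ f :+ j)) refl x e₁ e₂ (j · z)) s)

        mem₂⁺ : ∀ {u x} → u ∈ₛ Q₂ → u ≢ y₂ → S L (x ⊝ u) → S L₂ x
        mem₂⁺ {u} {x} u∈ u≢y₂ s = let (a , a<N , p) = ∈-adjoin⁻ Q z ordQ u∈ in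
          Act-++⁺ new L₁ (by-cases a a<N p)
          where
          low : ∀ a → a ≤ n → u ⊝ a · z ∈ₛ Q → Act new (S L₁) x
          low a a≤n p with em {u ⊝ a · z ≡ y}
          ... | no ≢y = inj₁ (inj₁ (Equivalence.from (acts periodic) (a , a≤n , mem⁺ p ≢y
                  (subst (S L) (solve 3 (λ x u a → x :- u := x :- a :- (u :- a)) refl x u (a · z)) s))))
          ... | yes ≡y = inj₂ (inj₂ (Equivalence.from (acts periodic) (a , a≤n ,
                  mem⁺ {u ⊝ a · z ⊕ (z₁ ⊕ z₁)} (FinSub.⊕∈ Q p (FinSub.⊕∈ Q z₁∈ z₁∈))
                    (λ eq → 2z₁≢𝟘 (shift-≡ (trans eq (sym ≡y))
                      (solve 2 (λ w z → z :+ z :- :0 := w :+ (z :+ z) :- w) refl (u ⊝ a · z) z₁)))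
                    (subst (S L) (solve 5 (λ x u a z z₁ → x :- u := x :- (:- z :- z₁) :- (z :- z₁) :- a :-
                      (u :- a :+ (z₁ :+ z₁)))
                       refl x u (a · z) z z₁) s))))
          by-cases : ∀ a → a < N → u ⊝ a · z ∈ₛ Q → Act new (S L₁) x
          by-cases a a<N p with a ≤? n
          ... | yes a≤n = low a a≤n p
          ... | no a≰n = inj₂ (inj₁ (Equivalence.from (acts periodic) (0 , z≤n ,
                  mem⁺ {u ⊕ z ⊕ z₁} (FinSub.⊕∈ Q uz∈ z₁∈)
                    (λ eq → u≢y₂ (shift-≡ eq (solve 4 (λ u z z₁ y → u :- (y :- z₁ :- z) := u :+ z :+ z₁ :- y) refl
                      u z z₁ y)))
                    (subst (S L) (solve 4 (λ x u z z₁ → x :- u := x :- (:- z :- z₁) :- :0 :- (u :+ z :+ z₁)) refl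
                      x u z z₁) s))))
            where
            a≡ : a ≡ suc n
            a≡ = ≤-antisym (s≤s⁻¹ a<N) (≰⇒> a≰n)
            uz∈ : u ⊕ z ∈ₛ Q
            uz∈ = subst (_∈ₛ Q) (shift-≡ (cong (u ⊕ z ⊝_) nz≡𝟘)
                    (solve 3 (λ u z a → u :- a :- (u :+ z) := u :+ z :- (z :+ a) :- (u :+ z :- :0)) refl u z
                      (suc n · z)))
                    (subst (λ a → u ⊝ a · z ∈ₛ Q) a≡ p)

        Q₂∩ : ∀ {u} → u ∈ₛ Q₂ → u ∈ E i → u ≡ 𝟘
        Q₂∩ {u} u∈ u∈E = let (a , a<N , p) = ∈-adjoin⁻ Q z ordQ u∈ in go a a<N p
          where
          go : ∀ a → a < N → u ⊝ a · z ∈ₛ Q → u ≡ 𝟘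
          go zero    _   p = Q∩ (subst (_∈ₛ Q) (⊝-𝟘 u) p) u∈E
          go (suc a) a<N p = contradiction (∈-⊝ˡ K₁ (Grow.K⊆ grow u∈E) (Q⊆ p)) (jz∉K₁ (s≤s z≤n) a<N)

        private
          z∉K₁ : z ∉ₛ K₁
          z∉K₁ = z∉ ∘ K₁⊆
          e₁∉ : e₁ ∉ₛ K₁
          e₁∉ e∈ = z∉K₁ (subst (_∈ₛ K₁) (solve 2 (λ z z₁ → :- (:- z :- z₁ :+ z₁) := z) refl z z₁)
                     (FinSub.⊖∈ K₁ (FinSub.⊕∈ K₁ e∈ z₁∈K₁)))
          e₂∉ : e₂ ∉ₛ K₁
          e₂∉ = z∉K₁ ∘ ∈-⊝ʳ K₁ z₁∈K₁
          e₁≢e₂ : e₁ ≢ e₂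
          e₁≢e₂ eq = jz∉K₁ {2} (s≤s z≤n) (s≤s (s≤s 1≤n)) (subst (_∈ₛ K₁)
            (shift-≡ eq (solve 2 (λ z z₁ → :0 :- (z :+ (z :+ :0)) := :- z :- z₁ :- (z :- z₁)) refl z z₁))
              (FinSub.𝟘∈ K₁))
          j≤n : ∀ {j} → j ≤ ⌈ n /2⌉ → j ≤ n
          j≤n j≤ = ≤-trans j≤ (⌈n/2⌉≤n n)
          e₁-fresh : ∀ {x} → x ∈ list → e₁ ≢ x
          e₁-fresh x∈ refl = let (j , _ , j≤ , p) = near x∈ in
            jz∉K₁ {suc j} (s≤s z≤n) (s≤s (s≤s (j≤n j≤))) (subst (_∈ₛ K₁)
              (solve 3 (λ z z₁ j → :- (:- z :- z₁ :- j :+ z₁) := z :+ j) refl z z₁ (j · z))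
              (FinSub.⊖∈ K₁ (FinSub.⊕∈ K₁ (K₀⊆ p) z₁∈K₁)))
          e₂-fresh : ∀ {x} → x ∈ list → e₂ ≢ x
          e₂-fresh x∈ refl = let (j , 0<j , j≤ , p) = near x∈ in go j 0<j (j≤n j≤) p
            where
            go : ∀ j → 0 < j → j ≤ n → ¬ e₂ ⊝ j · z ∈ₛ K₀
            go 1 _ _ p = z₁≢𝟘 (Q∩ z₁∈ (Valid.K₀⊆ v (subst (_∈ₛ K₀)
              (solve 2 (λ z z₁ → :- (z :- z₁ :- (z :+ :0)) := z₁) refl z z₁) (FinSub.⊖∈ K₀ p))))
            go (suc (suc j)) _ j≤ p = jz∉K₁ {suc j} (s≤s z≤n) (s≤s (≤-trans (n≤1+n (suc j)) (m≤n⇒m≤1+n j≤)))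
              (subst (_∈ₛ K₁) (solve 3 (λ z z₁ j → :- (z :- z₁ :- (z :+ (z :+ j)) :+ z₁) := z :+ j) refl z z₁
                (j · z))
                (FinSub.⊖∈ K₁ (FinSub.⊕∈ K₁ (K₀⊆ p) z₁∈K₁)))
          new-∉ : ∀ {x} → x ∈ new → x ∉ₛ K₁
          new-∉ (here refl)         = e₁∉
          new-∉ (there (here refl)) = e₂∉
          new-∉ (there (there x∈))  = let (j , 0<j , j≤ , p) = near x∈ in
            near-∉ {K₁} {z} {N} K₀⊆ ord {j = j} 0<j (s≤s (m≤n⇒m≤1+n (j≤n j≤))) p
          z∈K₂ : z ∈ₛ K₂
          z∈K₂ = generator∈adjoin K₁ z ord
          z₁∈K₂ : z₁ ∈ₛ K₂
          z₁∈K₂ = ⊆-adjoin K₁ z ord z₁∈K₁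
          new-∈ : ∀ {x} → x ∈ new → x ∈ₛ K₂
          new-∈ (here refl)         = ⊝∈ K₂ (FinSub.⊖∈ K₂ z∈K₂) z₁∈K₂
          new-∈ (there (here refl)) = ⊝∈ K₂ z∈K₂ z₁∈K₂
          new-∈ (there (there x∈))  = let (j , _ , _ , p) = near x∈ in near-∈ {K₁} {z} {N} K₀⊆ ord j p

        grow₂ : Grow (stage i) L K₂ L₂
        grow₂ = record
          { K⊆ = ⊆-adjoin K₁ z ord ∘ Grow.K⊆ grow
          ; valid = valid-by {K₁} {L₁} {K₂} new V₁ (⊆-adjoin K₁ z ord)
              ((e₁≢e₂ ∷ All.tabulate e₁-fresh) ∷ All.tabulate e₂-fresh ∷ DigitList.unique digits) new-∉ new-∈
          ; extends = ∈-++⁺ʳ new ∘ Grow.extends grow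
          ; S⊆S = λ s → Act-++⁺ new L₁ (Act-⊇ new (Grow.S⊆S grow s))
          ; restrict = λ {x} x∈ s → let (u , u∈ , _ , s′) = mem₂⁻ s in
              subst (S L) (trans (cong (x ⊝_) (Q₂∩ u∈ (∈-⊝ˡ (stage i) x∈ (Valid.S-inside v s′)))) (⊝-𝟘 x)) s′ }

        Full : SetC
        Full x = ∃ λ u → u ∈ₛ Q × S L (x ⊝ u)

        full-density : dens Full K₁ ≡ δ L i
        full-density = ℚP.≤-antisym
          (dens-Below (S L) (stage i) Full K₁ (Grow.K⊆ grow) λ g∈ → let (u , u∈ , p) = split g∈ in
            u , ⊝-sym (stage i) p , λ x∈ (w , w∈ , s) → proj₂ (same-class v u∈ w∈ x∈ s))
          (dens-Above (S L) (stage i) Full K₁ (Grow.K⊆ grow) λ g∈ → let (u , u∈ , p) = split g∈ in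
            u , ⊝-sym (stage i) p , λ {x} _ s → u , u∈ , subst (S L) (sym (⊕-⊝ x u)) s)

        -- Only the class of -z still has a gap, and there the set is a translate of `S L₁`; the n +
        -- 1 other classes are full. The number of missing elements of the enlarged group thus
        -- remains one.
        total : # (S L₂) K₂ ≡ # (S L₁) K₁ + suc n * # Full K₁
        total = trans (#-adjoin K₁ z ord) (cong₂ _+_ last (sumN-const (suc n) others))
          where
          sumN-const : ∀ m {f v} → (∀ {a} → a < m → f a ≡ v) → sumN m f ≡ m * v
          sumN-const zero    _ = refl
          sumN-const (suc m) h = cong₂ _+_ (h (n<1+n m)) (sumN-const m (λ a<m → h (m<n⇒m<1+n a<m)))
          last : # (λ x → S L₂ (suc n · z ⊕ x)) K₁ ≡ # (S L₁) K₁
          last = trans (count-cong (FinSub.elements K₁) λ {x} x∈ → mk⇔ (to x∈) from) (#-translate {S L₁} K₁ z₁∈K₁)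
            where
            Nz : z ⊕ suc n · z ≡ 𝟘
            Nz = nz≡𝟘
            from : ∀ {x} → S L₁ (x ⊕ z₁) → S L₂ (suc n · z ⊕ x)
            from {x} s = let (u , u∈ , u≢y , s′) = mem⁻ s in
              mem₂⁺ {u ⊝ z₁ ⊝ z} (⊝∈ Q₂ (⊝∈ Q₂ (Q⊆Q₂ u∈) (Q⊆Q₂ z₁∈)) z∈Q₂)
                (λ eq → u≢y (shift-≡ eq (solve 4 (λ u y z₁ z → u :- y := u :- z₁ :- z :- (y :- z₁ :- z)) refl u y
                  z₁ z)))
                (subst (S L) (shift-≡ (sym Nz)
                  (solve 5 (λ x z₁ u a z → x :+ z₁ :- u :- (a :+ x :- (u :- z₁ :- z)) := :0 :- (z :+ a))
                   refl x z₁ u (suc n · z) z)) s′)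
            to : ∀ {x} → x ∈ₛ K₁ → S L₂ (suc n · z ⊕ x) → S L₁ (x ⊕ z₁)
            to {x} x∈ s = let (u , u∈ , u≢y₂ , s′) = mem₂⁻ s in
              mem⁺ {u ⊕ z ⊕ z₁} (uz₁∈ u∈ s′)
                (λ eq → u≢y₂ (shift-≡ eq (solve 4 (λ u z z₁ y → u :- (y :- z₁ :- z) := u :+ z :+ z₁ :- y) refl u z
                  z₁ y)))
                (subst (S L) (shift-≡ Nz (solve 5
                  (λ x z₁ u a z → a :+ x :- u :- (x :+ z₁ :- (u :+ z :+ z₁)) := z :+ a :- :0)
                   refl x z₁ u (suc n · z) z)) s′)
              where
              uz₁∈ : ∀ {u} → u ∈ₛ Q₂ → S L (suc n · z ⊕ x ⊝ u) → u ⊕ z ⊕ z₁ ∈ₛ Q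
              uz₁∈ {u} u∈ s′ = FinSub.⊕∈ Q (subst (_∈ₛ Q) (shift-≡ (sym Nz)
                  (solve 3 (λ u a z → u :- a :- (u :+ z) := :0 :- (z :+ a)) refl u (suc n · z) z))
                    (digit-of (suc n) ≤-refl x∈ u∈ s′)) z₁∈
                where
                digit-of : ∀ a → a < N → ∀ {x u} → x ∈ₛ K₁ → u ∈ₛ Q₂ → S L (a · z ⊕ x ⊝ u) → u ⊝ a · z ∈ₛ Q
                digit-of a a<N {x} {u} x∈ u∈ s = let (b , b<N , p) = ∈-adjoin⁻ Q z ordQ u∈ in
                  subst (λ b → u ⊝ b · z ∈ₛ Q) (sym (Order.distinct ord a<N b<N (subst (_∈ₛ K₁)
                    (solve 4 (λ a x u b → a :+ x :- u :+ (u :- b) :- x := a :- b) refl (a · z) x u (b · z))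
                    (⊝∈ K₁ (FinSub.⊕∈ K₁ (Grow.K⊆ grow (Valid.S-inside v s)) (Q⊆ p)) x∈)))) p
          others : ∀ {a} → a < suc n → # (λ x → S L₂ (a · z ⊕ x)) K₁ ≡ # Full K₁
          others {a} a≤n = count-cong (FinSub.elements K₁) λ {x} x∈ → mk⇔ (to x∈) from
            where
            to : ∀ {x} → x ∈ₛ K₁ → S L₂ (a · z ⊕ x) → Full x
            to {x} x∈ s = let (u , u∈ , _ , s′) = mem₂⁻ s
                              (b , b<N , p) = ∈-adjoin⁻ Q z ordQ u∈
                              a≡b = Order.distinct ord (m<n⇒m<1+n a≤n) b<N (subst (_∈ₛ K₁)
                                (solve 4 (λ a x u b → a :+ x :- u :+ (u :- b) :- x := a :- b) refl (a · z) x u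
                                  (b · z))
                                (⊝∈ K₁ (FinSub.⊕∈ K₁ (Grow.K⊆ grow (Valid.S-inside v s′)) (Q⊆ p)) x∈)) in
              u ⊝ a · z , subst (λ b → u ⊝ b · z ∈ₛ Q) (sym a≡b) p
              , subst (S L) (solve 3 (λ a x u → a :+ x :- u := x :- (u :- a)) refl (a · z) x u) s′
            from : ∀ {x} → Full x → S L₂ (a · z ⊕ x)
            from {x} (u , u∈ , s) = mem₂⁺ {u ⊕ a · z} (FinSub.⊕∈ Q₂ (Q⊆Q₂ u∈) (·∈ Q₂ a z∈Q₂))
              (λ eq → jz∉Q {suc a} (s≤s z≤n) (s≤s a≤n) (subst (_∈ₛ Q)
                 (sym (shift-≡ eq (solve 5 (λ y z₁ u z a → z :+ a :- (y :- z₁ :- u) := u :+ a :- (y :- z₁ :- z))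
                   refl y z₁ u z (a · z))))
                 (⊝∈ Q (⊝∈ Q y∈ z₁∈) u∈)))
              (subst (S L) (solve 3 (λ a x u → x :- u := a :+ x :- (u :+ a)) refl (a · z) x u) s)

        lost₂ : ι (N * size) ℚ.* dens (S L₂) K₂ ℚ.+ ι 1 ℚ.* δ L i ≡ ι (N * size) ℚ.* δ L i
        lost₂ = begin
          ι (N * size) ℚ.* d₂ ℚ.+ ι 1 ℚ.* d
            ≡⟨ cong (λ w → w ℚ.* d₂ ℚ.+ ι 1 ℚ.* d) (trans (cong ι (*-comm N size)) (ι-* size N)) ⟩
          ι size ℚ.* ι N ℚ.* d₂ ℚ.+ ι 1 ℚ.* d
            ≡⟨ cong (ℚ._+ ι 1 ℚ.* d) (trans (ℚP.*-assoc (ι size) (ι N) d₂) (cong (ι size ℚ.*_) average)) ⟩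
          ι size ℚ.* (d₁ ℚ.+ ι (suc n) ℚ.* d) ℚ.+ ι 1 ℚ.* d
            ≡⟨ ℚsolve 5 (λ s d₁ m d o → s :*q (d₁ :+q m :*q d) :+q o :*q d :=q s :*q d₁ :+q o :*q d :+q s :*q m
              :*q d) refl (ι size) d₁ (ι (suc n)) d (ι 1) ⟩
          ι size ℚ.* d₁ ℚ.+ ι 1 ℚ.* d ℚ.+ ι size ℚ.* ι (suc n) ℚ.* d
            ≡⟨ cong (ℚ._+ ι size ℚ.* ι (suc n) ℚ.* d) lost ⟩
          ι size ℚ.* d ℚ.+ ι size ℚ.* ι (suc n) ℚ.* d
            ≡⟨ ℚsolve 3 (λ s m d → s :*q d :+q s :*q m :*q d :=q s :*q (conq 1ℚ :+q m) :*q d) refl (ι size)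
              (ι (suc n)) d ⟩
          ι size ℚ.* (1ℚ ℚ.+ ι (suc n)) ℚ.* d
            ≡⟨ cong (λ w → ι size ℚ.* w ℚ.* d) (trans (cong (ℚ._+ ι (suc n)) (sym ι-1)) (sym (ι-+ 1 (suc n)))) ⟩
          ι size ℚ.* ι N ℚ.* d
            ≡⟨ cong (ℚ._* d) (trans (sym (ι-* size N)) (cong ι (*-comm size N))) ⟩
          ι (N * size) ℚ.* d ∎
          where
          open ≡-Reasoning
          d d₁ d₂ k : ℚ
          d = δ L i
          d₁ = dens (S L₁) K₁
          d₂ = dens (S L₂) K₂
          k = ι (card K₁)
          average : ι N ℚ.* d₂ ≡ d₁ ℚ.+ ι (suc n) ℚ.* d
          average = ι-cancel-≡ (card-positive K₁) (begin
            k ℚ.* (ι N ℚ.* d₂) ≡⟨ ℚsolve 3 (λ k n d → k :*q (n :*q d) :=q n :*q k :*q d) refl k (ι N) d₂ ⟩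
            ι N ℚ.* k ℚ.* d₂ ≡⟨ cong (ℚ._* d₂) (ι-* N (card K₁)) ⟨
            ι (N * card K₁) ℚ.* d₂ ≡⟨ cong (λ w → ι w ℚ.* d₂) (card-adjoin K₁ z ord) ⟨
            ι (card K₂) ℚ.* d₂ ≡⟨ ι-frac (# (S L₂) K₂) (card-positive K₂) ⟩
            ι (# (S L₂) K₂) ≡⟨ cong ι total ⟩
            ι (# (S L₁) K₁ + suc n * # Full K₁)
              ≡⟨ trans (ι-+ (# (S L₁) K₁) (suc n * # Full K₁))
              (cong (ι (# (S L₁) K₁) ℚ.+_) (ι-* (suc n) (# Full K₁))) ⟩
            ι (# (S L₁) K₁) ℚ.+ ι (suc n) ℚ.* ι (# Full K₁)
              ≡⟨ cong₂ (λ a b → a ℚ.+ ι (suc n) ℚ.* b) (ι-frac (# (S L₁) K₁) (card-positive K₁))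
                (ι-frac (# Full K₁) (card-positive K₁)) ⟨
            k ℚ.* d₁ ℚ.+ ι (suc n) ℚ.* (k ℚ.* dens Full K₁)
              ≡⟨ cong (λ w → k ℚ.* d₁ ℚ.+ ι (suc n) ℚ.* (k ℚ.* w)) full-density ⟩
            k ℚ.* d₁ ℚ.+ ι (suc n) ℚ.* (k ℚ.* d)
              ≡⟨ ℚsolve 4 (λ k a n d → k :*q a :+q n :*q (k :*q d) :=q k :*q (a :+q n :*q d)) refl k d₁
                (ι (suc n)) d ⟩
            k ℚ.* (d₁ ℚ.+ ι (suc n) ℚ.* d) ∎)

        punctured₂ : Punctured i L (N * size)
        punctured₂ = record
          { l′ = l″ ; Q = Q₂ ; K₁ = K₂ ; L₁ = L₂ ; y = y₂ ; z₁ = z₁ ; i≤l′ = ≤-trans i≤l′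
            (≤-trans (n≤1+n l′) l′<l″)
          ; Q⊆ = adjoin-⊆ Q z ordQ {K₂} (⊆-adjoin K₁ z ord ∘ Q⊆) (generator∈adjoin K₁ z ord)
          ; K₁⊆ = adjoin-⊆ K₁ z ord {stage (suc l″)} (stage-mono (m≤n⇒m≤1+n l′<l″) ∘ K₁⊆) z∈
          ; split = λ {g} g∈ → let (a , _ , p) = ∈-adjoin⁻ K₁ z ord g∈
                                   (u , u∈ , q) = split p in
              a · z ⊕ u , FinSub.⊕∈ Q₂ (·∈ Q₂ a z∈Q₂) (Q⊆Q₂ u∈)
              , subst (_∈ E i) (solve 3 (λ g a u → g :- a :- u := g :- (a :+ u)) refl g (a · z) u) q
          ; Q∩ = Q₂∩
          ; y∈ = ⊝∈ Q₂ (⊝∈ Q₂ (Q⊆Q₂ y∈) (Q⊆Q₂ z₁∈)) z∈Q₂ ; z₁∈ = Q⊆Q₂ z₁∈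
          ; y∉ = λ y₂∈ → z∉l″ (∈-⊝ˡ (stage l″) (⊝∈ (stage l″) (below y∈) (below z₁∈)) y₂∈)
          ; 2z₁≢𝟘 = 2z₁≢𝟘 ; grow = grow₂ ; mem⁺ = mem₂⁺ ; mem⁻ = mem₂⁻
          ; 0<size = *-mono-≤ (s≤s (z≤n {1 + n})) 0<size ; lost = lost₂ }
          where
          below : ∀ {u} → u ∈ₛ Q → u ∈ E l″
          below u∈ = stage-mono l′<l″ (K₁⊆ (Q⊆ u∈))

      -- The group is enlarged only when its size equals the previous k. The factor is at least 2
      -- and at most `B`, which gives both bounds. They do not involve `i` or `L`, as a uniform M′
      -- demands.
      punctures : ∀ i L → Valid (stage i) L → ∀ k → 1 ≤ k → ∃ λ size →
        k ≤ size × size ≤ k * B × Punctured i L size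
      punctures i L v 1 _ = let (size , 1≤ , ≤B , pun) = puncture i L v in size , 1≤ ,
                                  ≤-trans ≤B (≤-reflexive (sym (+-identityʳ B))) , pun
      punctures i L v (suc (suc k)) _ with punctures i L v (suc k) (s≤s z≤n)
      ... | size , k≤ , ≤kB , pun with m≤n⇒m<n∨m≡n k≤
      ... | inj₁ k< = size , k< , ≤-trans ≤kB (m≤n+m _ B) , pun
      ... | inj₂ refl = N * size , ≤-trans (s≤s (s≤s (m≤m+n k _)))
        (≤-trans (≤-reflexive (double k)) (*-monoˡ-≤ size (s≤s (s≤s (z≤n {n})))))
          , ≤-trans (*-monoˡ-≤ size n≤B) (≤-trans (≤-reflexive (*-comm B size)) (m≤n+m _ B)) , punctured₂
        where
        open Extend {i} {L} {size} v pun using (N; punctured₂)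
        open Independent (independent (suc (Punctured.l′ pun))) using (n; n≤B)
        double : ∀ k → suc (suc (k + k)) ≡ 2 * suc k
        double k = trans (cong suc (sym (+-suc k k))) (cong (λ w → suc k + w) (sym (+-identityʳ (suc k))))

      drop-bounded : 0 < B → ∀ M → 2 ≤ M → ∃ λ M′ →
        0 < M′ × (∀ i L → Valid (stage i) L → Drop Any-multiple M M′ i L)
      drop-bounded 0<B M 2≤M = M * B , *-mono-≤ (≤-trans (s≤s z≤n) 2≤M) 0<B , λ i L v →
        let (size , M≤ , ≤MB , pun) = punctures i L v M (≤-trans (s≤s z≤n) 2≤M) in
        finish-drop (punctured⇒pre-drop {M} {M * B} {i} {L} {size} v M≤ ≤MB pun)

    gadgets : Gadgets
    gadgets with em {Unbounded}
    ... | yes unb = record { ok = One ; ok-0 = z≤n ; drop = drop-unbounded unb ; fill = fill-unbounded unb }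
    ... | no ¬unb = record { ok = Any-multiple ; ok-0 = tt ; drop = drop-bounded 0<B ; fill = fill-any }
      where
      torsion-bound : ∃ λ i → ∃ λ B → ∀ c → ∃ λ k → 0 < k × k ≤ B × k · c ∈ E i
      torsion-bound with em {∃ λ i → ∃ λ B → ∀ c → ∃ λ k → 0 < k × k ≤ B × k · c ∈ E i}
      ... | yes b = b
      ... | no none = contradiction (λ i M → free i M) ¬unb
        where
        free : ∀ i M → ∃ λ c → ∀ {k} → 0 < k → k ≤ M → k · c ∉ E i
        free i M with em {∃ λ c → ∀ {k} → 0 < k → k ≤ M → k · c ∉ E i}
        ... | yes f = f
        ... | no ¬f = contradiction (i , M , λ c → hit c) none
          where
          hit : ∀ c → ∃ λ k → 0 < k × k ≤ M × k · c ∈ E i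
          hit c with em {∃ λ k → 0 < k × k ≤ M × k · c ∈ E i}
          ... | yes p = p
          ... | no ¬p = contradiction (c , λ {k} 0<k k≤M kc∈ → ¬p (k , 0<k , k≤M , kc∈)) ¬f
      open Bounded (proj₁ torsion-bound) (proj₁ (proj₂ torsion-bound)) (proj₂ (proj₂ torsion-bound))
      0<B : 0 < proj₁ (proj₂ torsion-bound)
      0<B = let (k , 0<k , k≤B , _) = proj₂ (proj₂ torsion-bound) 𝟘 in ≤-trans 0<k k≤B

    open Moves gadgets
    open Gadgets gadgets using (ok; ok-0)

    -- Oscillating densities

    record State : Set where
      field
        index : ℕ
        list  : List C
        valid : Valid (stage index) list

      top : ℚ
      top = δ list index

    open State

    record Walk (P : ℚ → Set) (σ τ : State) : Set where
      field
        forward : index σ ≤ index τ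
        grow    : Stage-Grow (index σ) (list σ) (index τ) (list τ)
        along   : ∀ {j} → index σ ≤ j → j ≤ index τ → P (δ (list τ) j)

    walk-refl : ∀ {P σ} → P (top σ) → Walk P σ σ
    walk-refl {P} {σ} p = record { forward = ≤-refl ; grow = grow-refl (valid σ)
      ; along = λ i≤j j≤i → subst (λ j → P (δ (list σ) j)) (≤-antisym i≤j j≤i) p }

    walk-trans : ∀ {P σ τ υ} → Walk P σ τ → Walk P τ υ → Walk P σ υ
    walk-trans {P} {σ} {τ} {υ} v w = record
      { forward = ≤-trans V.forward W.forward ; grow = grow-trans V.grow W.grow
      ; along = λ {j} i≤j j≤k → by-cases j i≤j j≤k (j ≤? index τ) }
      where
      module V = Walk v
      module W = Walk w
      by-cases : ∀ j → index σ ≤ j → j ≤ index υ → Dec (j ≤ index τ) → P (δ (list υ) j)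
      by-cases j i≤j j≤k (yes j≤l) = subst P (sym (δ-stable W.grow j≤l)) (V.along i≤j j≤l)
      by-cases j i≤j j≤k (no j≰l)  = W.along (<⇒≤ (≰⇒> j≰l)) j≤k

    walk-map : ∀ {P Q σ τ} → (∀ {x} → P x → Q x) → Walk P σ τ → Walk Q σ τ
    walk-map f w = record { forward = W.forward ; grow = W.grow ; along = λ i≤j j≤l → f (W.along i≤j j≤l) }
      where module W = Walk w

    path-state : ∀ {i L l L′ lo hi} → Path i L l L′ lo hi → State
    path-state {l = l} {L′} p = record { index = l ; list = L′ ; valid = Grow.valid (Path.grow p) }

    path⇒walk : ∀ {σ l L′ lo hi P} (p : Path (index σ) (list σ) l L′ lo hi) →
                (∀ {x} → lo ℚ.≤ x → x ℚ.≤ hi → P x) → Walk P σ (path-state p)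
    path⇒walk p f = record { forward = R.i≤l ; grow = R.grow ; along = λ i≤j j≤l →
      f (R.above i≤j j≤l) (R.below i≤j j≤l) }
      where module R = Path p

    walk-end : ∀ {P σ τ} → Walk P σ τ → P (top τ)
    walk-end w = Walk.along w (Walk.forward w) ≤-refl

    -- The moves of a sweep may all be empty. One extra stage of equal density after each sweep
    -- makes the indices tend to infinity.
    advance : ∀ {P} σ → P (top σ) → ∃ λ τ → index σ < index τ × top τ ≡ top σ × Walk P σ τ
    advance {P} σ p = τ , n<1+n (index σ) , next-top , record
      { forward = n≤1+n (index σ) ; grow = R.grow ; along = λ {j} i≤j j≤1+i →
        by-cases j i≤j j≤1+i (m≤n⇒m<n∨m≡n j≤1+i) }
      where
      K = stage (index σ)
      K′ = stage (suc (index σ))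
      module R = Settled (settle {K} {list σ} {suc (index σ)} (valid σ) (stage-mono (n≤1+n (index σ))))
      τ : State
      τ = record { index = suc (index σ) ; list = R.L′ ; valid = Grow.valid R.grow }
      next-top : top τ ≡ top σ
      next-top = ℚP.≤-antisym
        (dens-Below (S (list σ)) K (S R.L′) K′ (Grow.K⊆ R.grow)
          (Copies⇒Below {K′} {S (list σ)} {K} {S R.L′} {K′} R.copies))
        (dens-Above (S (list σ)) K (S R.L′) K′ (Grow.K⊆ R.grow)
          (Copies⇒Above {K′} {S (list σ)} {K} {S R.L′} {K′} R.copies))
      by-cases : ∀ j → index σ ≤ j → j ≤ suc (index σ) → j < suc (index σ) ⊎ j ≡ suc (index σ) → P (δ R.L′ j)
      by-cases j i≤j _ (inj₂ refl) = subst P (sym next-top) p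
      by-cases j i≤j _ (inj₁ j≤i)  = subst P (sym (δ-stable R.grow (s≤s⁻¹ j≤i)))
        (subst (λ j → P (δ (list σ) j)) (≤-antisym i≤j (s≤s⁻¹ j≤i)) p)

    S-member : ∀ L {x} → x ∈ L → S L x
    S-member (c ∷ L) (here refl) = inj₂ (Act-⊇ L (⊝-self c))
    S-member (c ∷ L) (there x∈)  = inj₁ (S-member L x∈)

    V-member : ∀ qs {q} → q ∈ qs → VS One qs q
    V-member (q ∷ qs) (here refl) = 1 , ≤-refl ,
      subst (VS One qs) (sym (trans (cong (q ⊝_) (G.identityʳ q)) (⊝-self q))) (V-zero qs)
      where
      V-zero : ∀ qs → VS One qs 𝟘
      V-zero []       = refl
      V-zero (q ∷ qs) = 0 , z≤n , subst (VS One qs) (sym (⊝-𝟘 𝟘)) (V-zero qs)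
    V-member (p ∷ qs) {q} (there q∈) = 0 , z≤n , subst (VS One qs) (sym (⊝-𝟘 q)) (V-member qs q∈)

    dens-all : ∀ X K → (∀ {x} → x ∈ₛ K → X x) → dens X K ≡ 1ℚ
    dens-all X K f = ι-cancel-≡ (card-positive K) (begin
      ι (card K) ℚ.* dens X K ≡⟨ ι-frac (# X K) (card-positive K) ⟩
      ι (# X K)               ≡⟨ cong ι (count-all (FinSub.elements K) f) ⟩
      ι (card K)              ≡⟨ ℚP.*-identityʳ (ι (card K)) ⟨
      ι (card K) ℚ.* 1ℚ       ∎)
      where open ≡-Reasoning

    -- All of `K₀` is put into the set at the start. Its sums are `K₀` itself, so periodicity holds
    -- from here on, and the density begins at 1.
    initial : State
    initial = record { index = i₀ ; list = E i₀ ; valid = record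
      { unique = E-unique i₀ ; inside = id ; K₀⊆ = id
      ; periodic = λ k∈ s → S-member (E i₀) (E-⊕ i₀ (S⊆ K₀ (E i₀) id s) k∈) } }

    initial-density : ∀ {j} → j ≤ i₀ → δ (E i₀) j ≡ 1ℚ
    initial-density {j} j≤ = dens-all (S (E i₀)) (stage j) λ x∈ → S-member (E i₀) (stage-mono j≤ x∈)

    -- Here every element of the stage outside `K₀` serves as a recovery element. The elements of
    -- `K₀` are already sums, being periods of a set that contains zero, so the enlarged set covers
    -- the whole stage.
    fill-up : ∀ M → 0 < M → ∀ σ → ∃ λ τ → Walk (top σ ℚ.≤_) σ τ × 1ℚ ℚ.≤ top τ ℚ.+ frac 1 M
    fill-up M 0<M σ = path-state R.path , path⇒walk R.path (λ lo _ → lo)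
      , subst (ℚ._≤ δ R.L′ R.l ℚ.+ frac 1 M) (dens-all (S (list σ) ⊞ VS One qs) (stage i) everything) R.gain
      where
      i = index σ
      module V = Valid (valid σ)
      outside? : ∀ q → Dec (q ∉ₛ K₀)
      outside? q = em
      qs : List C
      qs = filter outside? (E i)
      module R = Up (up qs M 0<M i (list σ) (valid σ) (∈-filter⁻ outside?))
      S-zero : S (list σ) 𝟘
      S-zero = Act-⊇ (list σ) refl
      everything : ∀ {x} → x ∈ E i → (S (list σ) ⊞ VS One qs) x
      everything {x} x∈ with em {x ∈ₛ K₀}
      ... | yes x∈K₀ = ⊞VS-⊇ One (S (list σ)) z≤n qs (subst (S (list σ)) (G.identityˡ x) (V.periodic x∈K₀ S-zero))
      ... | no x∉K₀ = x , V-member qs (∈-filter⁺ outside? x∈ x∉K₀) , subst (S (list σ)) (sym (⊝-self x)) S-zero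

    record Visit (Hi : ℚ → Set) (σ τ : State) (t ε : ℚ) : Set where
      field
        time   : ℕ
        after  : index σ ≤ time
        before : time ≤ index τ
        upper  : δ (list τ) time ℚ.≤ t ℚ.+ ε
        lower  : t ℚ.≤ δ (list τ) time ⊎ Hi (δ (list τ) time)

    visit-later : ∀ {Hi P σ τ υ t ε} → Walk P τ υ → Visit Hi σ τ t ε → Visit Hi σ υ t ε
    visit-later {Hi} {t = t} {ε} w v = record
      { time = V.time ; after = V.after ; before = ≤-trans V.before W.forward
      ; upper = subst (ℚ._≤ t ℚ.+ ε) (sym same) V.upper
      ; lower = subst (λ x → t ℚ.≤ x ⊎ Hi x) (sym same) V.lower }
      where
      module V = Visit v
      module W = Walk w
      same = δ-stable W.grow V.before

    visit-earlier : ∀ {Hi P σ τ υ t ε} → Walk P σ τ → Visit Hi τ υ t ε → Visit Hi σ υ t ε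
    visit-earlier w v = record { V ; after = ≤-trans (Walk.forward w) V.after }
      where module V = Visit v

    -- Lo x, Aim x and Hi x stand for α ≤ x, α < x and β < x.
    module Targets (Lo Aim Hi : ℚ → Set) (Lo-up : ∀ {x y} → Lo x → x ℚ.≤ y → Lo y) (Hi-up : ∀ {x y} → Hi x → x ℚ.≤ y → Hi y)
                   (Aim⇒Lo : ∀ {x} → Aim x → Lo x) (Hi⇒Lo : ∀ {x} → Hi x → Lo x)
                   (Hi-open : ∀ {x} → Hi x → ∃ λ r → r ℚ.< x × Hi r) where

      Between : ℚ → ℚ → Set
      Between hi x = Lo x × x ℚ.≤ hi

      record Target (b : ℕ) (t : ℚ) (σ : State) : Set where
        field
          τ      : State
          walk   : Walk (Between (top σ)) σ τ
          high   : Hi (top τ)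
          visit  : Aim t → Visit Hi σ τ t (frac 1 b)
          fall : Aim t → Hi t → top τ ℚ.≤ t ℚ.+ frac 1 b

      stay : ∀ b t σ → Hi (top σ) → (Aim t → top σ ℚ.≤ t) → Target b t σ
      stay b t σ high low = record
        { τ = σ ; walk = walk-refl (Hi⇒Lo high , ℚP.≤-refl) ; high = high
        ; visit = λ aim → record { time = index σ ; after = ≤-refl ; before = ≤-refl ; upper = close aim ;
          lower = inj₂ high }
        ; fall = λ aim _ → close aim }
        where
        close : Aim t → top σ ℚ.≤ t ℚ.+ frac 1 b
        close aim = ℚP.≤-trans (low aim) (≤-by (frac 1 b) (0≤frac 1 b) refl)

      -- If t itself is above β, the density is left near t, which over time pushes the peaks
      -- towards β. Otherwise it returns almost to the old value: `Hi` is open, so some r below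
      -- `top σ` still satisfies it, and the loss 1/M is chosen smaller than the distance to r.
      target : ∀ b → 2 ≤ b → ∀ t → 0ℚ ℚ.≤ t → ∀ σ → Hi (top σ) → Target b t σ
      target b 2≤b t 0≤t σ high with em {Aim t} | top σ ℚP.≤? t
      ... | no ¬aim | _     = stay b t σ high λ aim → contradiction aim ¬aim
      ... | yes _ | yes low = stay b t σ high λ _ → low
      ... | yes aim | no ¬low = descend (em {Hi t})
        where
        i = index σ
        L = list σ
        t≤ : t ℚ.≤ top σ
        t≤ = ℚP.<⇒≤ (ℚP.≰⇒> ¬low)
        no-hull : Hull i L [] (top σ)
        no-hull = record
          { qs∈ = λ () ; upper = dens-mono (S L ⊞ VS ok []) (S L) (stage i) (λ _ → ⊞VS-[]⁻ ok (S L))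
          ; lower = dens-mono (S L) (S L ⊞ VS One []) (stage i) (λ _ → ⊞VS-[]⁺ One (S L)) }
        module D = Down (down b 2≤b t (top σ) 0≤t i L [] (valid σ) t≤ no-hull)
        τ : State
        τ = path-state D.path
        t≤τ : t ℚ.≤ top τ
        t≤τ = Path.above D.path (Path.i≤l D.path) ≤-refl
        down-walk : Walk (Between (top σ)) σ τ
        down-walk = path⇒walk D.path λ lo hi → Lo-up (Aim⇒Lo aim) lo , hi
        down-visit : Visit Hi σ τ t (frac 1 b)
        down-visit = record { time = D.l ; after = Path.i≤l D.path ; before = ≤-refl ; upper = D.near ;
          lower = inj₁ t≤τ }
        descend : Dec (Hi t) → Target b t σ
        descend (yes hi) = record
          { τ = τ ; walk = down-walk ; high = Hi-up hi t≤τ ; visit = λ _ → down-visit ; fall = λ _ _ → D.near }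
        descend (no ¬hi) = record
          { τ = υ ; walk = walk-trans down-walk up-walk
          ; high = Hi-up Hi-r (≤-by (top υ ℚ.+ frac 1 M ℚ.- top σ ℚ.+ (top σ ℚ.- r ℚ.- frac 1 M))
              (+-nonNeg (0≤p-q (ℚP.≤-trans (Hull.lower D.hull) U.gain)) (0≤p-q M-small))
              (ℚsolve 4 (λ υ m σ r → υ :=q r :+q (υ :+q m :-q σ :+q (σ :-q r :-q m))) refl (top υ) (frac 1 M)
                (top σ) r))
          ; visit = λ _ → visit-later up-walk down-visit ; fall = λ _ hi → contradiction hi ¬hi }
          where
          r : ℚ
          r = proj₁ (Hi-open high)
          Hi-r : Hi r
          Hi-r = proj₂ (proj₂ (Hi-open high))
          r< : 0ℚ ℚ.< top σ ℚ.- r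
          r< = subst (ℚ._< top σ ℚ.- r) (ℚP.+-inverseʳ r) (ℚP.+-monoˡ-< (ℚ.- r) (proj₁ (proj₂ (Hi-open high))))
          M : ℕ
          M = proj₁ (archimedean r<)
          M-small : frac 1 M ℚ.≤ top σ ℚ.- r
          M-small = proj₂ (proj₂ (archimedean r<))
          module U = Up (up D.qs M (≤-trans (s≤s z≤n) (proj₁ (proj₂ (archimedean r<)))) D.l D.L′ (valid τ) (Hull.qs∈ D.hull))
          υ : State
          υ = path-state U.path
          up-walk : Walk (Between (top σ)) τ υ
          up-walk = path⇒walk {σ = τ} U.path λ lo hi → Lo-up (Aim⇒Lo aim) (ℚP.≤-trans t≤τ lo) ,
            ℚP.≤-trans hi (Hull.upper D.hull)

      record Sweep (b k : ℕ) (σ : State) : Set where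
        field
          τ      : State
          walk   : Walk (Between (top σ)) σ τ
          high   : Hi (top τ)
          visit  : ∀ {a} → a < k → Aim (frac a b) → Visit Hi σ τ (frac a b) (frac 1 b)
          fall : ∀ {a} → a < k → Aim (frac a b) → Hi (frac a b) → top τ ℚ.≤ frac a b ℚ.+ frac 1 b

      sweep : ∀ b → 2 ≤ b → ∀ k σ → Hi (top σ) → Sweep b k σ
      sweep b 2≤b zero    σ high = record
        { τ = σ ; walk = walk-refl (Hi⇒Lo high , ℚP.≤-refl) ; high = high ; visit = λ () ; fall = λ () }
      sweep b 2≤b (suc k) σ high = record
        { τ = T.τ ; walk = walk-trans R.walk last ; high = T.high
        ; visit = λ a<1+k → visit (m≤n⇒m<n∨m≡n (s≤s⁻¹ a<1+k)) ; fall = λ a<1+k →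
          fall (m≤n⇒m<n∨m≡n (s≤s⁻¹ a<1+k)) }
        where
        module R = Sweep (sweep b 2≤b k σ high)
        module T = Target (target b 2≤b (frac k b) (0≤frac k b) R.τ R.high)
        last : Walk (Between (top σ)) R.τ T.τ
        last = walk-map (λ (lo , hi) → lo , ℚP.≤-trans hi (proj₂ (walk-end R.walk))) T.walk
        visit : ∀ {a} → a < k ⊎ a ≡ k → Aim (frac a b) → Visit Hi σ T.τ (frac a b) (frac 1 b)
        visit (inj₁ a<k) aim  = visit-later T.walk (R.visit a<k aim)
        visit (inj₂ refl) aim = visit-earlier R.walk (T.visit aim)
        fall : ∀ {a} → a < k ⊎ a ≡ k → Aim (frac a b) → Hi (frac a b) → top T.τ ℚ.≤ frac a b ℚ.+ frac 1 b
        fall (inj₁ a<k) aim hi  = ℚP.≤-trans (proj₂ (walk-end T.walk)) (R.fall a<k aim hi)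
        fall (inj₂ refl) aim hi = T.fall aim hi

    record Progress (Lo Aim Hi : ℚ → Set) (n : ℕ) (σ τ : State) : Set where
      field
        later : index σ < index τ
        walk  : Walk Lo σ τ
        visit : ∀ {a} → a < 2 + (2 + n) → Aim (frac a (2 + n)) → Visit Hi σ τ (frac a (2 + n)) (frac 1 (2 + n))

    module Limit (Lo Aim : ℚ → Set) (Hi : ℕ → ℚ → Set) (Lo-1 : Lo 1ℚ) (σ : ℕ → State) (σ₀ : σ 0 ≡ initial)
                 (progress : ∀ n → Progress Lo Aim (Hi n) n (σ n) (σ (suc n))) where
      private module P n = Progress (progress n)

      grows : ∀ {m n} → m ≤ n → Stage-Grow (index (σ m)) (list (σ m)) (index (σ n)) (list (σ n))
      grows {m} m≤n = go (≤⇒≤′ m≤n)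
        where
        go : ∀ {n} → m ≤′ n → Stage-Grow (index (σ m)) (list (σ m)) (index (σ n)) (list (σ n))
        go (≤′-reflexive refl) = grow-refl (valid (σ m))
        go (≤′-step m≤n)       = grow-trans (go m≤n) (Walk.grow (P.walk _))

      n≤index : ∀ n → n ≤ index (σ n)
      n≤index zero    = z≤n
      n≤index (suc n) = ≤-trans (s≤s (n≤index n)) (P.later n)

      A Sums : C → Set
      A x = ∃ λ n → x ∈ list (σ n)
      Sums x = ∃ λ n → S (list (σ n)) x

      s : ℕ → ℚ
      s j = dens Sums (stage j)

      Sums-restrict : ∀ {n x} → x ∈ E (index (σ n)) → Sums x → S (list (σ n)) x
      Sums-restrict {n} x∈ (m , p) with ≤-total m n
      ... | inj₁ m≤n = Grow.S⊆S (grows m≤n) p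
      ... | inj₂ n≤m = Grow.restrict (grows n≤m) x∈ p

      s≡δ : ∀ {n j} → j ≤ index (σ n) → s j ≡ δ (list (σ n)) j
      s≡δ {n} {j} j≤ = ℚP.≤-antisym
        (dens-mono Sums (S (list (σ n))) (stage j) (λ x∈ → Sums-restrict (stage-mono j≤ x∈)))
        (dens-mono (S (list (σ n))) Sums (stage j) (λ _ p → n , p))

      s-low : ∀ j → Lo (s j)
      s-low j = subst Lo (sym (s≡δ {j} (n≤index j))) (go j (n≤index j))
        where
        go : ∀ n {j} → j ≤ index (σ n) → Lo (δ (list (σ n)) j)
        go zero    j≤ = subst (λ σ → ∀ {j} → j ≤ index σ → Lo (δ (list σ) j)) (sym σ₀)
          (λ j≤ → subst Lo (sym (initial-density j≤)) Lo-1) j≤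
        go (suc n) {j} j≤ with j ≤? index (σ n)
        ... | yes j≤i = subst Lo (sym (δ-stable (Walk.grow (P.walk n)) j≤i)) (go n j≤i)
        ... | no j≰i  = Walk.along (P.walk n) (<⇒≤ (≰⇒> j≰i)) j≤

      s-visit : ∀ n {a} → a < 2 + (2 + n) → Aim (frac a (2 + n)) →
                ∃ λ j → n ≤ j × s j ℚ.≤ frac a (2 + n) ℚ.+ frac 1 (2 + n) × (frac a (2 + n) ℚ.≤ s j ⊎ Hi n (s j))
      s-visit n {a} a< aim = V.time , ≤-trans (n≤index n) V.after
        , subst (ℚ._≤ frac a (2 + n) ℚ.+ frac 1 (2 + n)) (sym same) V.upper
        , subst (λ x → frac a (2 + n) ℚ.≤ x ⊎ Hi n x) (sym same) V.lower
        where
        module V = Visit (P.visit n a< aim)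
        same = s≡δ {suc n} V.before

    -- Subset sums as sums of repetition-free lists

    SumsOf : SetC → SetC
    SumsOf A x = ∃ λ F → Unique F × All A F × x ≡ foldr _⊕_ 𝟘 F

    sublist : ∀ L → Unique L → ∀ {x} → S L x → ∃ λ F → Unique F × All (_∈ L) F × x ≡ foldr _⊕_ 𝟘 F
    sublist []      _        refl     = [] , [] , [] , refl
    sublist (c ∷ L) (_ ∷ u)  (inj₁ p) = let (F , uF , F⊆ , eq) = sublist L u p in F , uF , All.map there F⊆ , eq
    sublist (c ∷ L) (c∉ ∷ u) {x} (inj₂ p) =
      let (F , uF , F⊆ , eq) = sublist L u p in
      c ∷ F , All.map (λ y∈ c≡y → All.lookup c∉ y∈ c≡y) F⊆ ∷ uF , here refl ∷ All.map there F⊆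
      , trans (solve 2 (λ x c → x := c :+ (x :- c)) refl x c) (cong (c ⊕_) eq)

    remove : ∀ {c} F → Unique F → c ∈ F →
             ∃ λ F′ → Unique F′ × (∀ {y} → y ∈ F′ → y ∈ F × y ≢ c) × foldr _⊕_ 𝟘 F ≡ c ⊕ foldr _⊕_ 𝟘 F′
    remove (c ∷ F) (c∉ ∷ u) (here refl) = F , u , (λ y∈ → there y∈ , λ y≡c → All.lookup c∉ y∈ (sym y≡c)) , refl
    remove {c} (y ∷ F) (y∉ ∷ u) (there c∈) =
      let (F′ , u′ , F′⊆ , eq) = remove F u c∈ in
      y ∷ F′ , All.tabulate (λ z∈ → All.lookup y∉ (proj₁ (F′⊆ z∈))) ∷ u′
      , (λ { (here refl) → here refl , All.lookup y∉ c∈ ; (there z∈) → let (p , q) = F′⊆ z∈ in there p , q })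
      , trans (cong (y ⊕_) eq) (solve 3 (λ y c f → y :+ (c :+ f) := c :+ (y :+ f)) refl y c (foldr _⊕_ 𝟘 F′))

    drop-head : ∀ {c x : C} {L} → x ∈ c ∷ L → x ≢ c → x ∈ L
    drop-head (here x≡c) x≢c = contradiction x≡c x≢c
    drop-head (there x∈) _   = x∈

    S-sum : ∀ L F → Unique F → (∀ {x} → x ∈ F → x ∈ L) → S L (foldr _⊕_ 𝟘 F)
    S-sum []      []      _ _   = refl
    S-sum []      (x ∷ F) _ F⊆ with () ← F⊆ (here refl)
    S-sum (c ∷ L) F       u F⊆ with em {c ∈ F}
    ... | no c∉F = inj₁ (S-sum L F u λ x∈ → drop-head (F⊆ x∈) λ { refl → c∉F x∈ })
    ... | yes c∈F =
      let (F′ , u′ , F′⊆ , eq) = remove F u c∈F in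
      inj₂ (subst (S L) (trans (solve 2 (λ c f → f := c :+ f :- c) refl c (foldr _⊕_ 𝟘 F′))
        (cong (_⊝ c) (sym eq)))
        (S-sum L F′ u′ λ x∈ → drop-head (F⊆ (proj₁ (F′⊆ x∈))) (proj₂ (F′⊆ x∈))))

    -- The cases β < 1, α < β = 1 and α = β = 1

    module Construction (α β : ℝ) (0≤α : 0ᴿ ≤ᴿ α) (α≤β : α ≤ᴿ β) (β≤1 : β ≤ᴿ 1ᴿ) where
      open SubsequentialLimits em α β 0≤α α≤β β≤1 using (Oscillates; least-numerator)

      Solution : Set₁
      Solution = ∃ λ A → Oscillates (λ j → dens (SumsOf A) (stage j))

      Lo Aim : ℚ → Set
      Lo x  = ∀ {r} → r <ᴸ α → r ℚ.≤ x
      Aim x = α <ᵁ x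

      Lo-up : ∀ {x y} → Lo x → x ℚ.≤ y → Lo y
      Lo-up lo x≤y r<α = ℚP.≤-trans (lo r<α) x≤y

      Aim⇒Lo : ∀ {x} → Aim x → Lo x
      Aim⇒Lo α<x r<α = ℚP.<⇒≤ (Cut.L<U α r<α α<x)

      Lo-1 : Lo 1ℚ
      Lo-1 r<α = ℚP.<⇒≤ (β≤1 _ (α≤β _ r<α))

      oscillates-cong : ∀ {s t} → (∀ j → s j ≡ t j) → Oscillates s → Oscillates t
      oscillates-cong {s} {t} eq osc = record
        { low = λ j r<α → subst (_ ℚ.≤_) (eq j) (low j r<α)
        ; high = λ β<ρ → let (J , below) = high β<ρ in J , λ {j} J≤j → subst (ℚ._≤ _) (eq j) (below J≤j)
        ; visit = λ n {a} a< α<a → let (j , n≤j , u , l) = visit n a< α<a in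
            j , n≤j , subst (λ x → x ℚ.≤ frac a (2 + n) ℚ.+ frac 1 (2 + n) ×
              (frac a (2 + n) ℚ.≤ x ⊎ (∀ {q} → q <ᴸ β → q ℚ.< x ℚ.+ frac 1 (2 + n)))) (eq j) (u , l) }
        where open Oscillates osc

      module FromChain (Hi : ℕ → ℚ → Set) (Hi⇒near : ∀ n {x} → Hi n x → ∀ {q} → q <ᴸ β → q ℚ.< x ℚ.+ frac 1 (2 + n))
                       (σ : ℕ → State) (σ₀ : σ 0 ≡ initial)
                       (progress : ∀ n → Progress Lo Aim (Hi n) n (σ n) (σ (suc n))) where
        open Limit Lo Aim Hi Lo-1 σ σ₀ progress public
        open State

        solution : (∀ {ρ} → β <ᵁ ρ → ∃ λ J → ∀ {j} → J ≤ j → s j ℚ.≤ ρ) → Solution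
        solution high = A , oscillates-cong same record
          { low = s-low ; high = high
          ; visit = λ n a< α<a → let (j , n≤j , u , l) = s-visit n a< α<a in j , n≤j , u , near n l }
          where
          near : ∀ n {t x} → t ℚ.≤ x ⊎ Hi n x → t ℚ.≤ x ⊎ (∀ {q} → q <ᴸ β → q ℚ.< x ℚ.+ frac 1 (2 + n))
          near n (inj₁ t≤x) = inj₁ t≤x
          near n (inj₂ hi)  = inj₂ (Hi⇒near n hi)
          gather : ∀ F → All A F → ∃ λ n → ∀ {x} → x ∈ F → x ∈ list (σ n)
          gather []      []             = 0 , λ ()
          gather (x ∷ F) ((m , x∈) ∷ F⊆) = let (n , F∈) = gather F F⊆ in
            m ⊔ n , λ { (here refl) → Grow.extends (grows (m≤m⊔n m n)) x∈ ; (there y∈) →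
              Grow.extends (grows (m≤n⊔m m n)) (F∈ y∈) }
          to : ∀ {x} → Sums x → SumsOf A x
          to (n , p) = let (F , u , F⊆ , eq) = sublist (list (σ n)) (Valid.unique (valid (σ n))) p in
            F , u , All.map (n ,_) F⊆ , eq
          from : ∀ {x} → SumsOf A x → Sums x
          from (F , u , F⊆ , refl) = let (n , F∈) = gather F F⊆ in n , S-sum (list (σ n)) F u F∈
          same : ∀ j → s j ≡ dens (SumsOf A) (stage j)
          same j = ℚP.≤-antisym (dens-mono Sums (SumsOf A) (stage j) (λ _ → to))
            (dens-mono (SumsOf A) Sums (stage j) (λ _ → from))

      module Below1 (β<1 : β <ᵁ 1ℚ) where
        open State
        Hi : ℚ → Set
        Hi x = β <ᵁ x
        Hi⇒Aim : ∀ {x} → Hi x → Aim x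
        Hi⇒Aim = ≤ᴿ⇒U {α} {β} α≤β
        Hi-up : ∀ {x y} → Hi x → x ℚ.≤ y → Hi y
        Hi-up hi x≤y = Cut.U-up≤ β x≤y hi

        Hi-open : ∀ {x} → Hi x → ∃ λ r → r ℚ.< x × Hi r
        Hi-open = Equivalence.to (ℝ.U-open β _)

        Hi⇒Lo : ∀ {x} → Hi x → Lo x
        Hi⇒Lo hi = Aim⇒Lo (Hi⇒Aim hi)

        open Targets Lo Aim Hi Lo-up Hi-up Aim⇒Lo Hi⇒Lo Hi-open

        Hi⇒near : ∀ n {x} → Hi x → ∀ {q} → q <ᴸ β → q ℚ.< x ℚ.+ frac 1 (2 + n)
        Hi⇒near n {x} β<x q<β = ℚP.<-trans (Cut.L<U β q<β β<x) (p<p+r x (0<frac {2 + n} (s≤s z≤n)))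

        HighState : Set
        HighState = ∃ λ σ → Hi (State.top σ)

        record Next (n : ℕ) (σ : HighState) : Set where
          field
            τ        : HighState
            progress : Progress Lo Aim Hi n (proj₁ σ) (proj₁ τ)
            falls    : Walk (ℚ._≤ State.top (proj₁ σ)) (proj₁ σ) (proj₁ τ)
            fall     : ∀ {a} → a < 2 + (2 + n) → Aim (frac a (2 + n)) → Hi (frac a (2 + n)) →
                       State.top (proj₁ τ) ℚ.≤ frac a (2 + n) ℚ.+ frac 1 (2 + n)

        next : ∀ n σ → Next n σ
        next n (σ , high) =
          let module R = Sweep (sweep (2 + n) (s≤s (s≤s z≤n)) (2 + (2 + n)) σ high)
              (τ , later , same , w) = advance {Between (State.top σ)} R.τ (walk-end R.walk)
              walk = walk-trans R.walk w in
          record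
            { τ = τ , subst Hi (sym same) R.high
            ; progress = record { later = ≤-<-trans (Walk.forward R.walk) later ; walk = walk-map proj₁ walk
                                ; visit = λ a< aim → visit-later w (R.visit a< aim) }
            ; falls = walk-map proj₂ walk
            ; fall = λ {a} a< aim hi → subst (ℚ._≤ frac a (2 + n) ℚ.+ frac 1 (2 + n)) (sym same)
              (R.fall a< aim hi) }

        states : ℕ → HighState
        states zero    = initial , subst Hi (sym (initial-density ≤-refl)) β<1
        states (suc n) = Next.τ (next n (states n))

        open FromChain (λ _ → Hi) Hi⇒near (λ n → proj₁ (states n)) refl (λ n → Next.progress (next n (states n)))

        falling : ∀ {m n} → m ≤ n → Walk (ℚ._≤ State.top (proj₁ (states m))) (proj₁ (states m)) (proj₁ (states n))
        falling {m} m≤n = go (≤⇒≤′ m≤n)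
          where
          go : ∀ {n} → m ≤′ n → Walk (ℚ._≤ State.top (proj₁ (states m))) (proj₁ (states m)) (proj₁ (states n))
          go (≤′-reflexive refl) = walk-refl ℚP.≤-refl
          go (≤′-step {n} m≤n)   = walk-trans (go m≤n)
            (walk-map (λ x≤ → ℚP.≤-trans x≤ (walk-end (go m≤n))) (Next.falls (next n (states n))))

        -- Let a/b be β rounded down, with b = 2M. The sweep with denominator b leaves the density
        -- at most (a + 2)/b, which is a/b + 1/M, and a/b ≤ ρ′. Later sweeps never exceed the
        -- density with which they begin.
        high-bound : ∀ {ρ} → β <ᵁ ρ → ∃ λ J → ∀ {j} → J ≤ j → s j ℚ.≤ ρ
        high-bound {ρ} β<ρ =
          let (ρ′ , ρ′<ρ , β<ρ′)   = Equivalence.to (ℝ.U-open β ρ) β<ρ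
              (M , 2≤M , M-small) = archimedean (0<p-q ρ′<ρ) in
          go ρ′ β<ρ′ M 2≤M M-small (M + M ∸ 2) (m+[n∸m]≡n {2} (≤-trans 2≤M (m≤m+n M M)))
          where
          go : ∀ ρ′ → β <ᵁ ρ′ → ∀ M → 2 ≤ M → frac 1 M ℚ.≤ ρ ℚ.- ρ′ → ∀ n → 2 + n ≡ M + M →
               ∃ λ J → ∀ {j} → J ≤ j → s j ℚ.≤ ρ
          go ρ′ β<ρ′ M 2≤M M-small n b≡2M =
            let b = 2 + n
                (a , a<b , β<a+1 , β≮a) = least-numerator b (s≤s z≤n) β (λ q → α≤β q ∘ 0≤α q) b
                                            (subst (β <ᵁ_) (sym (frac-self {b} (s≤s z≤n))) β<1)
                N = suc n
                σ = proj₁ (states N)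
                a≤ρ′ : frac a b ℚ.≤ ρ′
                a≤ρ′ = ℚP.≮⇒≥ λ ρ′<a → β≮a (Cut.U-up β ρ′<a β<ρ′)
                top≤ρ : State.top σ ℚ.≤ ρ
                top≤ρ = ℚP.≤-trans (Next.fall (next n (states n)) (s≤s (m≤n⇒m≤1+n a<b)) (Hi⇒Aim β<a+1) β<a+1)
                  (bound {frac a b} a≤ρ′ (subst (λ x → x ℚ.+ frac 1 b ≡ frac a b ℚ.+ (frac 1 b ℚ.+ frac 1 b))
                    (frac-suc a {b} (s≤s z≤n))
                    (ℚP.+-assoc (frac a b) (frac 1 b) (frac 1 b)))
                      (subst (λ b → frac 1 b ℚ.+ frac 1 b ≡ frac 1 M) (sym b≡2M)
                      (halves (≤-trans (s≤s z≤n) 2≤M)))) in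
            index σ , λ {j} i≤j → let m = N ⊔ j
                                      j≤ = ≤-trans (m≤n⊔m N j) (n≤index m) in
              subst (ℚ._≤ ρ) (sym (s≡δ {m} j≤))
                (ℚP.≤-trans (Walk.along (falling {N} {m} (m≤m⊔n N j)) i≤j j≤) top≤ρ)
            where
            bound : ∀ {a x f} → a ℚ.≤ ρ′ → x ≡ a ℚ.+ f → f ≡ frac 1 M → x ℚ.≤ ρ
            bound {a} a≤ refl refl = ℚP.≤-trans (ℚP.+-mono-≤ a≤ M-small)
              (ℚP.≤-reflexive (ℚsolve 2 (λ r s → s :+q (r :-q s) :=q r) refl ρ ρ′))

        result : Solution
        result = solution high-bound

      module At1 (β≮1 : ¬ β <ᵁ 1ℚ) (α<1 : α <ᵁ 1ℚ) where
        -- For β = 1 no density exceeds β, so the upper threshold becomes the maximum of α and 1 -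
        -- 1/(2 + n). The rational witness r makes openness immediate.
        Hi : ℕ → ℚ → Set
        Hi n x = ∃ λ r → r ℚ.< x × α <ᵁ r × 1ℚ ℚ.≤ r ℚ.+ frac 1 (2 + n)

        Hi-up : ∀ {n x y} → Hi n x → x ℚ.≤ y → Hi n y
        Hi-up (r , r<x , p) x≤y = r , ℚP.<-≤-trans r<x x≤y , p

        Hi-open : ∀ {n x} → Hi n x → ∃ λ r → r ℚ.< x × Hi n r
        Hi-open (r , r<x , p) = let (m , r<m , m<x) = ℚP.<-dense r<x in m , m<x , r , r<m , p

        Hi⇒Lo : ∀ {n x} → Hi n x → Lo x
        Hi⇒Lo (r , r<x , α<r , _) = Aim⇒Lo (Cut.U-up α r<x α<r)

        Hi⇒near : ∀ n {x} → Hi n x → ∀ {q} → q <ᴸ β → q ℚ.< x ℚ.+ frac 1 (2 + n)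
        Hi⇒near n (r , r<x , _ , 1≤) q<β = ℚP.<-trans (ℚP.<-≤-trans (β≤1 _ q<β) 1≤)
          (ℚP.+-monoˡ-< (frac 1 (2 + n)) r<x)

        LowState : Set
        LowState = ∃ λ σ → Lo (State.top σ)

        -- The threshold tightens with n, so every sweep is preceded by a climb towards 1. The
        -- denominator `suc N` makes the remaining error smaller than both the distance to a
        -- rational r with α < r < 1 and 1/(2 + n).
        raise : ∀ n σ → Lo (State.top σ) → ∃ λ τ → Walk Lo σ τ × Hi n (State.top τ)
        raise n σ lo =
          let (r , r<1 , α<r)     = Equivalence.to (ℝ.U-open α 1ℚ) α<1
              (M , 2≤M , M-small) = archimedean (0<p-q r<1)
              b = 2 + n
              N = M ⊔ b
              (τ , w , gain) = fill-up (suc N) (s≤s z≤n) σ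
              t = State.top τ
              f<M = frac-< {M} {suc N} (≤-trans (s≤s z≤n) 2≤M) (s≤s (m≤m⊔n M b))
              f<b = frac-< {b} {suc N} (s≤s z≤n) (s≤s (m≤n⊔m M b))
              r<t = +ℚ-cancelʳ-< (frac 1 (suc N)) r t (ℚP.<-≤-trans (ℚP.+-monoʳ-< r (ℚP.<-≤-trans f<M M-small))
                      (ℚP.≤-trans (ℚP.≤-reflexive (ℚsolve 2 (λ r o → r :+q (o :-q r) :=q o) refl r 1ℚ)) gain))
              o<t = +ℚ-cancelʳ-< (frac 1 b) (1ℚ ℚ.- frac 1 b) t (ℚP.≤-<-trans
                      (ℚP.≤-trans (ℚP.≤-reflexive (ℚsolve 2 (λ o f → o :-q f :+q f :=q o) refl 1ℚ (frac 1 b)))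
                        gain) (ℚP.+-monoʳ-< t f<b))
          in τ , walk-map (Lo-up lo) w , pick r<t o<t α<r
          where
          reach : ∀ {x} → 1ℚ ℚ.- frac 1 (2 + n) ℚ.≤ x → 1ℚ ℚ.≤ x ℚ.+ frac 1 (2 + n)
          reach {x} le = subst (ℚ._≤ x ℚ.+ frac 1 (2 + n))
            (ℚsolve 2 (λ o f → o :-q f :+q f :=q o) refl 1ℚ (frac 1 (2 + n)))
            (ℚP.+-monoˡ-≤ (frac 1 (2 + n)) le)
          pick : ∀ {r t} → r ℚ.< t → 1ℚ ℚ.- frac 1 (2 + n) ℚ.< t → α <ᵁ r → Hi n t
          pick {r} {t} r<t o<t α<r with ℚP.≤-total r (1ℚ ℚ.- frac 1 (2 + n))
          ... | inj₁ r≤o = 1ℚ ℚ.- frac 1 (2 + n) , o<t , Cut.U-up≤ α r≤o α<r , reach ℚP.≤-refl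
          ... | inj₂ o≤r = r , r<t , α<r , reach o≤r

        next : ∀ n (σ : LowState) → ∃ λ (τ : LowState) → Progress Lo Aim (Hi n) n (proj₁ σ) (proj₁ τ)
        next n (σ , lo) =
          let (σ′ , up-walk , high) = raise n σ lo
              module T = Targets Lo Aim (Hi n) Lo-up Hi-up Aim⇒Lo Hi⇒Lo Hi-open
              module R = T.Sweep (T.sweep (2 + n) (s≤s (s≤s z≤n)) (2 + (2 + n)) σ′ high)
              sweep-walk = walk-map proj₁ R.walk
              (τ , later , same , w) = advance {Lo} R.τ (walk-end sweep-walk) in
          (τ , walk-end w) , record
            { later = ≤-<-trans (≤-trans (Walk.forward up-walk) (Walk.forward sweep-walk)) later
            ; walk = walk-trans up-walk (walk-trans sweep-walk w)
            ; visit = λ a< aim → visit-earlier up-walk (visit-later w (R.visit a< aim)) }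

        states : ℕ → LowState
        states zero    = initial , subst Lo (sym (initial-density ≤-refl)) Lo-1
        states (suc n) = proj₁ (next n (states n))

        open FromChain Hi Hi⇒near (λ n → proj₁ (states n)) refl (λ n → proj₂ (next n (states n)))

        result : Solution
        result = solution λ {ρ} β<ρ → 0 , λ {j} _ → ℚP.≤-trans (dens≤1 Sums (stage j))
          (ℚP.≮⇒≥ λ ρ<1 → β≮1 (Cut.U-up β ρ<1 β<ρ))

      -- Here α = β = 1, and the whole group works because each element is the sum of a singleton.
      everything : ¬ α <ᵁ 1ℚ → Solution
      everything α≮1 = (λ _ → ⊤) , oscillates-cong (λ j → sym (dens-all (SumsOf (λ _ → ⊤)) (stage j) λ {x} _ →
          x ∷ [] , [] ∷ [] , tt ∷ [] , sym (G.identityʳ x))) record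
        { low = λ _ r<α → Lo-1 r<α
        ; high = λ {ρ} β<ρ → 0 , λ _ → above (≤ᴿ⇒U {α} {β} α≤β β<ρ)
        ; visit = λ n {a} _ α<a → n , ≤-refl ,
          ℚP.≤-trans (above α<a) (≤-by (frac 1 (2 + n)) (0≤frac 1 (2 + n)) refl)
            , inj₂ λ q<β → ℚP.<-trans (β≤1 _ q<β) (p<p+r 1ℚ (0<frac {2 + n} (s≤s z≤n))) }
        where
        above : ∀ {x} → α <ᵁ x → 1ℚ ℚ.≤ x
        above α<x = ℚP.≮⇒≥ λ x<1 → α≮1 (Cut.U-up α x<1 α<x)

      solve-all : Solution
      solve-all with em {β <ᵁ 1ℚ} | em {α <ᵁ 1ℚ}
      ... | yes β<1 | _       = Below1.result β<1
      ... | no β≮1  | yes α<1 = At1.result β≮1 α<1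
      ... | no _    | no α≮1  = everything α≮1

open Combinatorics using (Setting; module Core)
open import Data.Integer.Base using (+_)
open import Relation.Unary using (Pred; _∈_; Decidable)
open import Defs

-- Transport along the enumeration of the group

module Transport (em : Classical) {c ℓ p} (G : AbelianGroup c ℓ) (countable : IsCountable G)
                 (infinite : ¬ Finite G (Doubles G)) (G• : Filtration G p) where
  open AbelianGroup G using (Carrier; _≈_; setoid) renaming (_∙_ to _+ᴳ_; ε to 0ᴳ; _⁻¹ to -ᴳ_)
  open Filtration G•
  private
    module G = AbelianGroup G
    module M = SetoidMembership setoid
    module MP = SetoidMembershipProperties
    module f = Surjection countable
  f : ℕ → Carrier
  f = f.to

  least-index : ∀ x → ∃ λ n → f n ≈ x × (∀ {m} → m < n → ¬ f m ≈ x)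
  least-index x = least em (λ n → f n ≈ x) (f.strictlySurjective x)

  index : Carrier → ℕ
  index x = proj₁ (least-index x)

  f-index : ∀ x → f (index x) ≈ x
  f-index x = proj₁ (proj₂ (least-index x))

  index-cong : ∀ {x y} → x ≈ y → index x ≡ index y
  index-cong x≈y = ≤-antisym (below x≈y) (below (G.sym x≈y))
    where
    below : ∀ {x y} → x ≈ y → index x ≤ index y
    below {x} {y} x≈y = ≮⇒≥ λ y<x → proj₂ (proj₂ (least-index x)) y<x (G.trans (f-index y) (G.sym x≈y))

  -- Canonical representatives of the classes of `_≈_`: an index that is the least one of its own
  -- value. The equality proof is unique, so elements with the same number are propositionally
  -- equal.
  C : Set
  C = ∃ λ n → index (f n) ≡ n

  φ : Carrier → C
  φ x = index x , index-cong (f-index x)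

  ψ : C → Carrier
  ψ (n , _) = f n

  C-≡ : ∀ {a b : C} → proj₁ a ≡ proj₁ b → a ≡ b
  C-≡ {n , e} {_ , e′} refl = cong (n ,_) (WithK.uip e e′)

  φ-cong : ∀ {x y} → x ≈ y → φ x ≡ φ y
  φ-cong x≈y = C-≡ (index-cong x≈y)

  ψφ : ∀ x → ψ (φ x) ≈ x
  ψφ = f-index

  φψ : ∀ a → φ (ψ a) ≡ a
  φψ (n , e) = C-≡ e

  φ-injective : ∀ {x y} → φ x ≡ φ y → x ≈ y
  φ-injective {x} {y} eq = G.trans (G.sym (ψφ x)) (G.trans (G.reflexive (cong ψ eq)) (ψφ y))

  ψ-injective : ∀ {a b} → ψ a ≈ ψ b → a ≡ b
  ψ-injective {a} {b} eq = trans (sym (φψ a)) (trans (φ-cong eq) (φψ b))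

  infixl 6 _⊕_
  _⊕_ : C → C → C
  a ⊕ b = φ (ψ a +ᴳ ψ b)

  φ-+ : ∀ x y → φ (x +ᴳ y) ≡ φ x ⊕ φ y
  φ-+ x y = φ-cong (G.∙-cong (G.sym (ψφ x)) (G.sym (ψφ y)))

  isAbelianGroup : IsAbelianGroup _≡_ _⊕_ (φ 0ᴳ) (λ a → φ (-ᴳ ψ a))
  isAbelianGroup = record
    { isGroup = record
      { isMonoid = record
        { isSemigroup = record
          { isMagma = record { isEquivalence = isEquivalence ; ∙-cong = cong₂ _⊕_ }
          ; assoc = λ a b c → φ-cong (G.trans (G.∙-congʳ (ψφ _))
            (G.trans (G.assoc _ _ _) (G.∙-congˡ (G.sym (ψφ _))))) }
        ; identity = (λ a → trans (φ-cong (G.trans (G.∙-congʳ (ψφ 0ᴳ)) (G.identityˡ (ψ a)))) (φψ a))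
                   , (λ a → trans (φ-cong (G.trans (G.∙-congˡ (ψφ 0ᴳ)) (G.identityʳ (ψ a)))) (φψ a)) }
      ; inverse = (λ a → φ-cong (G.trans (G.∙-congʳ (ψφ (-ᴳ ψ a))) (G.inverseˡ (ψ a))))
                , (λ a → φ-cong (G.trans (G.∙-congˡ (ψφ (-ᴳ ψ a))) (G.inverseʳ (ψ a))))
      ; ⁻¹-cong = cong (λ a → φ (-ᴳ ψ a)) }
    ; comm = λ a b → φ-cong (G.comm (ψ a) (ψ b)) }

  E : ℕ → List C
  E i = map φ (Finite.elements (finite i))

  private module MC = SetoidMembership (≡.setoid C)

  ∈E⁺ : ∀ {i x} → stage i x → φ x MC.∈ E i
  ∈E⁺ {i} {x} x∈ = MP.∈-map⁺ setoid (≡.setoid C) φ-cong (Equivalence.to (Finite.exact (finite i) x) x∈)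

  ∈E⁻ : ∀ {i x} → φ x MC.∈ E i → stage i x
  ∈E⁻ {i} {x} φx∈ =
    let (y , y∈ , eq) = MP.∈-map⁻ setoid (≡.setoid C) φx∈ in
    IsSubgroup.resp (isSubgroup i) (φ-injective (sym eq)) (Equivalence.from (Finite.exact (finite i) y) y∈)

  ∈Eψ : ∀ {i a} → a MC.∈ E i → stage i (ψ a)
  ∈Eψ {i} {a} a∈ = ∈E⁻ (subst (MC._∈ E i) (sym (φψ a)) a∈)

  -- If one stage contained every double, 2G would be a subset of a finite set cut out by a
  -- predicate that excluded middle decides, hence finite.
  unbounded-doubles : ∀ i → ∃ λ a → ¬ (a ⊕ a MC.∈ E i)
  unbounded-doubles i with em {P = ∃ λ a → ¬ (a ⊕ a MC.∈ E i)}
  ... | yes found = found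
  ... | no none   = contradiction doubles-finite infinite
    where
    inside : ∀ {x} → Doubles G x → stage i x
    inside {x} (g , x≈2g) with em {P = φ g ⊕ φ g MC.∈ E i}
    ... | yes 2g∈ = IsSubgroup.resp (isSubgroup i) (G.sym x≈2g) (∈E⁻ (subst (MC._∈ E i) (sym (φ-+ g g)) 2g∈))
    ... | no 2g∉  = contradiction (φ g , 2g∉) none
    module D = Finite (∩-finite G {S = Doubles G} (λ x → em) (λ x≈y (g , x≈2g) → g , G.trans (G.sym x≈y) x≈2g) (finite i))
    doubles-finite : Finite G (Doubles G)
    doubles-finite = record { elements = D.elements ; unique = D.unique
      ; exact = λ x → mk⇔ (λ d → Equivalence.to (D.exact x) (d , inside d))
        (proj₁ ∘ Equivalence.from (D.exact x)) }

  setting : Setting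
  setting = record
    { em = em ; C = C ; _⊕_ = _⊕_ ; 𝟘 = φ 0ᴳ ; ⊖_ = λ a → φ (-ᴳ ψ a) ; isAbelianGroup = isAbelianGroup ; E = E
    ; E-unique = λ i → SetoidUnique.map⁺ setoid (≡.setoid C) φ-injective (Finite.unique (finite i))
    ; E-𝟘 = λ i → ∈E⁺ (IsSubgroup.0-closed (isSubgroup i))
    ; E-⊕ = λ i a∈ b∈ → ∈E⁺ (IsSubgroup.+-closed (isSubgroup i) (∈Eψ a∈) (∈Eψ b∈))
    ; E-⊖ = λ i a∈ → ∈E⁺ (IsSubgroup.neg-closed (isSubgroup i) (∈Eψ a∈))
    ; E-suc = λ i {a} a∈ → subst (MC._∈ E (suc i)) (φψ a) (∈E⁺ (ascending i (∈Eψ a∈)))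
    ; E-cover = λ a → let (i , a∈) = exhaustive (ψ a) in i , subst (MC._∈ E i) (φψ a) (∈E⁺ a∈)
    ; unbounded-doubles = unbounded-doubles }

  open Core setting using (count; 𝟙[_]; 𝟙-yes; 𝟙-no; dens; SumsOf; module Construction) renaming (stage to stageC)

  φ-sum : ∀ F → φ (foldr _+ᴳ_ 0ᴳ F) ≡ foldr _⊕_ (φ 0ᴳ) (map φ F)
  φ-sum []      = refl
  φ-sum (x ∷ F) = trans (φ-+ x _) (cong (φ x ⊕_) (φ-sum F))

  ψ-sum : ∀ F → ψ (foldr _⊕_ (φ 0ᴳ) F) ≈ foldr _+ᴳ_ 0ᴳ (map ψ F)
  ψ-sum []      = ψφ 0ᴳ
  ψ-sum (a ∷ F) = G.trans (ψφ _) (G.∙-congˡ (ψ-sum F))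

  subset-sums : ∀ (A : C → Set) x → SubsetSums G (A ∘ φ) x ⇔ SumsOf A (φ x)
  subset-sums A x = mk⇔ to from
    where
    to : SubsetSums G (A ∘ φ) x → SumsOf A (φ x)
    to (F , u , F⊆ , x≈) = map φ F , SetoidUnique.map⁺ setoid (≡.setoid C) φ-injective u
      , All.map⁺ F⊆ , trans (φ-cong x≈) (φ-sum F)
    from : SumsOf A (φ x) → SubsetSums G (A ∘ φ) x
    from (F , u , F⊆ , eq) = map ψ F , SetoidUnique.map⁺ (≡.setoid C) setoid ψ-injective u
      , All.map⁺ (All.map (λ {a} → subst A (sym (φψ a))) F⊆) ,
        G.trans (G.sym (ψφ x)) (G.trans (G.reflexive (cong ψ eq)) (ψ-sum F))

  length-filter : ∀ {s} {P : Pred Carrier s} (P? : Decidable P) {X : C → Set} → (∀ x → P x ⇔ X (φ x)) →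
                  ∀ xs → length (filter P? xs) ≡ count X (map φ xs)
  length-filter P? P⇔X []       = refl
  length-filter P? {X} P⇔X (x ∷ xs) with P? x
  ... | yes px = cong₂ _+_ (sym (𝟙-yes (Equivalence.to (P⇔X x) px))) (length-filter P? P⇔X xs)
  ... | no ¬px = cong₂ _+_ (sym (𝟙-no (¬px ∘ Equivalence.from (P⇔X x)))) (length-filter P? P⇔X xs)

  density≡dens : ∀ A i → density G G• (λ x → em {P = SubsetSums G (A ∘ φ) x}) (SubsetSums-resp G (A ∘ φ)) i
                         ≡ dens (SumsOf A) (stageC i)
  density≡dens A i = trans (frac-/ _ (length xs) {{card-stage-nonZero G G• i}})
    (cong₂ frac (length-filter _ (subset-sums A) xs) (sym (length-map φ xs)))
    where xs = Finite.elements (finite i)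

  sublimit-cong : ∀ {s t : ℕ → ℚ} {γ} → (∀ i → s i ≡ t i) → IsSubsequentialLimit s γ → IsSubsequentialLimit t γ
  sublimit-cong {γ = γ} eq (ι , mono , conv) = ι , mono , λ ε 0<ε → let (N , close) = conv ε 0<ε in
    N , λ n N≤n → subst (λ x → x ℚ.- ε <ᴸ γ × γ <ᵁ x ℚ.+ ε) (eq (ι n)) (close n N≤n)

  theorem : (α β : ℝ) → 0ᴿ ≤ᴿ α → α ≤ᴿ β → β ≤ᴿ 1ᴿ →
            Σ (Pred Carrier 0ℓ) λ A → A Respects _≈_ × (∀ (γ : ℝ) → γ ∈ 𝓛 G G• em A ⇔ γ ∈ Interval α β)
  theorem α β 0≤α α≤β β≤1 = A ∘ φ , (λ x≈y → subst A (φ-cong x≈y)) , λ γ → mk⇔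
    (λ (_ , _ , lim) → Equivalence.to (limits γ) (sublimit-cong {γ = γ} (density≡dens A) lim))
    (λ γ∈ → (λ q → proj₁ γ∈ q ∘ 0≤α q) , (λ q → β≤1 q ∘ proj₂ γ∈ q)
           , sublimit-cong {γ = γ} (sym ∘ density≡dens A) (Equivalence.from (limits γ) γ∈))
    where
    open Construction α β 0≤α α≤β β≤1 using (solve-all)
    A : C → Set
    A = proj₁ solve-all
    limits : ∀ γ → IsSubsequentialLimit (λ j → dens (SumsOf A) (stageC j)) γ ⇔ Interval α β γ
    limits = SubsequentialLimits.limits⇔interval em α β 0≤α α≤β β≤1 (proj₂ solve-all)

theorem1p3 : (em : Classical) →
    ∀ {c ℓ p} (G : AbelianGroup c ℓ) →
    IsCountable G →
    IsLocallyFinite G →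
    ¬ Finite G (Doubles G) →
    (G• : Filtration G p) →
    (α β : ℝ) → 0ᴿ ≤ᴿ α → α ≤ᴿ β → β ≤ᴿ 1ᴿ →
    Σ (Pred (AbelianGroup.Carrier G) 0ℓ) λ A →
    A Respects (AbelianGroup._≈_ G) ×
    (∀ (γ : ℝ) → γ ∈ 𝓛 G G• em A ⇔ γ ∈ Interval α β)
theorem1p3 em G countable _ infinite G• = Transport.theorem em G countable infinite G•
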